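{- Let $\mathcal{L}\in\{\mathcal{EL},\mathcal{EL}_\bot,\mathcal{ELI},\mathcal{ELI}_\bot\}$. Then $(\mathcal{L},\text{AQ})$-ontology fitting, i.e. the problem to decide, given a collection $E=(E^+,E^-)$ of labeled ABox-AQ examples, whether there is an $\mathcal{L}$-ontology that fits $E$, is in $\mathrm{PTime}$.
   Context: Let $\mathsf{N_C},\mathsf{N_R},\mathsf{N_I}$ be countably infinite sets of concept names, role names and individual names. A role is a role name $r$ or an inverse role $r^-$. $\mathcal{ELI}_\bot$-concepts are built by $C,D::=\top\mid\bot\mid A\mid C\sqcap D\mid\exists r.C$ with $A\in\mathsf{N_C}$, $r$ a role; $\mathcal{EL}_\bot$-concepts are those without inverse roles; $\mathcal{EL}$-/$\mathcal{ELI}$-concepts are $\mathcal{EL}_\bot$-/$\mathcal{ELI}_\bot$-concepts without $\bot$. An $\mathcal{L}$-ontology is a finite set of concept inclusions $C\sqsubseteq D$ with $C,D$ $\mathcal{L}$-concepts. An ABox is a finite nonempty set of assertions $A(a)$, $r(a,b)$ with $A\in\mathsf{N_C}$, $r\in\mathsf{N_R}$, $a,b\in\mathsf{N_I}$; $\mathsf{ind}(\mathcal{A})$ is its set of individual names. Interpretations have non-empty domain and the usual semantics; $\mathcal{I}$ satisfies $C\sqsubseteq D$ if $C^{\mathcal I}\subseteq D^{\mathcal I}$, $A(a)$ if $a\in A^{\mathcal I}$, $r(a,b)$ if $(a,b)\in r^{\mathcal I}$ (standard names). A model of an ontology or ABox satisfies all its members. An atomic query (AQ) is $Q(a)$ with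 $Q\in\mathsf{N_C}$, $a\in\mathsf{N_I}$; $\mathcal{A}\cup\mathcal{O}\models Q(a)$ means $a\in Q^{\mathcal I}$ for all common models $\mathcal{I}$ of $\mathcal{A}$ and $\mathcal{O}$. An ABox-AQ example is a pair $(\mathcal{A},Q(a))$ with $a\in\mathsf{ind}(\mathcal{A})$. A collection of labeled examples is a pair $E=(E^+,E^-)$ of finite sets of examples (all ABoxes assumed to have pairwise disjoint sets of individual names). $\mathcal{O}$ fits $E$ if $\mathcal{A}\cup\mathcal{O}\models q$ for all $(\mathcal{A},q)\in E^+$ and $\mathcal{A}\cup\mathcal{O}\not\models q$ for all $(\mathcal{A},q)\in E^-$. -}

module Defs where

open import Data.Bool using (Bool; true; false; T)
open import Data.List using (List; []; _∷_; [_]; _++_; map; concatMap; length)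
open import Data.List.Membership.Propositional using (_∈_)
open import Data.List.NonEmpty using (List⁺; toList)
open import Data.List.Relation.Binary.Disjoint.Propositional using (Disjoint)
open import Data.List.Relation.Unary.All using (All)
open import Data.List.Relation.Unary.AllPairs using (AllPairs)
open import Data.Maybe using (Maybe; just; nothing)
open import Data.Nat using (ℕ; suc; _+_; _*_; _^_)
open import Data.Nat.GeneralisedArithmetic using (iterate)
open import Data.Fin using (Fin)
open import Data.Product using (∃; ∃₂; _×_; _,_)
open import Data.Sum using (_⊎_; inj₁)
open import Data.Unit using (⊤)
open import Data.Vec as Vec using (Vec)
open import Function using (_↔_; _∘_; flip)
open import Function.Definitions using (Injective)
open import Level using (0ℓ)
open import Relation.Binary using (Rel)
open import Relation.Binary.PropositionalEquality using (_≡_; _≢_)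
open import Relation.Nullary using (¬_)
open import Relation.Nullary.Reflects using (Reflects)
open import Relation.Unary using (Pred; _⊆_; _∩_; ∅; Satisfiable)

Finite : Set → Set
Finite A = ∃ λ n → A ↔ Fin n

data Move : Set where
  left stay right : Move

record TM (Σ : Set) : Set₁ where
  field
    State           : Set
    finite-State    : Finite State
    Γ               : Set
    finite-Γ        : Finite Γ
    blank           : Γ
    input           : Σ → Γ
    input-injective : Injective _≡_ _≡_ input
    input≢blank     : ∀ s → input s ≢ blank
    work-tapes      : ℕ
    start           : State
    -- just true: accepting, just false: rejecting, nothing: not halting
    verdict         : State → Maybe Bool
    δ               : State → Vec Γ (suc work-tapes) →
                      State × Vec (Γ × Move) (suc work-tapes)

module Run {Σ : Set} (M : TM Σ) where
  open TM M

  -- A two-way infinite tape that is blank outside a finite portion; both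
  -- lists start with the cell next to the head.
  record Tape : Set where
    constructor tape
    field
      before : List Γ
      head   : Γ
      after  : List Γ

  act : Γ × Move → Tape → Tape
  act (g , left)  (tape []       _ rs)       = tape [] blank (g ∷ rs)
  act (g , left)  (tape (l ∷ ls) _ rs)       = tape ls l (g ∷ rs)
  act (g , stay)  (tape ls       _ rs)       = tape ls g rs
  act (g , right) (tape ls       _ [])       = tape (g ∷ ls) blank []
  act (g , right) (tape ls       _ (r ∷ rs)) = tape (g ∷ ls) r rs

  record Config : Set where
    constructor config
    field
      state : State
      tapes : Vec Tape (suc work-tapes)

  step : Config → Config
  step (config q ts) with verdict q
  ... | just _  = config q ts
  ... | nothing with δ q (Vec.map Tape.head ts)
  ...   | q′ , as = config q′ (Vec.zipWith act as ts)

  inputTape : List Σ → Tape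
  inputTape []      = tape [] blank []
  inputTape (s ∷ w) = tape [] (input s) (map input w)

  initial : List Σ → Config
  initial w = config start
    (inputTape w Vec.∷ Vec.replicate work-tapes (tape [] blank []))

  HaltsWithin : ℕ → List Σ → Bool → Set
  HaltsWithin t w b =
    verdict (Config.state (iterate step (initial w) t)) ≡ just b

-- The input alphabet Σ is necessarily finite, since it embeds into Γ.
InPTime : ∀ {ℓ} {Σ : Set} → Pred (List Σ) ℓ → Set _
InPTime {Σ = Σ} L =
  ∃ λ (M : TM Σ) → ∃₂ λ (c k : ℕ) → ∀ w → ∃ λ (b : Bool) →
    Run.HaltsWithin M (c * length w ^ k + c) w b × Reflects (L w) b

-- Names are bit strings, so that they have an evident size in inputs.
N-C N-R N-I : Set
N-C = List Bool
N-R = List Bool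
N-I = List Bool

data Role : Set where
  name inverse : N-R → Role

infixr 6 _⊓_
infix 5 _⊑_

data Concept : Set where
  ⊤ᶜ ⊥ᶜ : Concept
  atom  : N-C → Concept
  _⊓_   : Concept → Concept → Concept
  ∃ᶜ    : Role → Concept → Concept

data DL : Set where
  EL EL⊥ ELI ELI⊥ : DL

admits-⊥ : DL → Bool
admits-⊥ EL   = false
admits-⊥ EL⊥  = true
admits-⊥ ELI  = false
admits-⊥ ELI⊥ = true

admits-inverse : DL → Bool
admits-inverse EL   = false
admits-inverse EL⊥  = false
admits-inverse ELI  = true
admits-inverse ELI⊥ = true

IsRole : DL → Role → Set
IsRole L (name r)    = ⊤
IsRole L (inverse r) = T (admits-inverse L)

IsConcept : DL → Concept → Set
IsConcept L ⊤ᶜ       = ⊤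
IsConcept L ⊥ᶜ       = T (admits-⊥ L)
IsConcept L (atom A) = ⊤
IsConcept L (C ⊓ D)  = IsConcept L C × IsConcept L D
IsConcept L (∃ᶜ R C) = IsRole L R × IsConcept L C

data Inclusion : Set where
  _⊑_ : Concept → Concept → Inclusion

Ontology : Set
Ontology = List Inclusion

IsInclusion : DL → Inclusion → Set
IsInclusion L (C ⊑ D) = IsConcept L C × IsConcept L D

IsOntology : DL → Ontology → Set
IsOntology L = All (IsInclusion L)

data Assertion : Set where
  concept : N-C → N-I → Assertion
  role    : N-R → N-I → N-I → Assertion

ABox : Set
ABox = List⁺ Assertion

individuals : Assertion → List N-I
individuals (concept A a) = [ a ]
individuals (role r a b)  = a ∷ b ∷ []

ind : ABox → List N-I
ind = concatMap individuals ∘ toList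

-- The domain Δ is an arbitrary set of individual names and other objects.
-- Standard names: an individual name denotes itself, and need not be in Δ.
record Interpretation : Set₁ where
  field
    Other : Set

  Element : Set
  Element = N-I ⊎ Other

  field
    Δ        : Pred Element 0ℓ
    nonempty : Satisfiable Δ
    conceptᴵ : N-C → Pred Element 0ℓ
    roleᴵ    : N-R → Rel Element 0ℓ
    concept⊆ : ∀ A → conceptᴵ A ⊆ Δ
    role⊆    : ∀ r {d e} → roleᴵ r d e → Δ d × Δ e

module _ (I : Interpretation) where
  open Interpretation I

  ⟦_⟧ᴿ : Role → Rel Element 0ℓ
  ⟦ name r ⟧ᴿ    = roleᴵ r
  ⟦ inverse r ⟧ᴿ = flip (roleᴵ r)

  ⟦_⟧ : Concept → Pred Element 0ℓ
  ⟦ ⊤ᶜ ⟧       = Δ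
  ⟦ ⊥ᶜ ⟧       = ∅
  ⟦ atom A ⟧   = conceptᴵ A
  ⟦ C ⊓ D ⟧    = ⟦ C ⟧ ∩ ⟦ D ⟧
  ⟦ ∃ᶜ R C ⟧ d = ∃ λ e → ⟦ R ⟧ᴿ d e × ⟦ C ⟧ e

  SatisfiesInclusion : Inclusion → Set
  SatisfiesInclusion (C ⊑ D) = ⟦ C ⟧ ⊆ ⟦ D ⟧

  SatisfiesAssertion : Assertion → Set
  SatisfiesAssertion (concept A a) = conceptᴵ A (inj₁ a)
  SatisfiesAssertion (role r a b)  = roleᴵ r (inj₁ a) (inj₁ b)

  ModelOfOntology : Ontology → Set
  ModelOfOntology = All SatisfiesInclusion

  ModelOfABox : ABox → Set
  ModelOfABox = All SatisfiesAssertion ∘ toList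

record AQ : Set where
  constructor aq
  field
    queryName  : N-C
    individual : N-I

infix 4 _∪_⊨_

_∪_⊨_ : ABox → Ontology → AQ → Set₁
𝒜 ∪ 𝒪 ⊨ aq Q a = ∀ I → ModelOfABox I 𝒜 → ModelOfOntology I 𝒪 →
  Interpretation.conceptᴵ I Q (inj₁ a)

record Example : Set where
  field
    abox      : ABox
    query     : AQ
    query∈ind : AQ.individual query ∈ ind abox

record Collection : Set where
  field
    positive negative : List Example
    disjoint-inds     : AllPairs
      (λ e f → Disjoint (ind (Example.abox e)) (ind (Example.abox f)))
      (positive ++ negative)

Entailed : Ontology → Example → Set₁
Entailed 𝒪 e = Example.abox e ∪ 𝒪 ⊨ Example.query e

Fits : Ontology → Collection → Set₁
Fits 𝒪 E = All (Entailed 𝒪) (Collection.positive E)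
         × All (¬_ ∘ Entailed 𝒪) (Collection.negative E)

data Symbol : Set where
  bit                                : Bool → Symbol
  lparen comma rparen turnstile vbar : Symbol

encodeName : List Bool → List Symbol
encodeName = map bit

encodeAtom : N-C → N-I → List Symbol
encodeAtom A a = encodeName A ++ lparen ∷ encodeName a ++ [ rparen ]

encodeAssertion : Assertion → List Symbol
encodeAssertion (concept A a) = encodeAtom A a
encodeAssertion (role r a b)  =
  encodeName r ++ lparen ∷ encodeName a ++ comma ∷ encodeName b ++ [ rparen ]

encodeABox : ABox → List Symbol
encodeABox = concatMap encodeAssertion ∘ toList

-- A(a)r(a,b)...⊢Q(a)
encodeExample : Example → List Symbol
encodeExample e =
  encodeABox abox ++ turnstile ∷ encodeAtom (AQ.queryName query) (AQ.individual query)
  where open Example e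

-- e₁...eₘ|f₁...fₙ with the positive examples eᵢ and negative examples fⱼ
encode : Collection → List Symbol
encode E = concatMap encodeExample positive ++ vbar ∷ concatMap encodeExample negative
  where open Collection E

-- Strings that encode no collection are not in the language.
OntologyFitting : DL → Pred (List Symbol) _
OntologyFitting L w = ∃ λ E → w ≡ encode E × ∃ λ 𝒪 → IsOntology L 𝒪 × Fits 𝒪 E

{-# OPTIONS --safe #-}

-- Let F be the least set of facts containing the assertions of the negative examples such that, for every positive
-- example (𝒜 , Q(a)), F contains Q(b) whenever (𝒜 , a) is simulated by b in the negative examples extended by F and,
-- if ⊥ is available, every individual of 𝒜 is simulated by some individual there. There is a fitting ontology iff F
-- contains no query of a negative example. If F contains none, then F itself is a countermodel for the ontology that
-- states C ⊑ Q or C ⊑ ⊥ for suitable unravellings C of the positive examples. Conversely, given models of the negative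
-- examples and of a fitting ontology, the subsets of their disjoint union form a model of the ontology in which a set
-- satisfies a concept iff all its members do; it interprets the individuals of a positive example by the sets of
-- individuals simulating them, so the ontology forces every fact in F to hold in the models of the negative examples.
--
-- The set F is computed by a program that assigns first-order definable relations to binary tables over the positions of
-- the input and iterates such assignments as many times as there are positions. Such programs run in polynomial time on
-- multi-tape machines: variables are heads on copies of the input, and every table is stored on a tape of its own.
module Submission where

open import Defs

open import Data.Bool as Bool using (Bool; true; false; T; if_then_else_; not; _∧_)
import Data.Bool.Properties as Boolₚ
open import Data.Bool.Properties using (T?)
open import Data.Empty using (⊥; ⊥-elim)
open import Data.Fin as Fin using (Fin; zero; suc; toℕ; _↑ˡ_; _↑ʳ_; splitAt)
open import Data.Fin.Patterns
import Data.Fin.Properties as Finₚ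
open import Data.Fin.Properties using (*↔×; +↔⊎; 1↔⊤; 2↔Bool; splitAt-↑ˡ; splitAt-↑ʳ)
open import Data.List using (List; []; _∷_; map; length; _++_; _ʳ++_; _∷ʳ_; concat; concatMap; reverse)
open import Data.List.Membership.Propositional using (_∈_; find; lose)
open import Data.List.Membership.Propositional.Properties
  using (∈-++⁺ˡ; ∈-++⁺ʳ; ∈-++⁻; ∈-concatMap⁺; ∈-concatMap⁻; ∈-map⁺; ∈-map⁻)
open import Data.List.NonEmpty using (toList; _∷_)
import Data.List.Properties as Listₚ
open import Data.List.Relation.Binary.Disjoint.Propositional using (Disjoint)
open import Data.List.Relation.Unary.All as All using (All; []; _∷_)
import Data.List.Relation.Unary.All.Properties as Allₚ
open import Data.List.Relation.Unary.AllPairs using (AllPairs; []; _∷_)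
open import Data.List.Relation.Unary.Any using (here; there)
open import Data.Maybe as Maybe using (Maybe; just; nothing; maybe)
open import Data.Nat hiding (compare) renaming (_⊓_ to _⊓ₙ_)
open import Data.Nat.DivMod using (_%_; [m+kn]%n≡m%n; m<n⇒m%n≡m)
open import Data.Nat.GeneralisedArithmetic using (iterate)
open import Data.Nat.Properties
open import Data.Nat.Tactic.RingSolver using (solve-∀)
open import Data.Product using (∃; ∃₂; _×_; _,_; proj₁; proj₂)
open import Data.Product.Function.NonDependent.Propositional using (_×-↔_; _×-⇔_)
open import Data.Sum as Sum using (_⊎_; inj₁; inj₂; [_,_]′)
open import Data.Sum.Function.Propositional using (_⊎-↔_; _⊎-⇔_)
open import Data.Unit using (⊤; tt)
open import Data.Vec as Vec using (Vec; []; _∷_)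
import Data.Vec.Properties as Vecₚ
open import Data.Vec.Relation.Unary.All as Vecᵃ using ([]; _∷_)
open import Data.Vec.Relation.Unary.All.Properties using (lookup⁺)
open import Function using (_∘_; id; _⇔_; mk⇔; Equivalence; mk↔ₛ′)
open import Function.Construct.Identity using (⇔-id)
open import Function.Properties.Inverse using (↔-refl; ↔-sym; ↔-trans)
open import Function.Related.TypeIsomorphisms using (→-cong-⇔; ¬-cong-⇔)
open import Level using (0ℓ)
open import Relation.Binary.Definitions using (DecidableEquality; tri<; tri≈; tri>)
open import Relation.Binary.PropositionalEquality
open import Relation.Nullary using (Dec; yes; no; does; contradiction; ¬_; _×-dec_; _⊎-dec_; _→-dec_; ¬?)
open import Relation.Nullary.Decidable using (decidable-stable; dec-false; dec-true; map′; proof)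
open import Relation.Nullary.Reflects as Reflects using (Reflects; ofʸ; ofⁿ)
open import Relation.Unary using (Pred; Satisfiable)

-- The detour through definability confines explicit machines to one small fixed language:
-- everything specific to ontologies is a formula. The domain consists of positions because names
-- are bit strings of unbounded length. A name is represented by the delimiter just after its end,
-- and so even equality of names has to be computed by iteration.
--
-- The powerset model takes the place of a universal model of a positive example and the ontology:
-- the entailment is applied to it directly, and the elements demanded by existential concepts are
-- at hand as sets of successors. The empty set would satisfy `⊥`, so with `⊥` all sets must be
-- nonempty; this is the origin of the extra condition on the individuals of a positive example.
--
-- To stay decidable without excluded middle, the greatest simulation and the least set of facts
-- appear only through numbered stages, and the computed tables decide these. For `N` positions,
-- `N * N` steps suffice: a binary table that only grows changes at most once per cell.

infixl 6 _:+_
infixl 7 _:*_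

-- Polynomial bounds and their domination by monomials

data Polynomial : Set where
  con     : ℕ → Polynomial
  var     : Polynomial
  _:+_ _:*_ : Polynomial → Polynomial → Polynomial

-- Running times are kept as expressions whose evaluation unfolds definitionally to the step counts
-- of compound programs; a monomial bound is extracted only once, at the very end.
eval : Polynomial → ℕ → ℕ
eval (con c)  n = c
eval var      n = n
eval (p :+ q) n = eval p n + eval q n
eval (p :* q) n = eval p n * eval q n

-- The base is `suc n` because the powers of `n` are not monotone in the exponent at `n = 0`,
-- whereas the case of a sum raises both exponents to a common one.
eval≤power : ∀ p → ∃₂ λ c k → ∀ n → eval p n ≤ c * suc n ^ k
eval≤power (con c)  = c , 0 , λ n → ≤-reflexive (sym (*-identityʳ c))
eval≤power var      = 1 , 1 , λ n → ≤-trans (n≤1+n n)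
  (≤-reflexive (trans (sym (*-identityʳ (suc n))) (sym (+-identityʳ (suc n * 1)))))
eval≤power (p :+ q) with eval≤power p | eval≤power q
... | c , k , f | d , l , g = c + d , k + l , λ n → begin
  eval p n + eval q n                         ≤⟨ +-mono-≤ (f n) (g n) ⟩
  c * suc n ^ k + d * suc n ^ l               ≤⟨ +-mono-≤
    (*-monoʳ-≤ c (^-monoʳ-≤ (suc n) (m≤m+n k l)))
    (*-monoʳ-≤ d (^-monoʳ-≤ (suc n) (m≤n+m l k))) ⟩
  c * suc n ^ (k + l) + d * suc n ^ (k + l)   ≡⟨ sym (*-distribʳ-+ (suc n ^ (k + l)) c d) ⟩
  (c + d) * suc n ^ (k + l)                   ∎
  where open ≤-Reasoning
eval≤power (p :* q) with eval≤power p | eval≤power q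
... | c , k , f | d , l , g = c * d , k + l , λ n → begin
  eval p n * eval q n                 ≤⟨ *-mono-≤ (f n) (g n) ⟩
  c * suc n ^ k * (d * suc n ^ l)     ≡⟨ rearrange c (suc n ^ k) d (suc n ^ l) ⟩
  c * d * (suc n ^ k * suc n ^ l)     ≡⟨ cong (c * d *_) (sym (^-distribˡ-+-* (suc n) k l)) ⟩
  c * d * suc n ^ (k + l)             ∎
  where
  open ≤-Reasoning
  rearrange : ∀ a b c d → a * b * (c * d) ≡ a * c * (b * d)
  rearrange = solve-∀

-- Leads back from `suc n` to `n`: the successor of a positive number is at most its double, and the
-- additive constant covers `n = 0`.
suc^≤ : ∀ n k → suc n ^ k ≤ 2 ^ k * n ^ k + 2 ^ k
suc^≤ zero    k = begin
  1 ^ k                     ≡⟨ ^-zeroˡ k ⟩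
  1                         ≤⟨ m^n>0 2 k ⟩
  2 ^ k                     ≤⟨ m≤n+m (2 ^ k) (2 ^ k * 0 ^ k) ⟩
  2 ^ k * 0 ^ k + 2 ^ k     ∎
  where open ≤-Reasoning
suc^≤ (suc n) k = begin
  suc (suc n) ^ k                     ≤⟨ ^-monoˡ-≤ k (≤-trans (m≤n+m (2 + n) n) (≤-reflexive (double n))) ⟩
  (2 * suc n) ^ k                     ≡⟨ power k ⟩
  2 ^ k * suc n ^ k                   ≤⟨ m≤m+n _ (2 ^ k) ⟩
  2 ^ k * suc n ^ k + 2 ^ k           ∎
  where
  open ≤-Reasoning
  double : ∀ n → n + (2 + n) ≡ 2 * suc n
  double = solve-∀
  swap : ∀ a b c d → a * b * (c * d) ≡ (a * c) * (b * d)
  swap = solve-∀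
  power : ∀ k → (2 * suc n) ^ k ≡ 2 ^ k * suc n ^ k
  power zero    = refl
  power (suc k) = trans (cong (2 * suc n *_) (power k)) (swap 2 (suc n) (2 ^ k) (suc n ^ k))

eval≤monomial : ∀ p → ∃₂ λ c k → ∀ n → eval p n ≤ c * n ^ k + c
eval≤monomial p with eval≤power p
... | c , k , f = c * 2 ^ k , k , λ n → begin
  eval p n                            ≤⟨ f n ⟩
  c * suc n ^ k                       ≤⟨ *-monoʳ-≤ c (suc^≤ n k) ⟩
  c * (2 ^ k * n ^ k + 2 ^ k)         ≡⟨ expand c (2 ^ k) (n ^ k) ⟩
  c * 2 ^ k * n ^ k + c * 2 ^ k       ∎
  where
  open ≤-Reasoning
  expand : ∀ a b c → a * (b * c + b) ≡ a * b * c + a * b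
  expand = solve-∀

-- Finite types, functions updated at a point, iteration

Finite-⊎ : ∀ {A B} → Finite A → Finite B → Finite (A ⊎ B)
Finite-⊎ (m , f) (n , g) = m + n , ↔-trans (f ⊎-↔ g) (↔-sym +↔⊎)

Finite-⊤ : Finite ⊤
Finite-⊤ = 1 , ↔-sym 1↔⊤

Finite-Bool : Finite Bool
Finite-Bool = 2 , ↔-sym 2↔Bool

nth : ∀ {A : Set} → A → List A → ℕ → A
nth d []       _       = d
nth d (x ∷ xs) zero    = x
nth d (x ∷ xs) (suc i) = nth d xs i

upd : ∀ {A : Set} → (ℕ → A) → ℕ → A → ℕ → A
upd f p a j with j ≟ p
... | yes _ = a
... | no _  = f j

upd-same : ∀ {A : Set} (f : ℕ → A) p a → upd f p a p ≡ a
upd-same f p a with p ≟ p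
... | yes _  = refl
... | no p≢p = contradiction refl p≢p

upd-other : ∀ {A : Set} (f : ℕ → A) {p j} a → j ≢ p → upd f p a j ≡ f j
upd-other f {p} {j} a j≢p with j ≟ p
... | yes j≡p = contradiction j≡p j≢p
... | no _    = refl

upd-id : ∀ {A : Set} (f : ℕ → A) {p a} → f p ≡ a → ∀ j → upd f p a j ≡ f j
upd-id f {p} fp≡a j with j ≟ p
... | yes refl = sym fp≡a
... | no _     = refl

upd-cong : ∀ {A : Set} {f g : ℕ → A} {p q a} → (∀ j → f j ≡ g j) → p ≡ q → ∀ j → upd f p a j ≡ upd g q a j
upd-cong {p = p} f≗g refl j with j ≟ p
... | yes _ = refl
... | no _  = f≗g j

iterate-+ : ∀ {A : Set} (f : A → A) x m n → iterate f x (m + n) ≡ iterate f (iterate f x m) n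
iterate-+ f x zero    n = refl
iterate-+ f x (suc m) n = iterate-+ f (f x) m n

-- A left move from position 0 is excluded, so positions remain natural numbers: programs never
-- extend a tape to the left. The single cell added there belongs to the initial step of the
-- machine.
data Shift : Move → ℕ → ℕ → Set where
  left  : ∀ {p} → Shift left (suc p) p
  stay  : ∀ {p} → Shift stay p p
  right : ∀ {p} → Shift right p (suc p)

-- A structured language compiled to multi-tape Turing machines

module Machine {Σ Q : Set} (finite-Σ : Finite Σ) (finite-Q : Finite Q) (D NT : ℕ) where

  Γ : Set
  Γ = Fin 3 ⊎ (Σ ⊎ Q)

  pattern blank = inj₁ zero
  pattern mark  = inj₁ (suc zero)
  pattern one   = inj₁ (suc (suc zero))
  pattern inp s = inj₂ (inj₁ s)
  pattern ltr q = inj₂ (inj₂ q)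

  finite-Γ : Finite Γ
  finite-Γ = Finite-⊎ (3 , ↔-refl) (Finite-⊎ finite-Σ finite-Q)

  -- The tapes: input, scratch counter, truth value, tables, and pointers.
  data Id : Set where
    U S F : Id
    tab   : Fin NT → Id
    ptr   : Fin D → Id

  W K : ℕ
  W = 2 + (NT + D)
  K = suc W

  index : Id → Fin K
  index U       = zero
  index S       = suc zero
  index F       = suc (suc zero)
  index (tab t) = suc (suc (suc (t ↑ˡ D)))
  index (ptr j) = suc (suc (suc (NT ↑ʳ j)))

  ids : Fin K → Id
  ids zero                = U
  ids (suc zero)          = S
  ids (suc (suc zero))    = F
  ids (suc (suc (suc i))) = [ tab , ptr ]′ (splitAt NT i)

  ids-index : ∀ i → ids (index i) ≡ i
  ids-index U       = refl
  ids-index S       = refl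
  ids-index F       = refl
  ids-index (tab t) = cong [ tab , ptr ]′ (splitAt-↑ˡ NT t D)
  ids-index (ptr j) = cong [ tab , ptr ]′ (splitAt-↑ʳ NT D j)

  Heads : Set
  Heads = Vec Γ K

  _at_ : Heads → Id → Γ
  hs at i = Vec.lookup hs (index i)

  record Store : Set where
    constructor store
    field
      pos  : Id → ℕ
      cell : Id → ℕ → Γ
  open Store public

  infix 4 _≈_
  record _≈_ (s s′ : Store) : Set where
    field
      pos≈  : ∀ i → pos s i ≡ pos s′ i
      cell≈ : ∀ i j → cell s i j ≡ cell s′ i j
  open _≈_ public

  heads : Store → Heads
  heads s = Vec.tabulate λ i → cell s (ids i) (pos s (ids i))

  heads-at : ∀ s i → heads s at i ≡ cell s i (pos s i)
  heads-at s i = trans (Vecₚ.lookup∘tabulate (λ i → cell s (ids i) (pos s (ids i))) (index i))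
    (cong (λ i → cell s i (pos s i)) (ids-index i))

  heads-cong : ∀ {s s′} → s ≈ s′ → heads s ≡ heads s′
  heads-cong {s} {s′} e = Vecₚ.tabulate-cong λ i →
    trans (cell≈ e (ids i) (pos s (ids i))) (cong (cell s′ (ids i)) (pos≈ e (ids i)))

  Action : Set
  Action = Id → Γ × Move

  -- A relation rather than a function, since left moves are partial and the contents of a tape
  -- matter only pointwise.
  record Acts (a : Action) (s s′ : Store) : Set where
    field
      moves  : ∀ i → Shift (proj₂ (a i)) (pos s i) (pos s′ i)
      writes : ∀ i j → cell s′ i j ≡ upd (cell s i) (pos s i) (proj₁ (a i)) j
  open Acts public

  Acts-≈ʳ : ∀ {a s s′ s″} → Acts a s s′ → s′ ≈ s″ → Acts a s s″
  Acts-≈ʳ {a} A e = record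
    { moves  = λ i → subst (Shift (proj₂ (a i)) _) (pos≈ e i) (moves A i)
    ; writes = λ i j → trans (sym (cell≈ e i j)) (writes A i j) }

  Acts-≈ˡ : ∀ {a s s′ s″} → Acts a s s′ → s ≈ s″ → Acts a s″ s′
  Acts-≈ˡ {a} {s} {s″ = s″} A e = record
    { moves  = λ i → subst (λ p → Shift (proj₂ (a i)) p _) (pos≈ e i) (moves A i)
    ; writes = λ i j → trans (writes A i j) (upd-cong {f = cell s i} {cell s″ i} (cell≈ e i) (pos≈ e i) j) }

  infixr 5 _∙_

  data Code : Set where
    act   : (Heads → Action) → Code
    _∙_   : Code → Code → Code
    ite   : (Heads → Bool) → Code → Code → Code
    while : (Heads → Bool) → Code → Code

  -- The control points, which become states of the machine. A branching or a loop has an extra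
  -- point at which its test is made.
  Loc : Code → Set
  Loc (act _)     = ⊤
  Loc (c ∙ d)     = Loc c ⊎ Loc d
  Loc (ite _ c d) = ⊤ ⊎ (Loc c ⊎ Loc d)
  Loc (while _ c) = ⊤ ⊎ Loc c

  Finite-Loc : ∀ c → Finite (Loc c)
  Finite-Loc (act _)     = Finite-⊤
  Finite-Loc (c ∙ d)     = Finite-⊎ (Finite-Loc c) (Finite-Loc d)
  Finite-Loc (ite _ c d) = Finite-⊎ Finite-⊤ (Finite-⊎ (Finite-Loc c) (Finite-Loc d))
  Finite-Loc (while _ c) = Finite-⊎ Finite-⊤ (Finite-Loc c)

  entry : ∀ c → Loc c
  entry (act _)     = tt
  entry (c ∙ d)     = inj₁ (entry c)
  entry (ite _ c d) = inj₁ tt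
  entry (while _ c) = inj₁ tt

  noop : Heads → Action
  noop hs i = hs at i , stay

  -- nothing: leave the program.
  next : ∀ c → Loc c → Heads → Maybe (Loc c)
  next (act _)     _               hs = nothing
  next (c ∙ d)     (inj₁ l)        hs = just (maybe inj₁ (inj₂ (entry d)) (next c l hs))
  next (c ∙ d)     (inj₂ l)        hs = Maybe.map inj₂ (next d l hs)
  next (ite b c d) (inj₁ _)        hs = just (inj₂ (if b hs then inj₁ (entry c) else inj₂ (entry d)))
  next (ite b c d) (inj₂ (inj₁ l)) hs = Maybe.map (inj₂ ∘ inj₁) (next c l hs)
  next (ite b c d) (inj₂ (inj₂ l)) hs = Maybe.map (inj₂ ∘ inj₂) (next d l hs)
  next (while b c) (inj₁ _)        hs = if b hs then just (inj₂ (entry c)) else nothing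
  next (while b c) (inj₂ l)        hs = just (maybe inj₂ (inj₁ tt) (next c l hs))

  action : ∀ c → Loc c → Heads → Action
  action (act a)     _               = a
  action (c ∙ d)     (inj₁ l)        = action c l
  action (c ∙ d)     (inj₂ l)        = action d l
  action (ite b c d) (inj₁ _)        = noop
  action (ite b c d) (inj₂ (inj₁ l)) = action c l
  action (ite b c d) (inj₂ (inj₂ l)) = action d l
  action (while b c) (inj₁ _)        = noop
  action (while b c) (inj₂ l)        = action c l

  -- The last step of a run also performs its action. Leaving a component therefore costs nothing,
  -- and the times of consecutive components add up exactly.
  data Exec (c : Code) : Loc c → Store → ℕ → Store → Set where
    exit : ∀ {l s s′} → next c l (heads s) ≡ nothing →
           Acts (action c l (heads s)) s s′ → Exec c l s 1 s′
    cont : ∀ {l l′ s s₁ t s′} → next c l (heads s) ≡ just l′ →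
           Acts (action c l (heads s)) s s₁ → Exec c l′ s₁ t s′ → Exec c l s (suc t) s′

  Exec-≈ʳ : ∀ {c l s t s′ s″} → Exec c l s t s′ → s′ ≈ s″ → Exec c l s t s″
  Exec-≈ʳ (exit n A)   e = exit n (Acts-≈ʳ A e)
  Exec-≈ʳ (cont n A x) e = cont n A (Exec-≈ʳ x e)

  Exec-≈ˡ : ∀ {c l s t s′ s″} → Exec c l s t s′ → s ≈ s″ → Exec c l s″ t s′
  Exec-≈ˡ {c} {l} (exit n A) e rewrite heads-cong e = exit n (Acts-≈ˡ A e)
  Exec-≈ˡ {c} {l} (cont n A x) e rewrite heads-cong e = cont n (Acts-≈ˡ A e) x

  Acts-noop : ∀ s → Acts (noop (heads s)) s s
  Acts-noop s = record
    { moves  = λ _ → stay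
    ; writes = λ i j → sym (upd-id (cell s i) (sym (heads-at s i)) j) }

  Exec-∙ : ∀ {c d l s t s₁ t′ s′} → Exec c l s t s₁ → Exec d (entry d) s₁ t′ s′ →
           Exec (c ∙ d) (inj₁ l) s (t + t′) s′
  Exec-∙ {c} {d} (exit n A)   y = cont (cong (just ∘ maybe inj₁ (inj₂ (entry d))) n) A (second y)
    where
    second : ∀ {l s t s′} → Exec d l s t s′ → Exec (c ∙ d) (inj₂ l) s t s′
    second (exit n A)   = exit (cong (Maybe.map inj₂) n) A
    second (cont n A x) = cont (cong (Maybe.map inj₂) n) A (second x)
  Exec-∙ {c} {d} (cont n A x) y = cont (cong (just ∘ maybe inj₁ (inj₂ (entry d))) n) A (Exec-∙ x y)

  Exec-then : ∀ {b c d l s t s′} → Exec c l s t s′ → Exec (ite b c d) (inj₂ (inj₁ l)) s t s′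
  Exec-then (exit n A)   = exit (cong (Maybe.map (inj₂ ∘ inj₁)) n) A
  Exec-then (cont n A x) = cont (cong (Maybe.map (inj₂ ∘ inj₁)) n) A (Exec-then x)

  Exec-else : ∀ {b c d l s t s′} → Exec d l s t s′ → Exec (ite b c d) (inj₂ (inj₂ l)) s t s′
  Exec-else (exit n A)   = exit (cong (Maybe.map (inj₂ ∘ inj₂)) n) A
  Exec-else (cont n A x) = cont (cong (Maybe.map (inj₂ ∘ inj₂)) n) A (Exec-else x)

  Exec-body : ∀ {b c l s t s₁ t′ s′} → Exec c l s t s₁ → Exec (while b c) (inj₁ tt) s₁ t′ s′ →
              Exec (while b c) (inj₂ l) s (t + t′) s′
  Exec-body (exit n A)   y = cont (cong (just ∘ maybe inj₂ (inj₁ tt)) n) A y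
  Exec-body (cont n A x) y = cont (cong (just ∘ maybe inj₂ (inj₁ tt)) n) A (Exec-body x y)

  -- Only upper bounds are tracked, so that branches of different lengths can share one.
  record Runs (c : Code) (s : Store) (t : ℕ) (s′ : Store) : Set where
    constructor runs
    field
      {steps} : ℕ
      within  : steps ≤ t
      exec    : Exec c (entry c) s steps s′

  Runs-≈ʳ : ∀ {c s t s′ s″} → Runs c s t s′ → s′ ≈ s″ → Runs c s t s″
  Runs-≈ʳ (runs ≤t x) e = runs ≤t (Exec-≈ʳ x e)

  Runs-≈ˡ : ∀ {c s t s′ s″} → Runs c s t s′ → s ≈ s″ → Runs c s″ t s′
  Runs-≈ˡ (runs ≤t x) e = runs ≤t (Exec-≈ˡ x e)

  Runs-≤ : ∀ {c s t t′ s′} → t ≤ t′ → Runs c s t s′ → Runs c s t′ s′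
  Runs-≤ t≤t′ (runs ≤t x) = runs (≤-trans ≤t t≤t′) x

  Runs-act : ∀ {a s s′} → Acts (a (heads s)) s s′ → Runs (act a) s 1 s′
  Runs-act A = runs ≤-refl (exit refl A)

  Runs-∙ : ∀ {c d s t s₁ t′ s′} → Runs c s t s₁ → Runs d s₁ t′ s′ → Runs (c ∙ d) s (t + t′) s′
  Runs-∙ (runs ≤t x) (runs ≤t′ y) = runs (+-mono-≤ ≤t ≤t′) (Exec-∙ x y)

  Runs-then : ∀ {b c d s t s′} → b (heads s) ≡ true → Runs c s t s′ → Runs (ite b c d) s (suc t) s′
  Runs-then {s = s} e (runs ≤t x) = runs (s≤s ≤t)
    (cont (cong (λ b → just (inj₂ (if b then _ else _))) e) (Acts-noop s) (Exec-then x))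

  Runs-else : ∀ {b c d s t s′} → b (heads s) ≡ false → Runs d s t s′ → Runs (ite b c d) s (suc t) s′
  Runs-else {s = s} e (runs ≤t x) = runs (s≤s ≤t)
    (cont (cong (λ b → just (inj₂ (if b then _ else _))) e) (Acts-noop s) (Exec-else x))

  Runs-done : ∀ {b c s} → b (heads s) ≡ false → Runs (while b c) s 1 s
  Runs-done {s = s} e = runs ≤-refl (exit (cong (λ b → if b then _ else _) e) (Acts-noop s))

  Runs-loop : ∀ {b c s t s₁ t′ s′} → b (heads s) ≡ true → Runs c s t s₁ → Runs (while b c) s₁ t′ s′ →
              Runs (while b c) s (suc t + t′) s′
  Runs-loop {s = s} e (runs ≤t x) (runs ≤t′ y) = runs (s≤s (+-mono-≤ ≤t ≤t′))
    (cont (cong (λ b → if b then _ else _) e) (Acts-noop s) (Exec-body x y))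

  isOne : Γ → Bool
  isOne one = true
  isOne _   = false

  -- The store after the first machine step: the input is preceded by one free cell, which the
  -- program will mark, and the other tapes already carry their mark.
  starting : List Σ → Store
  starting w = store (λ _ → 0) λ where
    U → nth blank (blank ∷ map inp w)
    _ → nth blank (mark ∷ [])

  module _ (c : Code) where

    -- A verdict depends on the state alone, so one more state, `check`, is spent on reading the
    -- truth value tape.
    Control : Set
    Control = ⊤ ⊎ (Loc c ⊎ (⊤ ⊎ Bool))

    pattern init   = inj₁ tt
    pattern inside l = inj₂ (inj₁ l)
    pattern check  = inj₂ (inj₂ (inj₁ tt))
    pattern halt b = inj₂ (inj₂ (inj₂ b))

    control : Control → Heads → Control
    control init     hs = inside (entry c)
    control (inside l)   hs = maybe (λ l → inside l) check (next c l hs)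
    control check    hs = halt (isOne (hs at F))
    control (halt b) hs = halt b

    initialise : Heads → Action
    initialise hs U = hs at U , left
    initialise hs _ = mark , stay

    perform : Control → Heads → Action
    perform init     = initialise
    perform (inside l)   = action c l
    perform check    = noop
    perform (halt b) = noop

    machine : TM Σ
    machine = record
      { State           = Control
      ; finite-State    = Finite-⊎ Finite-⊤ (Finite-⊎ (Finite-Loc c) (Finite-⊎ Finite-⊤ Finite-Bool))
      ; Γ               = Γ
      ; finite-Γ        = finite-Γ
      ; blank           = blank
      ; input           = λ s → inp s
      ; input-injective = λ { refl → refl }
      ; input≢blank     = λ _ ()
      ; work-tapes      = W
      ; start           = init
      ; verdict         = λ { (halt b) → just b ; _ → nothing }
      ; δ               = λ q hs → control q hs , Vec.tabulate (perform q hs ∘ ids)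
      }

    open Run machine hiding (act)
    act′ = Run.act machine

    cells : List Γ → List Γ → ℕ → Γ
    cells []       xs = nth blank xs
    cells (l ∷ ls) xs = cells ls (l ∷ xs)

    content : Tape → ℕ → Γ
    content (tape ls h rs) = cells ls (h ∷ rs)

    cells-cong : ∀ ls {xs ys} → (∀ j → nth blank xs j ≡ nth blank ys j) → ∀ j → cells ls xs j ≡ cells ls ys j
    cells-cong []       e = e
    cells-cong (l ∷ ls) e = cells-cong ls λ { zero → refl ; (suc j) → e j }

    cells-upd : ∀ ls {xs ys k g} → (∀ j → nth blank ys j ≡ upd (nth blank xs) k g j) →
                ∀ j → cells ls ys j ≡ upd (cells ls xs) (length ls + k) g j
    cells-upd []       e = e
    cells-upd (l ∷ ls) {xs} {ys} {k} {g} e j rewrite sym (+-suc (length ls) k) = cells-upd ls lemma j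
      where
      lemma : ∀ j → nth blank (l ∷ ys) j ≡ upd (nth blank (l ∷ xs)) (suc k) g j
      lemma zero = refl
      lemma (suc j) with j ≟ k | suc j ≟ suc k | e j
      ... | yes _   | yes _   | e = e
      ... | no _    | no _    | e = e
      ... | yes j≡k | no j≢k  | _ = contradiction (cong suc j≡k) j≢k
      ... | no j≢k  | yes j≡k | _ = contradiction (suc-injective j≡k) j≢k

    cells-head : ∀ ls h g rs j → cells ls (g ∷ rs) j ≡ upd (cells ls (h ∷ rs)) (length ls) g j
    cells-head ls h g rs j = subst (λ p → cells ls (g ∷ rs) j ≡ upd (cells ls (h ∷ rs)) p g j)
      (+-identityʳ (length ls)) (cells-upd ls (λ { zero → refl ; (suc _) → refl }) j)

    cells-length : ∀ ls xs → cells ls xs (length ls) ≡ nth blank xs 0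
    cells-length ls xs = trans (cong (cells ls xs) (sym (+-identityʳ (length ls)))) (shift ls xs 0)
      where
      shift : ∀ ls xs k → cells ls xs (length ls + k) ≡ nth blank xs k
      shift []       xs k = refl
      shift (l ∷ ls) xs k = trans (cong (cells ls (l ∷ xs)) (sym (+-suc (length ls) k))) (shift ls (l ∷ xs) (suc k))

    -- Contents are compared through the default `blank`, because moving right past the end of a
    -- tape appends an explicit blank that a store does not distinguish.
    record Represents (t : Tape) (p : ℕ) (f : ℕ → Γ) : Set where
      field
        position : length (Tape.before t) ≡ p
        contents : ∀ j → content t j ≡ f j
    open Represents

    represents-act : ∀ {t p f p′ f′ g m} → Represents t p f → Shift m p p′ →
                     (∀ j → f′ j ≡ upd f p g j) → Represents (act′ (g , m) t) p′ f′
    represents-act {tape (l ∷ ls) h rs} {g = g} r left e = record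
      { position = suc-injective (position r)
      ; contents = λ j → trans (cells-head (l ∷ ls) h g rs j)
          (trans (upd-cong {f = content (tape (l ∷ ls) h rs)} (contents r) (position r) j) (sym (e j))) }
    represents-act {tape ls h rs} {g = g} r stay e = record
      { position = position r
      ; contents = λ j → trans (cells-head ls h g rs j)
          (trans (upd-cong {f = content (tape ls h rs)} (contents r) (position r) j) (sym (e j))) }
    represents-act {tape ls h []} {g = g} r right e = record
      { position = cong suc (position r)
      ; contents = λ j → trans (cells-cong ls pad j) (trans (cells-head ls h g [] j)
          (trans (upd-cong {f = content (tape ls h [])} (contents r) (position r) j) (sym (e j)))) }
      where
      pad : ∀ j → nth blank (g ∷ blank ∷ []) j ≡ nth blank (g ∷ []) j
      pad zero          = refl
      pad (suc zero)    = refl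
      pad (suc (suc j)) = refl
    represents-act {tape ls h (x ∷ rs)} {g = g} r right e = record
      { position = cong suc (position r)
      ; contents = λ j → trans (cells-head ls h g (x ∷ rs) j)
          (trans (upd-cong {f = content (tape ls h (x ∷ rs))} (contents r) (position r) j) (sym (e j))) }

    Represented : Vec Tape K → Store → Set
    Represented ts s = ∀ i → Represents (Vec.lookup ts i) (pos s (ids i)) (cell s (ids i))

    heads-represented : ∀ ts s → Represented ts s → Vec.map Tape.head ts ≡ heads s
    heads-represented ts s r = trans (sym (Vecₚ.tabulate∘lookup _)) (Vecₚ.tabulate-cong λ i →
      trans (Vecₚ.lookup-map i Tape.head ts) (head (Vec.lookup ts i) (r i)))
      where
      head : ∀ t {p f} → Represents t p f → Tape.head t ≡ f p
      head (tape ls h rs) {p} {f} r = trans (sym (cells-length ls (h ∷ rs)))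
        (trans (contents r (length ls)) (cong f (position r)))

    lookup-acts : ∀ (a : Action) ts i →
      Vec.lookup (Vec.zipWith act′ (Vec.tabulate (a ∘ ids)) ts) i ≡ act′ (a (ids i)) (Vec.lookup ts i)
    lookup-acts a ts i = trans (Vecₚ.lookup-zipWith act′ i (Vec.tabulate (a ∘ ids)) ts)
      (cong (λ a → act′ a (Vec.lookup ts i)) (Vecₚ.lookup∘tabulate (a ∘ ids) i))

    acted : Control → Vec Tape K → Vec Tape K
    acted q ts = Vec.zipWith act′ (Vec.tabulate (perform q (Vec.map Tape.head ts) ∘ ids)) ts

    step-represented : ∀ {q ts s s′} → Represented ts s → Acts (perform q (heads s)) s s′ →
      Represented (acted q ts) s′
    step-represented {q} {ts} {s} {s′} r A i = subst (λ t → Represents t (pos s′ (ids i)) (cell s′ (ids i)))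
      (sym (trans (lookup-acts (perform q (Vec.map Tape.head ts)) ts i)
                  (cong (λ hs → act′ (perform q hs (ids i)) (Vec.lookup ts i)) (heads-represented ts s r))))
      (represents-act (r i) (moves A (ids i)) (writes A (ids i)))

    simulate : ∀ {l ts s t s′} → Exec c l s t s′ → Represented ts s →
      ∃ λ ts′ → iterate step (config (inside l) ts) t ≡ config check ts′ × Represented ts′ s′
    simulate {l} {ts} {s} (exit n A) r =
      _ , cong (λ q → config q (acted (inside l) ts)) (trans (cong (control (inside l)) (heads-represented ts s r))
        (cong (maybe _ _) n)) ,
      step-represented {inside l} {ts} {_} {_} r A
    simulate {l} {ts} {s} (cont {t = t} n A x) r with simulate {ts = acted (inside l) ts} x
      (step-represented {inside l} {ts} {_} {_} r A)
    ... | ts′ , e , r′ = ts′ ,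
      trans (cong (λ q → iterate step (config q (acted (inside l) ts)) t)
        (trans (cong (control (inside l)) (heads-represented ts s r)) (cong (maybe _ _) n))) e ,
      r′

    iterate-halt : ∀ b ts n → iterate step (config (halt b) ts) n ≡ config (halt b) ts
    iterate-halt b ts zero    = refl
    iterate-halt b ts (suc n) = iterate-halt b ts n

    starting-represented : ∀ w → Represented (Run.Config.tapes (step (initial w))) (starting w)
    starting-represented w zero with w
    ... | [] = record { position = refl ; contents = λ { zero → refl ; (suc zero) → refl ; (suc (suc j)) → refl } }
    ... | s ∷ w = record { position = refl ; contents = λ _ → refl }
    starting-represented w (suc i) =
      subst (λ t → Represents t (pos (starting w) (ids (suc i))) (cell (starting w) (ids (suc i))))
        (sym (trans (lookup-acts (initialise (Vec.map Tape.head (Run.Config.tapes (initial w))))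
                                 (Run.Config.tapes (initial w)) (suc i))
                    (cong (act′ (initialise (Vec.map Tape.head (Run.Config.tapes (initial w))) (ids (suc i))))
                          (Vecₚ.lookup-replicate i (tape [] blank [])))))
        (work (ids (suc i)) (ids-suc i))
      where
      ids-suc : ∀ i → ids (suc i) ≢ U
      ids-suc zero          ()
      ids-suc (suc zero)    ()
      ids-suc (suc (suc i)) e with splitAt NT i
      ids-suc (suc (suc i)) () | inj₁ _
      ids-suc (suc (suc i)) () | inj₂ _
      work : ∀ j → j ≢ U → Represents (act′ (initialise (Vec.map Tape.head (Run.Config.tapes (initial w))) j) (tape [] blank []))
                                      (pos (starting w) j) (cell (starting w) j)
      work U j≢U     = contradiction refl j≢U
      work S _       = record { position = refl ; contents = λ _ → refl }
      work F _       = record { position = refl ; contents = λ _ → refl }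
      work (tab _) _ = record { position = refl ; contents = λ _ → refl }
      work (ptr _) _ = record { position = refl ; contents = λ _ → refl }

    -- Two steps are added to the program, one that sets the marks and one that reads the truth
    -- value; for the time left over the machine idles in its halting state.
    halts : ∀ {w s t} → Runs c (starting w) t s → HaltsWithin (2 + t) w (isOne (cell s F (pos s F)))
    halts {w} {s} {t} (runs {t′} t′≤t x) with simulate x (starting-represented w)
    ... | ts′ , e , r = begin
        verdict (Config.state (iterate step (step (initial w)) (suc t)))
          ≡⟨ cong (λ n → verdict (Config.state (iterate step (step (initial w)) n))) split ⟩
        verdict (Config.state (iterate step (step (initial w)) (t′ + suc (t ∸ t′))))
          ≡⟨ cong (verdict ∘ Config.state) (iterate-+ step (step (initial w)) t′ (suc (t ∸ t′))) ⟩
        verdict (Config.state (iterate step (iterate step (step (initial w)) t′) (suc (t ∸ t′))))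
          ≡⟨ cong (λ k → verdict (Config.state (iterate step k (suc (t ∸ t′))))) e ⟩
        verdict (Config.state (iterate step (step (config check ts′)) (t ∸ t′)))
          ≡⟨ cong (verdict ∘ Config.state) (iterate-halt (isOne (Vec.map Tape.head ts′ at F)) _ (t ∸ t′)) ⟩
        just (isOne (Vec.map Tape.head ts′ at F))
          ≡⟨ cong (λ hs → just (isOne (hs at F))) (heads-represented ts′ s r) ⟩
        just (isOne (heads s at F))
          ≡⟨ cong (just ∘ isOne) (heads-at s F) ⟩
        just (isOne (cell s F (pos s F))) ∎
      where
      open ≡-Reasoning
      open TM machine using (verdict)
      split : suc t ≡ t′ + suc (t ∸ t′)
      split = trans (cong suc (sym (m+[n∸m]≡n t′≤t))) (sym (+-suc t′ (t ∸ t′)))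

  code∈P : ∀ {ℓ} {L : Pred (List Σ) ℓ} (c : Code) (p : Polynomial) →
           (∀ w → ∃ λ s → Runs c (starting w) (eval p (length w)) s × Reflects (L w) (isOne (cell s F (pos s F)))) →
           InPTime L
  code∈P c p f with eval≤monomial (con 2 :+ p)
  ... | k , d , ≤monomial = machine c , k , d , λ w → let (s , r , reflects) = f w in
    _ , subst (λ t → Run.HaltsWithin (machine c) t w (isOne (cell s F (pos s F)))) (m+[n∸m]≡n (≤monomial (length w)))
          (extend c (2 + eval p (length w)) _ w {isOne (cell s F (pos s F))} (halts c {w} r)) , reflects
    where
    extend : ∀ c t k w {b} → Run.HaltsWithin (machine c) t w b → Run.HaltsWithin (machine c) (t + k) w b
    extend c t k w {b} h rewrite iterate-+ (Run.step (machine c)) (Run.initial (machine c) w) t k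
      with iterate (Run.step (machine c)) (Run.initial (machine c) w) t
    extend c t k w refl | Run.config (inj₂ (inj₂ (inj₂ b))) ts rewrite iterate-halt c b ts k = refl

infixl 8 _[_↦_]

_[_↦_] : ∀ {k} {A : Set} → (Fin k → A) → Fin k → A → Fin k → A
(f [ i ↦ a ]) j with j Fin.≟ i
... | yes _ = a
... | no _  = f j

↦-same : ∀ {k} {A : Set} (f : Fin k → A) i a → (f [ i ↦ a ]) i ≡ a
↦-same f i a with i Fin.≟ i
... | yes _  = refl
... | no i≢i = contradiction refl i≢i

↦-other : ∀ {k} {A : Set} (f : Fin k → A) {i j} a → j ≢ i → (f [ i ↦ a ]) j ≡ f j
↦-other f {i} {j} a j≢i with j Fin.≟ i
... | yes j≡i = contradiction j≡i j≢i
... | no _    = refl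

↦-id : ∀ {k} {A : Set} (f : Fin k → A) {i a} → f i ≡ a → ∀ j → (f [ i ↦ a ]) j ≡ f j
↦-id f {i} e j with j Fin.≟ i
... | yes refl = sym e
... | no _     = refl

-- First-order formulas and iterating programs over the positions of a word

Table : Set
Table = ℕ → ℕ → Bool

infix  9 _≼_
infixr 8 ¬′_
infixr 7 _∧′_
infixr 6 _∨′_
infixr 5 _⇒′_

data Formula (Q : Set) (NT m : ℕ) : Set where
  letter         : (Q → Bool) → Fin m → Formula Q NT m
  _≼_            : Fin m → Fin m → Formula Q NT m
  rel            : Fin NT → Fin m → Fin m → Formula Q NT m
  ¬′_            : Formula Q NT m → Formula Q NT m
  _∧′_ _∨′_ _⇒′_ : Formula Q NT m → Formula Q NT m → Formula Q NT m
  ∃′ ∀′          : Formula Q NT (suc m) → Formula Q NT m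

infix  4 _≔_
infixr 3 _⨾_

-- The index bounds the nesting depth of loops; it determines which pointer serves as the counter of
-- a loop.
data Program (Q : Set) (NT : ℕ) : ℕ → Set where
  _≔_  : ∀ {l} → Fin NT → Formula Q NT 2 → Program Q NT l
  _⨾_  : ∀ {l} → Program Q NT l → Program Q NT l → Program Q NT l
  loop : ∀ {l} → Program Q NT l → Program Q NT (suc l)

module Semantics {Q : Set} {NT : ℕ} (v : List Q) where

  Tables : Set
  Tables = Fin NT → Table

  -- Position 0 precedes the letters, which have positions 1 to length v.
  N : ℕ
  N = suc (length v)

  letterAt : ℕ → Maybe Q
  letterAt zero    = nothing
  letterAt (suc i) = nth nothing (map just v) i

  ⟦_⟧ᶠ : ∀ {m} → Formula Q NT m → Tables → Vec ℕ m → Set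
  ⟦ letter f x ⟧ᶠ σ ρ = T (maybe f false (letterAt (Vec.lookup ρ x)))
  ⟦ x ≼ y ⟧ᶠ      σ ρ = Vec.lookup ρ x ≤ Vec.lookup ρ y
  ⟦ rel t x y ⟧ᶠ  σ ρ = T (σ t (Vec.lookup ρ x) (Vec.lookup ρ y))
  ⟦ ¬′ φ ⟧ᶠ       σ ρ = ¬ ⟦ φ ⟧ᶠ σ ρ
  ⟦ φ ∧′ ψ ⟧ᶠ     σ ρ = ⟦ φ ⟧ᶠ σ ρ × ⟦ ψ ⟧ᶠ σ ρ
  ⟦ φ ∨′ ψ ⟧ᶠ     σ ρ = ⟦ φ ⟧ᶠ σ ρ ⊎ ⟦ ψ ⟧ᶠ σ ρ
  ⟦ φ ⇒′ ψ ⟧ᶠ     σ ρ = ⟦ φ ⟧ᶠ σ ρ → ⟦ ψ ⟧ᶠ σ ρ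
  ⟦ ∃′ φ ⟧ᶠ       σ ρ = ∃ λ a → a < N × ⟦ φ ⟧ᶠ σ (a ∷ ρ)
  ⟦ ∀′ φ ⟧ᶠ       σ ρ = ∀ a → a < N → ⟦ φ ⟧ᶠ σ (a ∷ ρ)

  -- Unfolding the decision procedures of concrete formulas is expensive.
  abstract
    decide : ∀ {m} (φ : Formula Q NT m) σ ρ → Dec (⟦ φ ⟧ᶠ σ ρ)
    decide (letter f x) σ ρ = T? _
    decide (x ≼ y)      σ ρ = _ ≤? _
    decide (rel t x y)  σ ρ = T? _
    decide (¬′ φ)       σ ρ = ¬? (decide φ σ ρ)
    decide (φ ∧′ ψ)     σ ρ = decide φ σ ρ ×-dec decide ψ σ ρ
    decide (φ ∨′ ψ)     σ ρ = decide φ σ ρ ⊎-dec decide ψ σ ρ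
    decide (φ ⇒′ ψ)     σ ρ = decide φ σ ρ →-dec decide ψ σ ρ
    decide (∃′ φ)       σ ρ = anyUpTo? (λ a → decide φ σ (a ∷ ρ)) N
    decide (∀′ φ)       σ ρ = map′ (λ f a → f {a}) (λ f {a} → f a) (allUpTo? (λ a → decide φ σ (a ∷ ρ)) N)

  infix 4 _≋_
  -- Only entries at positions of the word are compared: formulas read no others, and the machine
  -- represents no others.
  _≋_ : Tables → Tables → Set
  σ ≋ τ = ∀ t x y → x < N → y < N → σ t x y ≡ τ t x y

  ≋-sym : ∀ {σ τ} → σ ≋ τ → τ ≋ σ
  ≋-sym e t x y x< y< = sym (e t x y x< y<)

  ⟦⟧-cong : ∀ {m} (φ : Formula Q NT m) {σ τ ρ} → Vecᵃ.All (_< N) ρ → σ ≋ τ → ⟦ φ ⟧ᶠ σ ρ → ⟦ φ ⟧ᶠ τ ρ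
  ⟦⟧-cong (letter f x) r e h               = h
  ⟦⟧-cong (x ≼ y)      r e h               = h
  ⟦⟧-cong (rel t x y)  r e h               = subst T (e t _ _ (lookup⁺ r x) (lookup⁺ r y)) h
  ⟦⟧-cong (¬′ φ)       r e h               = λ g → h (⟦⟧-cong φ r (≋-sym e) g)
  ⟦⟧-cong (φ ∧′ ψ)     r e (g , h)         = ⟦⟧-cong φ r e g , ⟦⟧-cong ψ r e h
  ⟦⟧-cong (φ ∨′ ψ)     r e h               = Sum.map (⟦⟧-cong φ r e) (⟦⟧-cong ψ r e) h
  ⟦⟧-cong (φ ⇒′ ψ)     r e h               = λ g → ⟦⟧-cong ψ r e (h (⟦⟧-cong φ r (≋-sym e) g))
  ⟦⟧-cong (∃′ φ)       r e (a , a< , h)    = a , a< , ⟦⟧-cong φ (a< ∷ r) e h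
  ⟦⟧-cong (∀′ φ)       r e h               = λ a a< → ⟦⟧-cong φ (a< ∷ r) e (h a a<)

  decide-cong : ∀ {m} (φ : Formula Q NT m) {σ τ ρ} → Vecᵃ.All (_< N) ρ → σ ≋ τ →
                does (decide φ σ ρ) ≡ does (decide φ τ ρ)
  decide-cong φ {σ} {τ} {ρ} r e with decide φ τ ρ
  ... | yes h = dec-true (decide φ σ ρ) (⟦⟧-cong φ r (≋-sym e) h)
  ... | no ¬h = dec-false (decide φ σ ρ) (¬h ∘ ⟦⟧-cong φ r e)

  run : ∀ {l} → Program Q NT l → Tables → Tables
  run (t ≔ φ)  σ = σ [ t ↦ (λ x y → does (decide φ σ (y ∷ x ∷ []))) ]
  run (P ⨾ P′) σ = run P′ (run P σ)
  run (loop P) σ = iterate (run P) σ N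

  run-cong : ∀ {l} (P : Program Q NT l) {σ τ} → σ ≋ τ → run P σ ≋ run P τ
  run-cong (t ≔ φ) e t′ x y x< y< with t′ Fin.≟ t
  ... | yes _ = decide-cong φ (y< ∷ x< ∷ []) e
  ... | no _  = e t′ x y x< y<
  run-cong (P ⨾ P′) e = run-cong P′ (run-cong P e)
  run-cong (loop P) e = go N e
    where
    go : ∀ k {σ τ} → σ ≋ τ → iterate (run P) σ k ≋ iterate (run P) τ k
    go zero    e = e
    go (suc k) e = go k (run-cong P e)

-- Head movements as arithmetic: sweeping, addressing table cells, comparing

module Primitives {Σ Q : Set} (finite-Σ : Finite Σ) (finite-Q : Finite Q) (D NT : ℕ) where

  open Machine finite-Σ finite-Q D NT

  isMark isBlank : Γ → Bool
  isMark mark = true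
  isMark _    = false
  isBlank blank = true
  isBlank _     = false

  bit′ : Bool → Γ
  bit′ b = if b then one else blank

  isOne-bit : ∀ b → isOne (bit′ b) ≡ b
  isOne-bit true  = refl
  isOne-bit false = refl

  notMark notBlank : Id → Heads → Bool
  notMark  i hs = not (isMark (hs at i))
  notBlank i hs = not (isBlank (hs at i))

  move : (Id → Move) → Code
  move m = act λ hs i → hs at i , m i

  Runs-move : ∀ {m p p′ c} → (∀ i → Shift (m i) (p i) (p′ i)) → Runs (move m) (store p c) 1 (store p′ c)
  Runs-move {p = p} {c = c} sh = Runs-act record
    { moves  = sh
    ; writes = λ i j → sym (upd-id (c i) (sym (heads-at (store p c) i)) j) }

  same-cells : ∀ {p p′ c} → (∀ i → p i ≡ p′ i) → store p c ≈ store p′ c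
  same-cells e = record { pos≈ = e ; cell≈ = λ _ _ → refl }

  shiftBy : Move → ℕ → ℕ → ℕ
  shiftBy left  k p = p ∸ k
  shiftBy stay  k p = p
  shiftBy right k p = k + p

  shifted : (Id → Move) → ℕ → (Id → ℕ) → Id → ℕ
  shifted m k p i = shiftBy (m i) k (p i)

  Shift-shiftBy : ∀ m p → (m ≡ left → 1 ≤ p) → Shift m p (shiftBy m 1 p)
  Shift-shiftBy left zero    h with h refl
  ... | ()
  Shift-shiftBy left (suc p) h = left
  Shift-shiftBy stay p       h = stay
  Shift-shiftBy right p      h = right

  shiftBy-suc : ∀ m k p → shiftBy m k (shiftBy m 1 p) ≡ shiftBy m (suc k) p
  shiftBy-suc left  k p = ∸-+-assoc p 1 k
  shiftBy-suc stay  k p = refl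
  shiftBy-suc right k p = +-suc k p

  shiftBy-zero : ∀ m p → shiftBy m 0 p ≡ p
  shiftBy-zero left  p = refl
  shiftBy-zero stay  p = refl
  shiftBy-zero right p = refl

  -- All heads move in step, so the heads watched by the guard dictate the number of rounds and the
  -- others count along. The last hypothesis keeps the heads that move left on their tapes.
  Runs-sweep : ∀ {g m c} k {p} →
    (∀ j → j < k → g (heads (store (shifted m j p) c)) ≡ true) →
    g (heads (store (shifted m k p) c)) ≡ false →
    (∀ i → m i ≡ left → k ≤ p i) →
    Runs (while g (move m)) (store p c) (1 + k * 2) (store (shifted m k p) c)
  Runs-sweep {g} {m} {c} zero {p} _ stop _ =
    Runs-≈ˡ (Runs-done stop) (same-cells λ i → shiftBy-zero (m i) (p i))
  Runs-sweep {g} {m} {c} (suc k) {p} go stop enough =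
    Runs-loop (trans (cong g (heads-cong {store p c} {store (shifted m 0 p) c}
      (same-cells λ i → sym (shiftBy-zero (m i) (p i))))) (go 0 z<s))
      (Runs-move λ i → Shift-shiftBy (m i) (p i) λ e → ≤-trans (s≤s z≤n) (enough i e))
      (Runs-≈ʳ (Runs-sweep k
        (λ j j<k → trans (cong g (heads-cong (later j))) (go (suc j) (s<s j<k)))
        (trans (cong g (heads-cong (later k))) stop)
        (λ i e → subst (λ m → k ≤ shiftBy m 1 (p i)) (sym e) (∸-monoˡ-≤ 1 (enough i e))))
        (later k))
    where
    later : ∀ j → store (shifted m j (shifted m 1 p)) c ≈ store (shifted m (suc j) p) c
    later j = same-cells λ i → shiftBy-suc (m i) j (p i)

  -- Since position 0 can be recognised, a head can be sent back there from an unknown position.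
  Marked : (ℕ → Γ) → Set
  Marked f = ∀ j → isMark (f j) ≡ (j ≡ᵇ 0)

  notMark-heads : ∀ i p c → Marked (c i) → notMark i (heads (store p c)) ≡ not (p i ≡ᵇ 0)
  notMark-heads i p c mk = cong not (trans (cong isMark (heads-at (store p c) i)) (mk (p i)))

  Runs-drain : ∀ {i m p c} → Marked (c i) → m i ≡ left → (∀ j → m j ≡ left → p i ≤ p j) →
    Runs (while (notMark i) (move m)) (store p c) (1 + p i * 2) (store (shifted m (p i) p) c)
  Runs-drain {i} {m} {p} {c} mk mi enough = Runs-sweep (p i)
    (λ j j<k → trans (notMark-heads i (shifted m j p) c mk) (trans (cong (λ k → not (k ≡ᵇ 0)) (at-left j))
      (positive (m<n⇒0<n∸m j<k))))
    (trans (notMark-heads i (shifted m (p i) p) c mk) (cong (λ k → not (k ≡ᵇ 0)) (trans (at-left (p i)) (n∸n≡0 (p i)))))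
    enough
    where
    at-left : ∀ j → shifted m j p i ≡ p i ∸ j
    at-left j = cong (λ m → shiftBy m j (p i)) mi
    positive : ∀ {k} → 0 < k → not (k ≡ᵇ 0) ≡ true
    positive z<s = refl

  -- Between the inner loops that address a cell, only the scratch head, one table head and one
  -- pointer are displaced.
  put : (Id → ℕ) → ℕ → Fin NT → ℕ → Fin D → ℕ → Id → ℕ
  put p s t a x v U        = p U
  put p s t a x v S        = s
  put p s t a x v F        = p F
  put p s t a x v (tab t′) = ((p ∘ tab) [ t ↦ a ]) t′
  put p s t a x v (ptr x′) = ((p ∘ ptr) [ x ↦ v ]) x′

  on : ∀ {k} → Fin k → Move → Fin k → Move
  on i m j with j Fin.≟ i
  ... | yes _ = m
  ... | no _  = stay

  on-same : ∀ {k} (i : Fin k) m → on i m i ≡ m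
  on-same i m with i Fin.≟ i
  ... | yes _  = refl
  ... | no i≢i = contradiction refl i≢i

  Shift-on : ∀ {k m a a′} {f : Fin k → ℕ} i → Shift m a a′ → ∀ j → Shift (on i m j) ((f [ i ↦ a ]) j) ((f [ i ↦ a′ ]) j)
  Shift-on i sh j with j Fin.≟ i
  ... | yes _ = sh
  ... | no _  = stay

  count back : Fin NT → Fin D → Id → Move
  count t x S        = right
  count t x (tab t′) = on t right t′
  count t x (ptr x′) = on x left x′
  count t x _        = stay
  back t x S         = left
  back t x (ptr x′)  = on x right x′
  back t x _         = stay

  Runs-count : ∀ {p s t a x v c} →
    Runs (move (count t x)) (store (put p s t a x (suc v)) c) 1 (store (put p (suc s) t (suc a) x v) c)
  Runs-count {t = t} {x = x} = Runs-move λ where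
    U        → stay
    S        → right
    F        → stay
    (tab t′) → Shift-on t right t′
    (ptr x′) → Shift-on x left x′

  Runs-back : ∀ {p s t a x v c} →
    Runs (move (back t x)) (store (put p (suc s) t a x v) c) 1 (store (put p s t a x (suc v)) c)
  Runs-back {t = t} {x = x} = Runs-move λ where
    U        → stay
    S        → left
    F        → stay
    (tab t′) → stay
    (ptr x′) → Shift-on x right x′

  -- Adding a pointer to a table head drives the pointer down to 0; the scratch counter has recorded
  -- the distance and gives it back.
  restore : Fin NT → Fin D → Code
  restore t x = while (notMark S) (move (back t x))

  Runs-restore : ∀ {p t a x v c} s → Marked (c S) →
    Runs (restore t x) (store (put p s t a x v) c) (1 + s * 2) (store (put p 0 t a x (s + v)) c)
  Runs-restore {p} {t} {a} {x} {v} {c} zero mk = Runs-done (notMark-heads S (put p 0 t a x v) c mk)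
  Runs-restore {p} {t} {a} {x} {v} {c} (suc s) mk = Runs-loop (notMark-heads S (put p (suc s) t a x v) c mk) Runs-back
    (subst (λ w → Runs (restore t x) (store (put p s t a x (suc v)) c) (1 + s * 2) (store (put p 0 t a x w) c))
      (+-suc s v) (Runs-restore s mk))

  add : Fin NT → Fin D → Code
  add t x = while (notMark (ptr x)) (move (count t x)) ∙ restore t x

  put-ptr : ∀ p s t a x v → put p s t a x v (ptr x) ≡ v
  put-ptr p s t a x v = ↦-same (p ∘ ptr) x v

  notMark-put : ∀ p s t a x v c → Marked (c (ptr x)) →
    notMark (ptr x) (heads (store (put p s t a x v) c)) ≡ not (v ≡ᵇ 0)
  notMark-put p s t a x v c mk =
    trans (notMark-heads (ptr x) (put p s t a x v) c mk) (cong (λ v → not (v ≡ᵇ 0)) (put-ptr p s t a x v))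

  Runs-add : ∀ {p t a x v c} → Marked (c S) → Marked (c (ptr x)) →
    Runs (add t x) (store (put p 0 t a x v) c) (1 + v * 2 + (1 + v * 2)) (store (put p 0 t (v + a) x v) c)
  Runs-add {p} {t} {a} {x} {v} {c} mS mx = Runs-∙ first (subst
      (λ w → Runs (restore t x) (store (put p v t (v + a) x 0) c) (1 + v * 2) (store (put p 0 t (v + a) x w) c))
      (+-identityʳ v) (Runs-restore v mS))
    where
    counting : ∀ v s a → Runs (while (notMark (ptr x)) (move (count t x))) (store (put p s t a x v) c) (1 + v * 2)
                              (store (put p (v + s) t (v + a) x 0) c)
    counting zero    s a = Runs-done (notMark-put p s t a x 0 c mx)
    counting (suc v) s a = Runs-loop (notMark-put p s t a x (suc v) c mx) Runs-count
      (subst₂ (λ s′ a′ → Runs (while (notMark (ptr x)) (move (count t x))) (store (put p (suc s) t (suc a) x v) c)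
        (1 + v * 2) (store (put p s′ t a′ x 0) c))
        (+-suc v s) (+-suc v a) (counting v (suc s) (suc a)))
    first : Runs (while (notMark (ptr x)) (move (count t x))) (store (put p 0 t a x v) c) (1 + v * 2)
                 (store (put p v t (v + a) x 0) c)
    first = subst (λ s → Runs (while (notMark (ptr x)) (move (count t x))) (store (put p 0 t a x v) c) (1 + v * 2)
                              (store (put p s t (v + a) x 0) c)) (+-identityʳ v) (counting v 0 a)

  record Delimited (N : ℕ) (f : ℕ → Γ) : Set where
    field
      nonblank : ∀ j → j < N → isBlank (f j) ≡ false
      end      : isBlank (f N) ≡ true
      marked   : Marked f
  open Delimited public

  notBlank-heads : ∀ i p c → notBlank i (heads (store p c)) ≡ not (isBlank (c i (p i)))
  notBlank-heads i p c = cong (not ∘ isBlank) (heads-at (store p c) i)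

  along rewindU : Fin NT → Id → Move
  along t U        = right
  along t (tab t′) = on t right t′
  along t _        = stay
  rewindU t U = left
  rewindU t _ = stay

  -- The word tape serves as a ruler of length `N`: the table head moves along until the blank at
  -- its end, then the ruler is rewound.
  row : Fin NT → Code
  row t = while (notBlank U) (move (along t)) ∙ while (notMark U) (move (rewindU t))

  Runs-row : ∀ {N p s t a x v c} → Delimited N (c U) → p U ≡ 0 →
    Runs (row t) (store (put p s t a x v) c) (1 + N * 2 + (1 + N * 2)) (store (put p s t (N + a) x v) c)
  Runs-row {N} {p} {s} {t} {a} {x} {v} {c} dl pU = Runs-∙
    (Runs-sweep N
      (λ j j<N → trans (notBlank-heads U (shifted (along t) j p₀) c)
        (cong not (trans (cong (isBlank ∘ c U) (posU j)) (nonblank dl j j<N))))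
      (trans (notBlank-heads U (shifted (along t) N p₀) c) (cong not (trans (cong (isBlank ∘ c U) (posU N)) (end dl))))
      (λ { U () ; S () ; F () ; (tab t′) e → contradiction e (never t′) ; (ptr x′) () }))
    (Runs-≤ (≤-reflexive (cong (λ k → 1 + k * 2) (posU N)))
      (Runs-≈ʳ (Runs-drain {U} {rewindU t} {shifted (along t) N p₀} (marked dl) refl
        (λ { U _ → ≤-refl ; S () ; F () ; (tab _) () ; (ptr _) () })) (same-cells final)))
    where
    p₀ = put p s t a x v
    posU : ∀ j → j + p U ≡ j
    posU j = trans (cong (j +_) pU) (+-identityʳ j)
    never : ∀ t′ → on t right t′ ≢ left
    never t′ e with t′ Fin.≟ t
    never t′ () | yes _
    never t′ () | no _
    final : ∀ i → shifted (rewindU t) (shifted (along t) N p₀ U) (shifted (along t) N p₀) i ≡ put p s t (N + a) x v i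
    final U = trans (n∸n≡0 (N + p U)) (sym pU)
    final S = refl
    final F = refl
    final (tab t′) with t′ Fin.≟ t
    ... | yes _ = refl
    ... | no _  = refl
    final (ptr x′) = refl

  shiftPtr : Fin D → Id → Move
  shiftPtr x S        = right
  shiftPtr x (ptr x′) = on x left x′
  shiftPtr x _        = stay

  rows : Fin NT → Fin D → Code
  rows t x = while (notMark (ptr x)) (move (shiftPtr x) ∙ row t) ∙ restore t x

  rowTime : ℕ → ℕ
  rowTime N = 1 + (1 + N * 2 + (1 + N * 2))

  Runs-rows : ∀ {N p t a x v c} → Marked (c S) → Marked (c (ptr x)) → Delimited N (c U) → p U ≡ 0 →
    Runs (rows t x) (store (put p 0 t a x v) c) (1 + v * suc (rowTime N) + (1 + v * 2)) (store (put p 0 t (v * N + a) x v) c)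
  Runs-rows {N} {p} {t} {a} {x} {v} {c} mS mx dl pU = Runs-∙ first (subst
      (λ w → Runs (restore t x) (store (put p v t (v * N + a) x 0) c) (1 + v * 2) (store (put p 0 t (v * N + a) x w) c))
      (+-identityʳ v) (Runs-restore v mS))
    where
    body : ∀ {s a v} → Runs (move (shiftPtr x) ∙ row t) (store (put p s t a x (suc v)) c) (rowTime N)
      (store (put p (suc s) t (N + a) x v) c)
    body {s} {a} {v} = Runs-∙ (Runs-move {shiftPtr x} {put p s t a x (suc v)} {put p (suc s) t a x v} λ where
        U        → stay
        S        → right
        F        → stay
        (tab t′) → stay
        (ptr x′) → Shift-on x left x′) (Runs-row dl pU)
    loops : ∀ v s a → Runs (while (notMark (ptr x)) (move (shiftPtr x) ∙ row t)) (store (put p s t a x v) c)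
      (1 + v * suc (rowTime N))
                           (store (put p (v + s) t (v * N + a) x 0) c)
    loops zero    s a = Runs-done (notMark-put p s t a x 0 c mx)
    loops (suc v) s a = Runs-≤ (≤-reflexive (arith (rowTime N) (v * suc (rowTime N))))
      (Runs-loop (notMark-put p s t a x (suc v) c mx) body
      (subst₂ (λ s′ a′ → Runs (while (notMark (ptr x)) (move (shiftPtr x) ∙ row t))
        (store (put p (suc s) t (N + a) x v) c) (1 + v * suc (rowTime N)) (store (put p s′ t a′ x 0) c))
        (+-suc v s) (rearrange v N a) (loops v (suc s) (N + a))))
      where
      arith : ∀ r k → suc r + (1 + k) ≡ 1 + (suc r + k)
      arith = solve-∀
      rearrange : ∀ v N a → v * N + (N + a) ≡ suc v * N + a
      rearrange = solve-∀
    first : Runs (while (notMark (ptr x)) (move (shiftPtr x) ∙ row t)) (store (put p 0 t a x v) c) (1 + v * suc (rowTime N))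
                 (store (put p v t (v * N + a) x 0) c)
    first = subst (λ s → Runs (while (notMark (ptr x)) (move (shiftPtr x) ∙ row t)) (store (put p 0 t a x v) c)
      (1 + v * suc (rowTime N))
                              (store (put p s t (v * N + a) x 0) c)) (+-identityʳ v) (loops v 0 a)

  tabAt : (Id → ℕ) → Fin NT → ℕ → Id → ℕ
  tabAt p t a (tab t′) = ((p ∘ tab) [ t ↦ a ]) t′
  tabAt p t a i        = p i

  put≗tabAt : ∀ {p t a x v} → p S ≡ 0 → p (ptr x) ≡ v → ∀ i → put p 0 t a x v i ≡ tabAt p t a i
  put≗tabAt pS px U        = refl
  put≗tabAt pS px S        = sym pS
  put≗tabAt pS px F        = refl
  put≗tabAt pS px (tab t′) = refl
  put≗tabAt {p} pS px (ptr x′) = ↦-id (p ∘ ptr) px x′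

  onTab : Move → Fin NT → Id → Move
  onTab m t (tab t′) = on t m t′
  onTab m t _        = stay

  seek : Fin NT → Fin D → Fin D → Code
  seek t x y = move (onTab right t) ∙ rows t x ∙ add t y

  unseek : Fin NT → Code
  unseek t = while (notMark (tab t)) (move (onTab left t))

  -- Row-major order, shifted by 1 because cell 0 of a table tape holds the mark.
  cellIndex : ℕ → ℕ → ℕ → ℕ
  cellIndex N a b = b + (a * N + 1)

  Runs-seek : ∀ {N p t x y c} → Marked (c S) → (∀ j → Marked (c (ptr j))) → Delimited N (c U) →
    p U ≡ 0 → p S ≡ 0 → p (tab t) ≡ 0 →
    let a = p (ptr x) ; b = p (ptr y) in
    Runs (seek t x y) (store p c) (1 + ((1 + a * suc (rowTime N) + (1 + a * 2)) + (1 + b * 2 + (1 + b * 2))))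
      (store (tabAt p t (cellIndex N a b)) c)
  Runs-seek {N} {p} {t} {x} {y} {c} mS mP dl pU pS pT = Runs-∙
    (Runs-move {p′ = tabAt p t 1} λ { U → stay ; S → stay ; F → stay ; (tab t′) → step t′ ; (ptr _) → stay })
    (Runs-∙
      (Runs-≈ˡ (Runs-≈ʳ (Runs-rows {x = x} {v = p (ptr x)} mS (mP x) dl pU) (same-cells (put≗tabAt {p} {t} pS refl)))
        (same-cells (put≗tabAt {p} {t} pS refl)))
      (Runs-≈ˡ (Runs-≈ʳ (Runs-add {x = y} {v = p (ptr y)} mS (mP y)) (same-cells (put≗tabAt {p} {t} pS refl)))
        (same-cells (put≗tabAt {p} {t} pS refl))))
    where
    step : ∀ t′ → Shift (on t right t′) (p (tab t′)) (((p ∘ tab) [ t ↦ 1 ]) t′)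
    step t′ with t′ Fin.≟ t
    ... | yes refl = subst (λ k → Shift right k 1) (sym pT) right
    ... | no _     = stay

  Runs-unseek : ∀ {p t a c} → Marked (c (tab t)) → p (tab t) ≡ 0 →
    Runs (unseek t) (store (tabAt p t a) c) (1 + a * 2) (store p c)
  Runs-unseek {p} {t} {a} {c} mk pT = Runs-≤ (≤-reflexive (cong (λ a → 1 + a * 2) at-t))
    (Runs-≈ʳ (Runs-drain {tab t} {onTab left t} {tabAt p t a} mk (on-same t left)
      (λ { U () ; S () ; F () ; (ptr _) () ; (tab t′) e → ≤-reflexive (cong (((p ∘ tab) [ t ↦ a ])) (sym (only t′ e))) }))
      (same-cells λ { U → refl ; S → refl ; F → refl ; (ptr _) → refl ; (tab t′) → final t′ }))
    where
    at-t : tabAt p t a (tab t) ≡ a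
    at-t = ↦-same (p ∘ tab) t a
    only : ∀ t′ → on t left t′ ≡ left → t′ ≡ t
    only t′ e with t′ Fin.≟ t
    only t′ e | yes t′≡t = t′≡t
    only t′ () | no _
    final : ∀ t′ → shiftBy (on t left t′) (tabAt p t a (tab t)) (tabAt p t a (tab t′)) ≡ p (tab t′)
    final t′ with t′ Fin.≟ t
    ... | yes refl = trans (cong (a ∸_) at-t) (trans (n∸n≡0 a) (sym pT))
    ... | no _     = refl

  putF : (Id → ℕ → Γ) → Γ → Id → ℕ → Γ
  putF c g F = upd (c F) 0 g
  putF c g i = c i

  putT : (Id → ℕ → Γ) → Fin NT → ℕ → Γ → Id → ℕ → Γ
  putT c t k g (tab t′) = ((c ∘ tab) [ t ↦ upd (c (tab t)) k g ]) t′
  putT c t k g i        = c i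

  setF : (Heads → Bool) → Code
  setF f = act λ where
    hs F → bit′ (f hs) , stay
    hs i → hs at i , stay

  copyF : Fin NT → Code
  copyF t = act λ where
    hs (tab t′) → ((λ t → hs at tab t) [ t ↦ bit′ (isOne (hs at F)) ]) t′ , stay
    hs i        → hs at i , stay

  keep : ∀ {p c} i → ∀ j → c i j ≡ upd (c i) (p i) (heads (store p c) at i) j
  keep {p} {c} i j = sym (upd-id (c i) (sym (heads-at (store p c) i)) j)

  Runs-setF : ∀ {f p c} → p F ≡ 0 → Runs (setF f) (store p c) 1 (store p (putF c (bit′ (f (heads (store p c))))))
  Runs-setF {f} {p} {c} pF = Runs-act record
    { moves  = λ { U → stay ; S → stay ; F → stay ; (tab _) → stay ; (ptr _) → stay }
    ; writes = λ where
        U       → keep {p} {c} U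
        S       → keep {p} {c} S
        F       → λ j → cong (λ k → upd (c F) k (bit′ (f (heads (store p c)))) j) (sym pF)
        (tab t) → keep {p} {c} (tab t)
        (ptr x) → keep {p} {c} (ptr x) }

  Runs-copyF : ∀ {t k p c} → p (tab t) ≡ k →
    Runs (copyF t) (store p c) 1 (store p (putT c t k (bit′ (isOne (heads (store p c) at F)))))
  Runs-copyF {t} {k} {p} {c} pT = Runs-act record
    { moves  = λ { U → stay ; S → stay ; F → stay ; (tab _) → stay ; (ptr _) → stay }
    ; writes = λ where
        U        → keep {p} {c} U
        S        → keep {p} {c} S
        F        → keep {p} {c} F
        (tab t′) → table t′
        (ptr x)  → keep {p} {c} (ptr x) }
    where
    g = bit′ (isOne (heads (store p c) at F))
    table : ∀ t′ j → ((c ∘ tab) [ t ↦ upd (c (tab t)) k g ]) t′ j ≡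
                     upd (c (tab t′)) (p (tab t′)) (((λ t → heads (store p c) at tab t) [ t ↦ g ]) t′) j
    table t′ j with t′ Fin.≟ t
    ... | yes refl = cong (λ k → upd (c (tab t)) k g j) (sym pT)
    ... | no _     = keep {p} {c} (tab t′) j

  -- If the two pointers coincide, the common one still moves only once.
  both : Fin D → Fin D → Move → Fin D → Move
  both x y m z with z Fin.≟ x | z Fin.≟ y
  ... | yes _ | _     = m
  ... | no _  | yes _ = m
  ... | no _  | no _  = stay

  descend ascend : Fin D → Fin D → Id → Move
  descend x y S       = right
  descend x y (ptr z) = both x y left z
  descend x y _       = stay
  ascend x y S        = left
  ascend x y (ptr z)  = both x y right z
  ascend x y _        = stay

  -- Both pointers descend until one of them meets its mark; the first is then at its mark iff it
  -- was not the larger one. The scratch counter holds the common distance for the way back.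
  compareP : Fin D → Fin D → Code
  compareP x y = while (λ hs → notMark (ptr x) hs ∧ notMark (ptr y) hs) (move (descend x y))
    ∙ setF (λ hs → isMark (hs at ptr x))
    ∙ while (notMark S) (move (ascend x y))

  ∸⊓ : ∀ a b → (a ∸ (a ⊓ₙ b) ≡ᵇ 0) ≡ does (a ≤? b)
  ∸⊓ zero    b       = refl
  ∸⊓ (suc a) zero    = refl
  ∸⊓ (suc a) (suc b) = trans (∸⊓ a b) (suc≤ᵇ a b)
    where
    suc≤ᵇ : ∀ a b → does (a ≤? b) ≡ does (suc a ≤? suc b)
    suc≤ᵇ zero    b = refl
    suc≤ᵇ (suc a) b = refl

  Runs-compare : ∀ {p x y c} → Marked (c S) → (∀ j → Marked (c (ptr j))) → p S ≡ 0 → p F ≡ 0 →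
    let a = p (ptr x) ; b = p (ptr y) in
    Runs (compareP x y) (store p c) (1 + (a ⊓ₙ b) * 2 + (1 + (1 + (a ⊓ₙ b) * 2))) (store p (putF c (bit′ (does (a ≤? b)))))
  Runs-compare {p} {x} {y} {c} mS mP pS pF = Runs-∙
    (Runs-sweep k
      (λ j j<k → trans (guard j) (go j j<k))
      (trans (guard k) stop)
      enough)
    (Runs-∙ (Runs-setF pF)
      (Runs-≤ (≤-reflexive (cong (λ k → 1 + k * 2) kS))
        (Runs-≈ˡ
          (Runs-≈ʳ (Runs-drain {S} {ascend x y} {p₁} {c₁} mS refl
            (λ { U () ; S _ → ≤-refl ; F () ; (tab _) () ; (ptr z) e → contradiction e (never z) }))
            (same-cells final))
          (record { pos≈ = λ _ → refl ; cell≈ = λ i j → cong (λ b → putF c (bit′ b) i j) (sym flag) }))))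
    where
    a = p (ptr x)
    b = p (ptr y)
    k = a ⊓ₙ b
    p₁ = shifted (descend x y) k p
    c₁ = putF c (bit′ (does (a ≤? b)))
    kS : k + p S ≡ k
    kS = trans (cong (k +_) pS) (+-identityʳ k)
    at-x : ∀ m j → shiftBy (both x y m x) j a ≡ shiftBy m j a
    at-x m j with x Fin.≟ x
    ... | yes _  = refl
    ... | no x≢x = contradiction refl x≢x
    at-y : ∀ m j → shiftBy (both x y m y) j b ≡ shiftBy m j b
    at-y m j with y Fin.≟ x | y Fin.≟ y
    ... | yes _ | _      = refl
    ... | no _  | yes _  = refl
    ... | no _  | no y≢y = contradiction refl y≢y
    guard : ∀ j → _ ≡ not (a ∸ j ≡ᵇ 0) ∧ not (b ∸ j ≡ᵇ 0)
    guard j = cong₂ _∧_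
      (trans (notMark-heads (ptr x) (shifted (descend x y) j p) c (mP x)) (cong (λ k → not (k ≡ᵇ 0)) (at-x left j)))
      (trans (notMark-heads (ptr y) (shifted (descend x y) j p) c (mP y)) (cong (λ k → not (k ≡ᵇ 0)) (at-y left j)))
    positive : ∀ {k} → 0 < k → not (k ≡ᵇ 0) ≡ true
    positive z<s = refl
    go : ∀ j → j < k → not (a ∸ j ≡ᵇ 0) ∧ not (b ∸ j ≡ᵇ 0) ≡ true
    go j j<k = cong₂ _∧_ (positive (m<n⇒0<n∸m (<-≤-trans j<k (m⊓n≤m a b)))) (positive (m<n⇒0<n∸m (<-≤-trans j<k (m⊓n≤n a b))))
    stop : not (a ∸ k ≡ᵇ 0) ∧ not (b ∸ k ≡ᵇ 0) ≡ false
    stop = zero-one a b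
      where
      zero-one : ∀ a b → not (a ∸ (a ⊓ₙ b) ≡ᵇ 0) ∧ not (b ∸ (a ⊓ₙ b) ≡ᵇ 0) ≡ false
      zero-one zero    b       = refl
      zero-one (suc a) zero    = refl
      zero-one (suc a) (suc b) = zero-one a b
    enough : ∀ i → descend x y i ≡ left → k ≤ p i
    enough (ptr z) e with z Fin.≟ x | z Fin.≟ y
    enough (ptr z) e  | yes refl | _        = m⊓n≤m a b
    enough (ptr z) e  | no _     | yes refl = m⊓n≤n a b
    enough (ptr z) () | no _     | no _
    never : ∀ z → both x y right z ≢ left
    never z e with z Fin.≟ x | z Fin.≟ y
    never z () | yes _ | _
    never z () | no _  | yes _
    never z () | no _  | no _
    flag : isMark (heads (store p₁ c) at ptr x) ≡ does (a ≤? b)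
    flag = trans (cong isMark (heads-at (store p₁ c) (ptr x)))
      (trans (mP x (p₁ (ptr x))) (trans (cong (_≡ᵇ 0) (at-x left k)) (∸⊓ a b)))
    restored : ∀ {q} → k ≤ q → k + p S + (q ∸ k) ≡ q
    restored {q} k≤q = trans (cong (_+ (q ∸ k)) kS) (m+[n∸m]≡n k≤q)
    final : ∀ i → shifted (ascend x y) (p₁ S) p₁ i ≡ p i
    final U = refl
    final S = trans (n∸n≡0 (k + p S)) (sym pS)
    final F = refl
    final (tab t) = refl
    final (ptr z) with z Fin.≟ x | z Fin.≟ y
    ... | yes refl | _        = restored (m⊓n≤m a b)
    ... | no _     | yes refl = restored (m⊓n≤n a b)
    ... | no _     | no _     = refl

-- A total coercion keeps bounds on pointer numbers out of the code; they enter only in the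
-- correctness proofs.
clamp : ∀ {D} → ℕ → Fin (suc D)
clamp zero            = zero
clamp {zero}  (suc j) = zero
clamp {suc D} (suc j) = suc (clamp j)

toℕ-clamp : ∀ {D j} → j ≤ D → toℕ (clamp {D} j) ≡ j
toℕ-clamp {j = zero}        z≤n       = refl
toℕ-clamp {suc D} {suc j} (s≤s j≤D) = cong suc (toℕ-clamp j≤D)

-- A Hoare logic for code acting on pointers, tables and a truth value

module Compile {Σ Q : Set} (finite-Σ : Finite Σ) (finite-Q : Finite Q) (D NT : ℕ) where

  open Machine finite-Σ finite-Q (suc D) (suc NT)
  open Primitives finite-Σ finite-Q (suc D) (suc NT)

  Nᵖ rowᵖ seekᵖ accessᵖ compareᵖ : Polynomial
  Nᵖ       = con 1 :+ var
  rowᵖ     = con 1 :+ (con 1 :+ Nᵖ :* con 2 :+ (con 1 :+ Nᵖ :* con 2))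
  seekᵖ    = con 1 :+ ((con 1 :+ (con 1 :+ rowᵖ) :* Nᵖ :+ (con 1 :+ Nᵖ :* con 2))
                 :+ (con 1 :+ Nᵖ :* con 2 :+ (con 1 :+ Nᵖ :* con 2)))
  accessᵖ  = seekᵖ :+ (con 1 :+ (con 1 :+ (Nᵖ :+ (Nᵖ :* Nᵖ :+ con 1)) :* con 2))
  compareᵖ = con 1 :+ Nᵖ :* con 2 :+ (con 1 :+ (con 1 :+ Nᵖ :* con 2))

  load save : Fin (suc NT) → Fin (suc D) → Fin (suc D) → Code
  load t x y = seek t x y ∙ setF (λ hs → isOne (hs at tab t)) ∙ unseek t
  save t x y = seek t x y ∙ copyF t ∙ unseek t

  skip : Code
  skip = move λ _ → stay

  flag : Heads → Bool
  flag hs = isOne (hs at F)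

  onPtr : Move → Fin (suc D) → Id → Move
  onPtr m x (ptr x′) = on x m x′
  onPtr m x _        = stay

  -- The pointer visits the positions 0 to `N - 1`, stops at the blank after the word and is sent
  -- back to 0, so that a finished loop leaves no trace in the pointers.
  for : Fin (suc D) → Code → Code
  for x c = while (notBlank (ptr x)) (c ∙ move (onPtr right x)) ∙ while (notMark (ptr x)) (move (onPtr left x))

  forᵖ : Polynomial → Polynomial
  forᵖ p = (con 1 :+ (con 1 :+ (p :+ con 1)) :* Nᵖ) :+ (con 1 :+ Nᵖ :* con 2)

  place : (Fin (suc D) → ℕ) → Id → ℕ
  place π (ptr x) = π x
  place π _       = 0

  module _ (v : List Q) where

    open Semantics {Q} {NT} v using (N)

    n : ℕ
    n = length v

    word : ℕ → Γ
    word zero    = mark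
    word (suc j) = nth blank (map (λ q → ltr q) v) j

    word-marked : Marked word
    word-marked zero    = refl
    word-marked (suc j) = letters v j
      where
      letters : ∀ v j → isMark (nth blank (map (λ q → ltr q) v) j) ≡ false
      letters []      j       = refl
      letters (q ∷ v) zero    = refl
      letters (q ∷ v) (suc j) = letters v j

    word-delimited : Delimited N word
    word-delimited = record { nonblank = nonblank′ ; end = end′ v ; marked = word-marked }
      where
      nonblank′ : ∀ j → j < N → isBlank (word j) ≡ false
      nonblank′ zero    _         = refl
      nonblank′ (suc j) (s≤s j<n) = letters v j j<n
        where
        letters : ∀ v j → j < length v → isBlank (nth blank (map (λ q → ltr q) v) j) ≡ false
        letters (q ∷ v) zero    _         = refl
        letters (q ∷ v) (suc j) (s≤s j<n) = letters v j j<n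
      end′ : ∀ v → isBlank (nth blank (map (λ q → ltr q) v) (length v)) ≡ true
      end′ []      = refl
      end′ (q ∷ v) = end′ v

    Tables⁺ : Set
    Tables⁺ = Fin (suc NT) → Table

    -- What a store encodes between instructions. All heads other than the pointers rest at 0, and
    -- every pointer tape holds a copy of the word, so that a pointer reads the letter at its
    -- position.
    record Good (π : Fin (suc D) → ℕ) (σ : Tables⁺) (b : Bool) (s : Store) : Set where
      field
        position : ∀ i → pos s i ≡ place π i
        wordU    : ∀ j → cell s U j ≡ word j
        wordP    : ∀ x j → cell s (ptr x) j ≡ word j
        markS    : Marked (cell s S)
        markT    : ∀ t → Marked (cell s (tab t))
        truth    : isOne (cell s F 0) ≡ b
        table    : ∀ t x y → x < N → y < N → isOne (cell s (tab t) (cellIndex N x y)) ≡ σ t x y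
    open Good

    Good-π : ∀ {π π′ σ b s} → (∀ x → π x ≡ π′ x) → Good π σ b s → Good π′ σ b s
    Good-π e g = record
      { position = λ { U → position g U ; S → position g S ; F → position g F ; (tab t) → position g (tab t)
                     ; (ptr x) → trans (position g (ptr x)) (e x) }
      ; wordU = wordU g ; wordP = wordP g ; markS = markS g ; markT = markT g ; truth = truth g ; table = table g }

    Good-place : ∀ {π π′ σ b s} → Good π σ b s → Good π′ σ b (store (place π′) (cell s))
    Good-place g = record
      { position = λ _ → refl
      ; wordU = wordU g ; wordP = wordP g ; markS = markS g ; markT = markT g ; truth = truth g ; table = table g }

    Good-putF : ∀ {π σ b s} b′ → Good π σ b s → Good π σ b′ (store (place π) (putF (cell s) (bit′ b′)))
    Good-putF {s = s} b′ g = record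
      { position = λ _ → refl
      ; wordU = wordU g ; wordP = wordP g ; markS = markS g ; markT = markT g
      ; truth = trans (cong isOne (upd-same (cell s F) 0 (bit′ b′))) (isOne-bit b′) ; table = table g }

    -- The column is the remainder modulo `N`; the row then follows by cancellation.
    cellIndex-injective : ∀ x y x′ y′ → y < N → y′ < N → cellIndex N x y ≡ cellIndex N x′ y′ → x ≡ x′ × y ≡ y′
    cellIndex-injective x y x′ y′ y< y′< e = *-cancelʳ-≡ x x′ N
      (+-cancelˡ-≡ y (x * N) (x′ * N) (trans e″ (cong (_+ x′ * N) (sym y≡y′)))) , y≡y′
      where
      e″ : y + x * N ≡ y′ + x′ * N
      e″ = suc-injective (trans (sym (shape y (x * N))) (trans e (shape y′ (x′ * N))))
        where
        shape : ∀ a b → a + (b + 1) ≡ suc (a + b)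
        shape = solve-∀
      y≡y′ : y ≡ y′
      y≡y′ = begin
        y                   ≡⟨ sym (m<n⇒m%n≡m y<) ⟩
        y % N               ≡⟨ sym ([m+kn]%n≡m%n y x N) ⟩
        (y + x * N) % N     ≡⟨ cong (_% N) e″ ⟩
        (y′ + x′ * N) % N   ≡⟨ [m+kn]%n≡m%n y′ x′ N ⟩
        y′ % N              ≡⟨ m<n⇒m%n≡m y′< ⟩
        y′                  ∎
        where open ≡-Reasoning

    record Updated (σ : Tables⁺) (t : Fin (suc NT)) (x y : ℕ) (b : Bool) (σ′ : Tables⁺) : Set where
      field
        updated   : σ′ t x y ≡ b
        unchanged : ∀ t′ x′ y′ → ¬ (t′ ≡ t × x′ ≡ x × y′ ≡ y) → σ′ t′ x′ y′ ≡ σ t′ x′ y′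
    open Updated

    Good-putT : ∀ {π σ σ′ b s t x y} b′ → x < N → y < N → Updated σ t x y b′ σ′ → Good π σ b s →
                Good π σ′ b (store (place π) (putT (cell s) t (cellIndex N x y) (bit′ b′)))
    Good-putT {σ = σ} {σ′} {s = s} {t} {x} {y} b′ x< y< up g = record
      { position = λ _ → refl
      ; wordU = wordU g ; wordP = wordP g ; markS = markS g ; markT = markT′ ; truth = truth g ; table = table′ }
      where
      k = cellIndex N x y
      bit-unmarked : ∀ b → isMark (bit′ b) ≡ false
      bit-unmarked true  = refl
      bit-unmarked false = refl
      positive : (k ≡ᵇ 0) ≡ false
      positive = cong (_≡ᵇ 0) (shape y (x * N))
        where
        shape : ∀ a b → a + (b + 1) ≡ suc (a + b)
        shape = solve-∀
      markT′ : ∀ t′ → Marked (putT (cell s) t k (bit′ b′) (tab t′))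
      markT′ t′ j with t′ Fin.≟ t
      ... | no _     = markT g t′ j
      ... | yes refl with j ≟ k
      ...   | yes refl = trans (bit-unmarked b′) (sym positive)
      ...   | no _     = markT g t j
      table′ : ∀ t′ x′ y′ → x′ < N → y′ < N → isOne (putT (cell s) t k (bit′ b′) (tab t′) (cellIndex N x′ y′)) ≡ σ′ t′ x′ y′
      table′ t′ x′ y′ x′< y′< with t′ Fin.≟ t
      ... | no t′≢t  = trans (table g t′ x′ y′ x′< y′<) (sym (unchanged up t′ x′ y′ (t′≢t ∘ proj₁)))
      ... | yes refl with cellIndex N x′ y′ ≟ k
      ...   | no ≢k  = trans (table g t x′ y′ x′< y′<) (sym (unchanged up t x′ y′ λ { (_ , refl , refl) → ≢k refl }))
      ...   | yes e with cellIndex-injective x′ y′ x y y′< y< e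
      ...     | refl , refl = trans (isOne-bit b′) (sym (updated up))

    Good-≈ : ∀ {π σ b s} → Good π σ b s → store (place π) (cell s) ≈ s
    Good-≈ g = record { pos≈ = λ i → sym (position g i) ; cell≈ = λ _ _ → refl }

    markP : ∀ {π σ b s} → Good π σ b s → ∀ x → Marked (cell s (ptr x))
    markP g x j = trans (cong isMark (wordP g x j)) (word-marked j)

    delimU : ∀ {π σ b s} → Good π σ b s → Delimited N (cell s U)
    delimU g = record
      { nonblank = λ j j< → trans (cong isBlank (wordU g j)) (nonblank word-delimited j j<)
      ; end      = trans (cong isBlank (wordU g N)) (end word-delimited)
      ; marked   = λ j → trans (cong isMark (wordU g j)) (word-marked j) }

    flag-heads : ∀ {π σ b s} → Good π σ b s → flag (heads s) ≡ b
    flag-heads {s = s} g = trans (cong isOne (trans (heads-at s F) (cong (cell s F) (position g F)))) (truth g)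

    Good-setF : ∀ {π σ b s f} b′ → f (heads s) ≡ b′ → Good π σ b s → ∃ λ s′ → Runs (setF f) s 1 s′ × Good π σ b′ s′
    Good-setF {π} {s = s} {f} b′ e g = _ ,
      Runs-≈ˡ (Runs-≈ʳ (Runs-setF {f} {place π} {cell s} refl)
        (record { pos≈ = λ _ → refl ; cell≈ = λ i j → cong (λ b → putF (cell s) (bit′ b) i j)
          (trans (cong f (heads-cong (Good-≈ g))) e) }))
        (Good-≈ g) ,
      Good-putF b′ g

    Good-skip : ∀ {π σ b s} → Good π σ b s → Runs skip s 1 s
    Good-skip g = Runs-move λ _ → stay

    ≤seek : ∀ {a b} → a ≤ N → b ≤ N →
      1 + ((1 + a * suc (rowTime N) + (1 + a * 2)) + (1 + b * 2 + (1 + b * 2))) ≤ eval seekᵖ n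
    ≤seek {a} a≤ b≤ = s≤s (+-mono-≤ (+-mono-≤ (s≤s (≤-trans (≤-reflexive (*-comm a (suc (rowTime N))))
      (*-monoʳ-≤ (suc (rowTime N)) a≤))) (s≤s (*-monoˡ-≤ 2 a≤)))
                               (+-mono-≤ (s≤s (*-monoˡ-≤ 2 b≤)) (s≤s (*-monoˡ-≤ 2 b≤))))

    ≤unseek : ∀ {a b} → a ≤ N → b ≤ N → 1 + (1 + cellIndex N a b * 2) ≤ 1 + (1 + (N + (N * N + 1)) * 2)
    ≤unseek a≤ b≤ = s≤s (s≤s (*-monoˡ-≤ 2 (+-mono-≤ b≤ (+-monoˡ-≤ 1 (*-monoˡ-≤ N a≤)))))

    Good-load : ∀ {π σ b s} t x y → π x < N → π y < N → Good π σ b s →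
      ∃ λ s′ → Runs (load t x y) s (eval accessᵖ n) s′ × Good π σ (σ t (π x) (π y)) s′
    Good-load {π} {σ} {b} {s} t x y x< y< g = _ ,
      Runs-≈ˡ (Runs-≤ (+-mono-≤ (≤seek (<⇒≤ x<) (<⇒≤ y<)) (≤unseek (<⇒≤ x<) (<⇒≤ y<)))
        (Runs-∙ (Runs-seek {x = x} {y} (markS g) (markP g) (delimU g) refl refl refl)
        (Runs-∙ (Runs-≈ʳ (Runs-setF {λ hs → isOne (hs at tab t)} {p} {cell s} refl)
                  (record { pos≈ = λ _ → refl ; cell≈ = λ i j → cong (λ b → putF (cell s) (bit′ b) i j) value }))
                (Runs-unseek {t = t} (markT g t) refl))))
        (Good-≈ g) ,
      Good-putF _ g
      where
      p = tabAt (place π) t (cellIndex N (π x) (π y))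
      value : isOne (heads (store p (cell s)) at tab t) ≡ σ t (π x) (π y)
      value = trans (cong isOne (trans (heads-at (store p (cell s)) (tab t))
                (cong (cell s (tab t)) (↦-same (place π ∘ tab) t _)))) (table g t (π x) (π y) x< y<)

    Good-save : ∀ {π σ σ′ b s} t x y → π x < N → π y < N → Updated σ t (π x) (π y) b σ′ → Good π σ b s →
      ∃ λ s′ → Runs (save t x y) s (eval accessᵖ n) s′ × Good π σ′ b s′
    Good-save {π} {σ} {σ′} {b} {s} t x y x< y< up g = _ ,
      Runs-≈ˡ (Runs-≤ (+-mono-≤ (≤seek (<⇒≤ x<) (<⇒≤ y<)) (≤unseek (<⇒≤ x<) (<⇒≤ y<)))
        (Runs-∙ (Runs-seek {x = x} {y} (markS g) (markP g) (delimU g) refl refl refl)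
        (Runs-∙ (Runs-≈ʳ (Runs-copyF {t} {k} {p} {cell s} (↦-same (place π ∘ tab) t k))
                  (record { pos≈ = λ _ → refl ; cell≈ = λ i j → cong (λ b → putT (cell s) t k (bit′ b) i j) value }))
                (Runs-unseek {t = t} (markT after t) refl))))
        (Good-≈ g) ,
      after
      where
      k = cellIndex N (π x) (π y)
      p = tabAt (place π) t k
      after = Good-putT b x< y< up g
      value : isOne (heads (store p (cell s)) at F) ≡ b
      value = trans (cong isOne (heads-at (store p (cell s)) F)) (truth g)

    Good-compare : ∀ {π σ b s} x y → π x < N → Good π σ b s →
      ∃ λ s′ → Runs (compareP x y) s (eval compareᵖ n) s′ × Good π σ (does (π x ≤? π y)) s′
    Good-compare {π} {s = s} x y x< g = _ ,
      Runs-≈ˡ (Runs-≤ (+-mono-≤ (s≤s bound) (s≤s (s≤s bound)))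
        (Runs-compare {place π} {x} {y} {cell s} (markS g) (markP g) refl refl)) (Good-≈ g) ,
      Good-putF _ g
      where
      bound : (π x ⊓ₙ π y) * 2 ≤ N * 2
      bound = *-monoˡ-≤ 2 (≤-trans (m⊓n≤m (π x) (π y)) (<⇒≤ x<))

    record Result (π : Fin (suc D) → ℕ) (J : Tables⁺ → Bool → Set) (c : Code) (s : Store) (t : ℕ) : Set where
      constructor result
      field
        {tables} : Tables⁺
        {value}  : Bool
        {final}  : Store
        ran      : Runs c s t final
        good     : Good π tables value final
        holds    : J tables value

    -- Code described by such a triple returns all pointers to where they were, so the conditions
    -- need to speak of tables and the truth value only.
    record Hoare (π : Fin (suc D) → ℕ) (J : Tables⁺ → Bool → Set) (c : Code) (t : ℕ) (J′ : Tables⁺ → Bool → Set) : Set where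
      constructor hoare
      field
        execute : ∀ {σ b s} → J σ b → Good π σ b s → Result π J′ c s t
    open Hoare public

    Result-∙ : ∀ {π J J′ c d s t u} → Result π J c s t → Hoare π J d u J′ → Result π J′ (c ∙ d) s (t + u)
    Result-∙ (result r a j) g with execute g j a
    ... | result r′ a′ j′ = result (Runs-∙ r r′) a′ j′

    Hoare-∙ : ∀ {π J J′ J″ c d t u} → Hoare π J c t J′ → Hoare π J′ d u J″ → Hoare π J (c ∙ d) (t + u) J″
    Hoare-∙ f g = hoare λ j a → Result-∙ (execute f j a) g

    Result-map : ∀ {π J J′ c s t} → (∀ {σ b} → J σ b → J′ σ b) → Result π J c s t → Result π J′ c s t
    Result-map f (result r a j) = result r a (f j)

    Hoare-map : ∀ {π J₀ J J′ J″ c t} → (∀ {σ b} → J₀ σ b → J σ b) → (∀ {σ b} → J′ σ b → J″ σ b) → Hoare π J c t J′ →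
      Hoare π J₀ c t J″
    Hoare-map f g h = hoare λ j a → Result-map g (execute h (f j) a)

    Hoare-ite : ∀ {π J′ c d} J t u → Hoare π (λ σ b → J σ b × b ≡ true) c t J′ → Hoare π (λ σ b → J σ b × b ≡ false) d u J′ →
                Hoare π J (ite flag c d) (1 + (t + u)) J′
    Hoare-ite {π} {J′} {c} {d} J t u f g = hoare λ {_} {b} → branch b
      where
      branch : ∀ b {σ s} → J σ b → Good π σ b s → Result π J′ (ite flag c d) s (1 + (t + u))
      branch true  j a with execute f (j , refl) a
      ... | result r a′ j′ = result (Runs-≤ (s≤s (m≤m+n t u)) (Runs-then (flag-heads a) r)) a′ j′
      branch false j a with execute g (j , refl) a
      ... | result r a′ j′ = result (Runs-≤ (s≤s (m≤n+m u t)) (Runs-else (flag-heads a) r)) a′ j′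

    Hoare-skip : ∀ {π J} → Hoare π J skip 1 J
    Hoare-skip = hoare λ j a → result (Good-skip a) a j

    -- `J i` is the loop invariant after `i` rounds. The body may read the counter at `i` but must
    -- leave it there.
    Hoare-for : ∀ {π x c} p (J : ℕ → Tables⁺ → Bool → Set) → π x ≡ 0 →
      (∀ i → i < N → Hoare (π [ x ↦ i ]) (J i) c (eval p n) (J (suc i))) →
      Hoare π (J 0) (for x c) (eval (forᵖ p) n) (J N)
    Hoare-for {π} {x} {c} p J π0 body = hoare λ j a →
      rewind (iterations N 0 refl j (Good-π (λ y → sym (↦-id π π0 y)) a))
      where
      advance : ∀ {i σ b s} → Good (π [ x ↦ i ]) σ b s →
        ∃ λ s′ → Runs (move (onPtr right x)) s 1 s′ × Good (π [ x ↦ suc i ]) σ b s′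
      advance {i} g = _ , Runs-≈ˡ (Runs-move λ { U → stay ; S → stay ; F → stay ; (tab _) → stay ; (ptr y) → Shift-on
        x right y }) (Good-≈ g) ,
        Good-place g
      guard : ∀ {i σ b s} → Good (π [ x ↦ i ]) σ b s → notBlank (ptr x) (heads s) ≡ not (isBlank (word i))
      guard {i} {s = s} g = cong (not ∘ isBlank) (trans (heads-at s (ptr x)) (trans (wordP g x _)
        (cong word (trans (position g (ptr x)) (↦-same π x i)))))
      scanning : Code
      scanning = while (notBlank (ptr x)) (c ∙ move (onPtr right x))
      iterations : ∀ k i → i + k ≡ N → ∀ {σ b s} → J i σ b → Good (π [ x ↦ i ]) σ b s →
        Result (π [ x ↦ N ]) (J N) scanning s (1 + k * suc (eval p n + 1))
      iterations zero i e j a with trans (sym (+-identityʳ i)) e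
      ... | refl = result (Runs-done (trans (guard a) (cong not (end word-delimited)))) a j
      iterations (suc k) i e {σ} {b} {s} j a = continue (execute (body i i<N) j a)
        where
        i<N : i < N
        i<N = subst (i <_) e (m<m+n i z<s)
        arith : ∀ r k → suc r + (1 + k) ≡ 1 + (suc r + k)
        arith = solve-∀
        continue : Result (π [ x ↦ i ]) (J (suc i)) c s (eval p n) →
                   Result (π [ x ↦ N ]) (J N) scanning s (1 + suc k * suc (eval p n + 1))
        continue (result r a′ j′) with advance a′
        ... | s″ , r′ , a″ with iterations k (suc i) (trans (sym (+-suc i k)) e) j′ a″
        ... | result r″ a‴ j‴ = result
          (Runs-≤ (≤-reflexive (arith (eval p n + 1) (k * suc (eval p n + 1))))
            (Runs-loop (trans (guard a) (cong not (nonblank word-delimited i i<N))) (Runs-∙ r r′) r″)) a‴ j‴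
      atN : (π [ x ↦ N ]) x ≡ N
      atN = ↦-same π x N
      only : ∀ y → on x left y ≡ left → y ≡ x
      only y e with y Fin.≟ x
      only y e | yes y≡x = y≡x
      only y () | no _
      final′ : ∀ y → shiftBy (on x left y) ((π [ x ↦ N ]) x) ((π [ x ↦ N ]) y) ≡ π y
      final′ y with y Fin.≟ x
      ... | yes refl = trans (cong (N ∸_) atN) (trans (n∸n≡0 N) (sym π0))
      ... | no _     = refl
      rewind : ∀ {s} → Result (π [ x ↦ N ]) (J N) scanning s (1 + N * suc (eval p n + 1)) →
               Result π (J N) (for x c) s (eval (forᵖ p) n)
      rewind (result r a j) = result
        (Runs-∙ (Runs-≤ (≤-reflexive (cong suc (*-comm N (suc (eval p n + 1))))) r)
          (Runs-≈ˡ (Runs-≤ (≤-reflexive (cong (λ k → 1 + k * 2) atN))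
            (Runs-≈ʳ (Runs-drain {ptr x} {onPtr left x} {place (π [ x ↦ N ])} (markP a x) (on-same x left)
              λ { U () ; S () ; F () ; (tab _) () ; (ptr y) e → ≤-reflexive (cong (π [ x ↦ N ]) (sym (only y e))) })
              (same-cells λ { U → refl ; S → refl ; F → refl ; (tab _) → refl ; (ptr y) → final′ y })))
          (Good-≈ a)))
        (Good-place a) j

-- Compiling formulas

reflects-T : ∀ b → Reflects (T b) b
reflects-T true  = ofʸ tt
reflects-T false = ofⁿ λ ()

reflects-map : ∀ {p q} {P : Set p} {R : Set q} {b} → (P → R) → (R → P) → Reflects P b → Reflects R b
reflects-map f g (ofʸ p)  = ofʸ (f p)
reflects-map f g (ofⁿ ¬p) = ofⁿ (¬p ∘ g)

reflects-¬ : ∀ {P : Set} {b} → Reflects P b → Reflects (¬ P) (not b)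
reflects-¬ (ofʸ p)  = ofⁿ λ ¬p → ¬p p
reflects-¬ (ofⁿ ¬p) = ofʸ ¬p

-- Unlike a de Bruijn index, a level is unaffected by further binders, so it can name a fixed
-- pointer.
level : ∀ {m} → Fin m → ℕ
level {suc m} zero    = m
level {suc m} (suc i) = level i

level< : ∀ {m} (i : Fin m) → level i < m
level< {suc m} zero    = ≤-refl
level< {suc m} (suc i) = m<n⇒m<1+n (level< i)

variables : ∀ {Q NT m} → Formula Q NT m → ℕ
variables {m = m} (letter f x)  = m
variables {m = m} (x ≼ y)       = m
variables {m = m} (rel t x y)   = m
variables (¬′ φ)        = variables φ
variables (φ ∧′ ψ)      = variables φ ⊔ variables ψ
variables (φ ∨′ ψ)      = variables φ ⊔ variables ψ
variables (φ ⇒′ ψ)      = variables φ ⊔ variables ψ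
variables (∃′ φ)        = variables φ
variables (∀′ φ)        = variables φ

m≤variables : ∀ {Q NT m} (φ : Formula Q NT m) → m ≤ variables φ
m≤variables (letter f x) = ≤-refl
m≤variables (x ≼ y)      = ≤-refl
m≤variables (rel t x y)  = ≤-refl
m≤variables (¬′ φ)       = m≤variables φ
m≤variables (φ ∧′ ψ)     = ≤-trans (m≤variables φ) (m≤m⊔n _ _)
m≤variables (φ ∨′ ψ)     = ≤-trans (m≤variables φ) (m≤m⊔n _ _)
m≤variables (φ ⇒′ ψ)     = ≤-trans (m≤variables φ) (m≤m⊔n _ _)
m≤variables (∃′ φ)       = ≤-trans (n≤1+n _) (m≤variables φ)
m≤variables (∀′ φ)       = ≤-trans (n≤1+n _) (m≤variables φ)

variablesᴾ : ∀ {Q NT l} → Program Q NT l → ℕ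
variablesᴾ (t ≔ φ)  = variables φ
variablesᴾ (P ⨾ P′) = variablesᴾ P ⊔ variablesᴾ P′
variablesᴾ (loop P) = variablesᴾ P

annotate : {Σ Q : Set} → (Q → Σ → Q) → Q → List Σ → List Q
annotate δ q []      = []
annotate δ q (s ∷ w) = δ q s ∷ annotate δ (δ q s) w

annotate-length : {Σ Q : Set} (δ : Q → Σ → Q) → ∀ q w → length (annotate δ q w) ≡ length w
annotate-length δ q []      = refl
annotate-length δ q (s ∷ w) = cong suc (annotate-length δ (δ q s) w)

iterate-suc : ∀ {A : Set} (f : A → A) x k → iterate f x (suc k) ≡ f (iterate f x k)
iterate-suc f x zero    = refl
iterate-suc f x (suc k) = iterate-suc f (f x) k

-- The pointers below L serve the loops, the pointer L + ℓ serves the variables bound at depth ℓ.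
module Compilation {Σ Q : Set} (finite-Σ : Finite Σ) (finite-Q : Finite Q) (D NT L : ℕ) where

  open Machine finite-Σ finite-Q (suc D) (suc NT)
  open Primitives finite-Σ finite-Q (suc D) (suc NT)
  open Compile finite-Σ finite-Q D NT

  ptrOf : ℕ → Fin (suc D)
  ptrOf ℓ = clamp (L + ℓ)

  isLetter : (Q → Bool) → Γ → Bool
  isLetter f (ltr q) = f q
  isLetter f _       = false

  -- Once a witness has been found, the body is skipped in the remaining rounds, which preserves the
  -- flag.
  existsᶜ : Fin (suc D) → Code → Code
  existsᶜ x c = setF (λ _ → false) ∙ for x (ite flag skip c)

  existsᵖ : Polynomial → Polynomial
  existsᵖ p = con 1 :+ forᵖ (con 1 :+ (con 1 :+ p))

  not-flag : Code
  not-flag = setF (not ∘ flag)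

  compile : ∀ {m} → Formula Q NT m → Code
  compile (letter f x)   = setF λ hs → isLetter f (hs at ptr (ptrOf (level x)))
  compile (x ≼ y)        = compareP (ptrOf (level x)) (ptrOf (level y))
  compile (rel t x y)    = load (suc t) (ptrOf (level x)) (ptrOf (level y))
  compile (¬′ φ)         = compile φ ∙ not-flag
  compile (φ ∧′ ψ)       = compile φ ∙ ite flag (compile ψ) skip
  compile (φ ∨′ ψ)       = compile φ ∙ ite flag skip (compile ψ)
  compile (φ ⇒′ ψ)       = compile φ ∙ ite flag (compile ψ) not-flag
  compile {m} (∃′ φ)     = existsᶜ (ptrOf m) (compile φ)
  compile {m} (∀′ φ)     = existsᶜ (ptrOf m) (compile φ ∙ not-flag) ∙ not-flag

  time : ∀ {m} → Formula Q NT m → Polynomial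
  time (letter f x) = con 1
  time (x ≼ y)      = compareᵖ
  time (rel t x y)  = accessᵖ
  time (¬′ φ)       = time φ :+ con 1
  time (φ ∧′ ψ)     = time φ :+ (con 1 :+ (time ψ :+ con 1))
  time (φ ∨′ ψ)     = time φ :+ (con 1 :+ (con 1 :+ time ψ))
  time (φ ⇒′ ψ)     = time φ :+ (con 1 :+ (time ψ :+ con 1))
  time (∃′ φ)       = existsᵖ (time φ)
  time (∀′ φ)       = existsᵖ (time φ :+ con 1) :+ con 1

  compileᴾ : ∀ {l} → Program Q NT l → Code
  compileᴾ (t ≔ φ)      = for (ptrOf 0) (for (ptrOf 1) (compile φ ∙ save zero (ptrOf 0) (ptrOf 1)))
                        ∙ for (ptrOf 0) (for (ptrOf 1) (load zero (ptrOf 0) (ptrOf 1) ∙ save (suc t) (ptrOf 0) (ptrOf 1)))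
  compileᴾ (P ⨾ P′)     = compileᴾ P ∙ compileᴾ P′
  compileᴾ (loop {l} P) = for (clamp l) (compileᴾ P)

  timeᴾ : ∀ {l} → Program Q NT l → Polynomial
  timeᴾ (t ≔ φ)  = forᵖ (forᵖ (time φ :+ accessᵖ)) :+ forᵖ (forᵖ (accessᵖ :+ accessᵖ))
  timeᴾ (P ⨾ P′) = timeᴾ P :+ timeᴾ P′
  timeᴾ (loop P) = forᵖ (timeᴾ P)

  module _ (v : List Q) where

    open Semantics {Q} {NT} v hiding (Tables)

    assign : ∀ {m} → (Fin (suc D) → ℕ) → Vec ℕ m → Fin (suc D) → ℕ
    assign π []              = π
    assign π (_∷_ {m} a ρ)   = assign π ρ [ ptrOf m ↦ a ]

    clamp-injective : ∀ {i j} → i ≤ D → j ≤ D → clamp {D} i ≡ clamp j → i ≡ j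
    clamp-injective i≤ j≤ e = trans (sym (toℕ-clamp i≤)) (trans (cong toℕ e) (toℕ-clamp j≤))

    assign-level : ∀ {m π} (ρ : Vec ℕ m) i → L + m ≤ suc D → assign π ρ (ptrOf (level i)) ≡ Vec.lookup ρ i
    assign-level {suc m} {π} (a ∷ ρ) zero    _  = ↦-same (assign π ρ) (ptrOf m) a
    assign-level {suc m} {π} (a ∷ ρ) (suc i) ≤D = trans
      (↦-other (assign π ρ) a λ e → <⇒≢ (level< i) (+-cancelˡ-≡ L (level i) m
        (clamp-injective (≤-trans (+-monoʳ-≤ L (<⇒≤ (level< i))) L+m≤) L+m≤ e)))
      (assign-level ρ i (m≤n⇒m≤1+n L+m≤))
      where
      L+m≤ : L + m ≤ D
      L+m≤ = s≤s⁻¹ (subst (_≤ suc D) (+-suc L m) ≤D)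

    -- The pointers reserved for variables rest at 0, where a search over all positions has to
    -- start.
    Free : (Fin (suc D) → ℕ) → Set
    Free π = ∀ j → L ≤ toℕ j → π j ≡ 0

    assign-fresh : ∀ {m π} (ρ : Vec ℕ m) ℓ → Free π → m ≤ ℓ → L + ℓ ≤ D → assign π ρ (ptrOf ℓ) ≡ 0
    assign-fresh [] ℓ free _ ≤D = free (ptrOf ℓ) (subst (L ≤_) (sym (toℕ-clamp ≤D)) (m≤m+n L ℓ))
    assign-fresh {suc m} {π} (a ∷ ρ) ℓ free m<ℓ ≤D = trans
      (↦-other (assign π ρ) a λ e → <⇒≢ m<ℓ (sym (+-cancelˡ-≡ L ℓ m
        (clamp-injective ≤D (≤-trans (+-monoʳ-≤ L (<⇒≤ m<ℓ)) ≤D) e))))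
      (assign-fresh ρ ℓ free (<⇒≤ m<ℓ) ≤D)

    Decides : (Fin (suc D) → ℕ) → Tables⁺ v → Code → Polynomial → Set → Set
    Decides π σ c p P = Hoare v π (λ σ′ _ → σ′ ≡ σ) c (eval p (length v)) (λ σ′ b → σ′ ≡ σ × Reflects P b)

    Decides-map : ∀ {π σ c P P′} p → (P → P′) → (P′ → P) → Decides π σ c p P → Decides π σ c p P′
    Decides-map p f g = Hoare-map v id λ { (e , h) → e , reflects-map f g h }

    set-flag : ∀ {π J J′ f} (g : Bool → Bool) → (∀ hs → f hs ≡ g (flag hs)) → (∀ {σ b} → J σ b → J′ σ (g b)) → Hoare v
      π J (setF f) 1 J′
    set-flag g f≡ step = hoare λ j a → let (_ , r , a′) = Good-setF v (g _) (trans (f≡ _) (cong g (flag-heads v a))) a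
                                             in result r a′ (step j)

    Decides-¬ : ∀ {π σ c P} p → Decides π σ c p P → Decides π σ (c ∙ not-flag) (p :+ con 1) (¬ P)
    Decides-¬ p d = Hoare-∙ v d (set-flag not (λ _ → refl) λ { (e , h) → e , reflects-¬ h })

    module _ {σ : Tables⁺ v} {P : ℕ → Set} where

      Found : ℕ → Tables⁺ v → Bool → Set
      Found i σ′ b = σ′ ≡ σ × Reflects (∃ λ a → a < i × P a) b

      Found-true : ∀ {i σ′ b} → Found i σ′ b × b ≡ true → Found (suc i) σ′ b
      Found-true ((e , ofʸ (a , a< , h)) , _) = e , ofʸ (a , m<n⇒m<1+n a< , h)

      Found-suc : ∀ {i b} → ¬ (∃ λ a → a < i × P a) → Reflects (P i) b → Reflects (∃ λ a → a < suc i × P a) b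
      Found-suc {i} none = reflects-map (λ p → i , ≤-refl , p) λ (a , a< , p) → only a p (m≤n⇒m<n∨m≡n (s≤s⁻¹ a<))
        where
        only : ∀ a → P a → a < i ⊎ a ≡ i → P i
        only a p (inj₁ a<i)  = contradiction (a , a<i , p) none
        only a p (inj₂ refl) = p

      Found-false : ∀ {π c t i} → Hoare v π (λ σ′ _ → σ′ ≡ σ) c t (λ σ′ b → σ′ ≡ σ × Reflects (P i) b) →
                    Hoare v π (λ σ′ b → Found i σ′ b × b ≡ false) c t (Found (suc i))
      Found-false d = hoare λ { ((e , ofⁿ none) , _) a → Result-map v (λ (e′ , h) → e′ , Found-suc none h) (execute d e a) }

      Decides-∃ : ∀ {π x c} p → π x ≡ 0 → (∀ a → a < N → Decides (π [ x ↦ a ]) σ c p (P a)) →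
                  Decides π σ (existsᶜ x c) (existsᵖ p) (∃ λ a → a < N × P a)
      Decides-∃ {π} {x} {c} p π0 d = Hoare-∙ v {J′ = Found 0}
        (set-flag (λ _ → false) (λ _ → refl) λ e → e , ofⁿ λ { (_ , () , _) })
        (Hoare-for v (con 1 :+ (con 1 :+ p)) Found π0 λ i i<N → Hoare-ite v (Found i) 1 (eval p (length v))
          (Hoare-map v Found-true id (Hoare-skip v)) (Found-false (d i i<N)))

    Decides-branch : ∀ {π σ c d e p P R t u} → Decides π σ c p P →
      (P → Hoare v π (λ σ′ b → σ′ ≡ σ × b ≡ true) d t (λ σ′ b → σ′ ≡ σ × Reflects R b)) →
      (¬ P → Hoare v π (λ σ′ b → σ′ ≡ σ × b ≡ false) e u (λ σ′ b → σ′ ≡ σ × Reflects R b)) →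
      Hoare v π (λ σ′ _ → σ′ ≡ σ) (c ∙ ite flag d e) (eval p (length v) + (1 + (t + u))) (λ σ′ b → σ′ ≡ σ × Reflects R b)
    Decides-branch {P = P} {t = t} {u} dec f g = Hoare-∙ v dec (Hoare-ite v _ t u
      (hoare λ { ((e , ofʸ p) , eq) a → execute (f p) (e , eq) a })
      (hoare λ { ((e , ofⁿ ¬p) , eq) a → execute (g ¬p) (e , eq) a }))

    isLetter-word : ∀ f a → isLetter f (word v a) ≡ maybe f false (letterAt a)
    isLetter-word f zero    = refl
    isLetter-word f (suc a) = letters v a
      where
      letters : ∀ v a → isLetter f (nth blank (map (λ q → ltr q) v) a) ≡ maybe f false (nth nothing (map just v) a)
      letters []      a       = refl
      letters (q ∷ v) zero    = refl
      letters (q ∷ v) (suc a) = letters v a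

    compile-decides : ∀ {m} (φ : Formula Q NT m) {π σ ρ} → Free π → L + variables φ ≤ suc D → Vecᵃ.All (_< N) ρ →
      Decides (assign π ρ) σ (compile φ) (time φ) (⟦ φ ⟧ᶠ (σ ∘ suc) ρ)
    compile-decides (letter f x) {π} {σ} {ρ} free ≤D r = hoare λ { {s = s} refl a →
      let (_ , r′ , a′) = Good-setF v _ (value a) a in result r′ a′ (refl , reflects-T _) }
      where
      value : ∀ {σ b s} → Good v (assign π ρ) σ b s →
              isLetter f (heads s at ptr (ptrOf (level x))) ≡ maybe f false (letterAt (Vec.lookup ρ x))
      value {s = s} a = trans (cong (isLetter f) (trans (heads-at s _) (trans (Good.wordP a _ _)
        (cong (word v) (trans (Good.position a _) (assign-level ρ x ≤D)))))) (isLetter-word f (Vec.lookup ρ x))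
    compile-decides (x ≼ y) {π} {σ} {ρ} free ≤D r = hoare λ { refl a →
      let (_ , r′ , a′) = Good-compare v (ptrOf (level x)) (ptrOf (level y))
            (subst (_< N) (sym (assign-level ρ x ≤D)) (lookup⁺ r x)) a
      in result r′ a′ (refl , subst₂ (λ i j → Reflects (i ≤ j)
        (does (assign π ρ (ptrOf (level x)) ≤? assign π ρ (ptrOf (level y)))))
           (assign-level ρ x ≤D) (assign-level ρ y ≤D) (proof (assign π ρ (ptrOf (level x)) ≤? assign π ρ (ptrOf (level y))))) }
    compile-decides (rel t x y) {π} {σ} {ρ} free ≤D r = hoare λ { refl a →
      let (_ , r′ , a′) = Good-load v (suc t) (ptrOf (level x)) (ptrOf (level y))
            (subst (_< N) (sym (assign-level ρ x ≤D)) (lookup⁺ r x))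
                            (subst (_< N) (sym (assign-level ρ y ≤D)) (lookup⁺ r y)) a
      in result r′ a′ (refl , subst₂ (λ i j → Reflects (T (σ (suc t) i j))
        (σ (suc t) (assign π ρ (ptrOf (level x))) (assign π ρ (ptrOf (level y)))))
           (assign-level ρ x ≤D) (assign-level ρ y ≤D) (reflects-T _)) }
    compile-decides (¬′ φ) free ≤D r = Decides-¬ (time φ) (compile-decides φ free ≤D r)
    compile-decides (φ ∧′ ψ) free ≤D r = Decides-branch {p = time φ}
      (compile-decides φ free (≤-trans (+-monoʳ-≤ L (m≤m⊔n _ _)) ≤D) r)
      (λ p → Hoare-map v proj₁ (λ (e , h) → e , reflects-map (p ,_) proj₂ h)
               (compile-decides ψ free (≤-trans (+-monoʳ-≤ L (m≤n⊔m (variables φ) _)) ≤D) r))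
      (λ ¬p → Hoare-map v id (λ { (e , refl) → e , ofⁿ (¬p ∘ proj₁) }) (Hoare-skip v))
    compile-decides (φ ∨′ ψ) free ≤D r = Decides-branch {p = time φ}
      (compile-decides φ free (≤-trans (+-monoʳ-≤ L (m≤m⊔n _ _)) ≤D) r)
      (λ p → Hoare-map v id (λ { (e , refl) → e , ofʸ (inj₁ p) }) (Hoare-skip v))
      (λ ¬p → Hoare-map v proj₁ (λ (e , h) → e , reflects-map inj₂ (λ { (inj₁ p) → contradiction p ¬p ; (inj₂ q) → q }) h)
               (compile-decides ψ free (≤-trans (+-monoʳ-≤ L (m≤n⊔m (variables φ) _)) ≤D) r))
    compile-decides (φ ⇒′ ψ) free ≤D r = Decides-branch {p = time φ}
      (compile-decides φ free (≤-trans (+-monoʳ-≤ L (m≤m⊔n _ _)) ≤D) r)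
      (λ p → Hoare-map v proj₁ (λ (e , h) → e , reflects-map (λ q _ → q) (λ f → f p) h)
               (compile-decides ψ free (≤-trans (+-monoʳ-≤ L (m≤n⊔m (variables φ) _)) ≤D) r))
      (λ ¬p → set-flag not (λ _ → refl) λ { (e , refl) → e , ofʸ λ p → contradiction p ¬p })
    compile-decides (∃′ φ) {ρ = ρ} free ≤D r = Decides-∃ (time φ)
      (assign-fresh ρ _ free ≤-refl (s≤s⁻¹ (≤-trans (≤-reflexive (sym (+-suc L _))) (≤-trans (+-monoʳ-≤ L (m≤variables φ)) ≤D))))
      λ a a< → compile-decides φ {ρ = a ∷ ρ} free ≤D (a< ∷ r)
    compile-decides (∀′ φ) {σ = σ} {ρ} free ≤D r = Decides-map (existsᵖ (time φ :+ con 1) :+ con 1)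
      -- A universal formula is compiled as a failed search for a counterexample; decidability of
      -- formulas removes the double negation.
      (λ none a a< → decidable-stable (decide φ (σ ∘ suc) (a ∷ ρ)) λ ¬p → none (a , a< , ¬p))
      (λ all (a , a< , ¬p) → ¬p (all a a<))
      (Decides-¬ (existsᵖ (time φ :+ con 1)) (Decides-∃ (time φ :+ con 1)
        (assign-fresh ρ _ free ≤-refl (s≤s⁻¹ (≤-trans (≤-reflexive (sym (+-suc L _)))
          (≤-trans (+-monoʳ-≤ L (m≤variables φ)) ≤D))))
        λ a a< → Decides-¬ (time φ) (compile-decides φ {ρ = a ∷ ρ} free ≤D (a< ∷ r))))

-- Compiling assignments and loops

module Programs {Σ Q : Set} (finite-Σ : Finite Σ) (finite-Q : Finite Q) (D NT L : ℕ) where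

  open Machine finite-Σ finite-Q (suc D) (suc NT)
  open Primitives finite-Σ finite-Q (suc D) (suc NT)
  open Compile finite-Σ finite-Q D NT
  open Compilation finite-Σ finite-Q D NT L

  module _ (v : List Q) where

    open Semantics {Q} {NT} v

    write : Tables⁺ v → Fin (suc NT) → ℕ → ℕ → Bool → Tables⁺ v
    write σ t x y b = σ [ t ↦ upd (σ t) x (upd (σ t x) y b) ]

    Updated-write : ∀ σ t x y b → Updated v σ t x y b (write σ t x y b)
    Updated-write σ t x y b = record { updated = at-xy ; unchanged = elsewhere }
      where
      at-xy : write σ t x y b t x y ≡ b
      at-xy = trans (cong (λ A → A x y) (↦-same σ t _)) (trans (cong (λ f → f y) (upd-same (σ t) x _)) (upd-same (σ t x) y b))
      elsewhere : ∀ t′ x′ y′ → ¬ (t′ ≡ t × x′ ≡ x × y′ ≡ y) → write σ t x y b t′ x′ y′ ≡ σ t′ x′ y′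
      elsewhere t′ x′ y′ ≢txy with t′ Fin.≟ t
      ... | no _     = refl
      ... | yes refl with x′ ≟ x
      ...   | no _     = refl
      ...   | yes refl = upd-other (σ t x) b λ { refl → ≢txy (refl , refl , refl) }

    module Assignment {π : Fin (suc D) → ℕ} (free : Free v π) (t : Fin NT) (φ : Formula Q NT 2)
                      (≤D : L + variables φ ≤ suc D) (τ : Tables) where

      x y : Fin (suc D)
      x = ptrOf 0
      y = ptrOf 1

      value : ℕ → ℕ → Bool
      value i j = does (decide φ τ (j ∷ i ∷ []))

      L+2≤ : L + 2 ≤ suc D
      L+2≤ = ≤-trans (+-monoʳ-≤ L (m≤variables φ)) ≤D

      L+1≤ : L + 1 ≤ D
      L+1≤ = s≤s⁻¹ (subst (_≤ suc D) (+-suc L 1) L+2≤)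

      x-zero : π x ≡ 0
      x-zero = assign-fresh v [] 0 free z≤n (≤-trans (+-monoʳ-≤ L z≤n) L+1≤)

      y-zero : ∀ i → (π [ x ↦ i ]) y ≡ 0
      y-zero i = assign-fresh v (i ∷ []) 1 free ≤-refl L+1≤

      at-x : ∀ i j → (π [ x ↦ i ] [ y ↦ j ]) x ≡ i
      at-x i j = assign-level v {π = π} (j ∷ i ∷ []) (suc zero) L+2≤

      at-y : ∀ i j → (π [ x ↦ i ] [ y ↦ j ]) y ≡ j
      at-y i j = assign-level v {π = π} (j ∷ i ∷ []) zero L+2≤

      in-range : ∀ {z k} → z ≡ k → k < N → z < N
      in-range refl k< = k<

      Rows : ℕ → Table → Set
      Rows i A = ∀ a b → a < i → b < N → A a b ≡ value a b

      Cells : ℕ → ℕ → Table → Set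
      Cells i j A = Rows i A × (∀ b → b < j → A i b ≡ value i b)

      Rows-suc : ∀ {i A} → Cells i N A → Rows (suc i) A
      Rows-suc (rows , row) a b a< b< with m≤n⇒m<n∨m≡n (s≤s⁻¹ a<)
      ... | inj₁ a<i  = rows a b a<i b<
      ... | inj₂ refl = row b b<

      Cells-suc : ∀ {i j A A′} → A′ i j ≡ value i j → (∀ a b → ¬ (a ≡ i × b ≡ j) → A′ a b ≡ A a b) → Cells i j A →
        Cells i (suc j) A′
      Cells-suc {i} {j} at-ij other (rows , row) = (λ a b a< b< → trans
        (other a b λ { (refl , _) → <-irrefl refl a< }) (rows a b a< b<)) , go
        where
        go : ∀ b → b < suc j → _
        go b b< with m≤n⇒m<n∨m≡n (s≤s⁻¹ b<)
        ... | inj₁ b<j  = trans (other i b λ { (_ , refl) → <-irrefl refl b<j }) (row b b<j)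
        ... | inj₂ refl = at-ij

      stored : ∀ {i j t′ b σ σ′} → Updated v σ t′ ((π [ x ↦ i ] [ y ↦ j ]) x) ((π [ x ↦ i ] [ y ↦ j ]) y) b σ′ → b ≡ value i j →
               Cells i j (σ t′) → Cells i (suc j) (σ′ t′)
      stored {i} {j} {t′} {b} {σ} {σ′} up b≡ = Cells-suc
        (trans (subst₂ (λ k l → σ′ t′ k l ≡ b) (at-x i j) (at-y i j) (Updated.updated up)) b≡)
        (λ a c ≢ij → Updated.unchanged up t′ a c λ { (_ , e , e′) → ≢ij (trans e (at-x i j) , trans e′ (at-y i j)) })

      -- The values are first collected in the spare table 0, since φ may mention t.
      Collecting : ℕ → Tables⁺ v → Bool → Set
      Collecting i σ _ = (σ ∘ suc) ≋ τ × Rows i (σ zero)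

      CollectingRow : ℕ → ℕ → Tables⁺ v → Bool → Set
      CollectingRow i j σ _ = (σ ∘ suc) ≋ τ × Cells i j (σ zero)

      collect : Hoare v π (Collecting 0) (for x (for y (compile φ ∙ save zero x y)))
        (eval (forᵖ (forᵖ (time φ :+ accessᵖ))) (length v)) (Collecting N)
      collect = Hoare-for v (forᵖ (time φ :+ accessᵖ)) Collecting x-zero λ i i<N →
        Hoare-map v (λ (same , rows) → same , rows , λ _ ()) (λ (same , cells) → same , Rows-suc cells)
          (Hoare-for v (time φ :+ accessᵖ) (CollectingRow i) (y-zero i) λ j j<N → hoare λ {σ} → collect-cell i<N j<N)
        where
        collect-cell : ∀ {i j σ b s} → i < N → j < N → CollectingRow i j σ b → Good v (π [ x ↦ i ] [ y ↦ j ]) σ b s →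
          Result v (π [ x ↦ i ] [ y ↦ j ]) (CollectingRow i (suc j)) (compile φ ∙ save zero x y) s
            (eval (time φ :+ accessᵖ) (length v))
        collect-cell {i} {j} {σ} i<N j<N (same , cells) g = Result-∙ v
          (execute (compile-decides v φ {σ = σ} {ρ = j ∷ i ∷ []} free ≤D (j<N ∷ i<N ∷ [])) refl g)
          (hoare λ { {b = b} (refl , h) g′ →
            let up = Updated-write σ zero ((π [ x ↦ i ] [ y ↦ j ]) x) ((π [ x ↦ i ] [ y ↦ j ]) y) b
                (_ , r , g″) = Good-save v zero x y (in-range (at-x i j) i<N) (in-range (at-y i j) j<N) up g′
            in result r g″ (same , stored up (agree h) cells) })
          where
          agree : ∀ {b} → Reflects (⟦ φ ⟧ᶠ (σ ∘ suc) (j ∷ i ∷ [])) b → b ≡ value i j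
          agree h = trans (Reflects.det h (proof (decide φ (σ ∘ suc) (j ∷ i ∷ [])))) (decide-cong φ (j<N ∷ i<N ∷ []) same)

      Copying : ℕ → Tables⁺ v → Bool → Set
      Copying i σ _ = Rows N (σ zero) × (∀ t′ a b → t′ ≢ t → a < N → b < N → σ (suc t′) a b ≡ τ t′ a b) × Rows i (σ (suc t))

      CopyingRow : ℕ → ℕ → Tables⁺ v → Bool → Set
      CopyingRow i j σ _ = Rows N (σ zero) × (∀ t′ a b → t′ ≢ t → a < N → b < N → σ (suc t′) a b ≡ τ t′ a b) × Cells i
        j (σ (suc t))

      copy : Hoare v π (Copying 0) (for x (for y (load zero x y ∙ save (suc t) x y)))
        (eval (forᵖ (forᵖ (accessᵖ :+ accessᵖ))) (length v)) (Copying N)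
      copy = Hoare-for v (forᵖ (accessᵖ :+ accessᵖ)) Copying x-zero λ i i<N →
        Hoare-map v (λ (full , same , rows) → full , same , rows , λ _ ())
          (λ (full , same , cells) → full , same , Rows-suc cells)
          (Hoare-for v (accessᵖ :+ accessᵖ) (CopyingRow i) (y-zero i) λ j j<N → hoare λ {σ} → copy-cell i<N j<N)
        where
        copy-cell : ∀ {i j σ b s} → i < N → j < N → CopyingRow i j σ b → Good v (π [ x ↦ i ] [ y ↦ j ]) σ b s →
          Result v (π [ x ↦ i ] [ y ↦ j ]) (CopyingRow i (suc j)) (load zero x y ∙ save (suc t) x y) s
            (eval (accessᵖ :+ accessᵖ) (length v))
        copy-cell {i} {j} {σ} i<N j<N (full , same , cells) g =
          let (_ , r , g′)  = Good-load v zero x y (in-range (at-x i j) i<N) (in-range (at-y i j) j<N) g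
              (_ , r′ , g″) = Good-save v (suc t) x y (in-range (at-x i j) i<N) (in-range (at-y i j) j<N) up g′
          in result (Runs-∙ r r′) g″
             ((λ a b a< b< → trans (unchanged up zero a b λ { (() , _) }) (full a b a< b<)) ,
              (λ t′ a b t′≢t a< b< → trans (unchanged up (suc t′) a b λ { (e , _) → t′≢t (Finₚ.suc-injective e) })
                (same t′ a b t′≢t a< b<)) ,
              stored up (trans (cong₂ (σ zero) (at-x i j) (at-y i j)) (full i j i<N j<N)) cells)
          where
          open Updated
          up = Updated-write σ (suc t) ((π [ x ↦ i ] [ y ↦ j ]) x) ((π [ x ↦ i ] [ y ↦ j ]) y)
            (σ zero ((π [ x ↦ i ] [ y ↦ j ]) x) ((π [ x ↦ i ] [ y ↦ j ]) y))

      assignment : Hoare v π (λ σ _ → (σ ∘ suc) ≋ τ) (compileᴾ {0} (t ≔ φ)) (eval (timeᴾ {0} (t ≔ φ)) (length v))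
        (λ σ _ → (σ ∘ suc) ≋ run {l = 0} (t ≔ φ) τ)
      assignment = Hoare-∙ v (Hoare-map v (λ same → same , λ _ _ ()) id collect)
        (Hoare-map v (λ (same , full) → full , (λ t′ a b _ a< b< → same t′ a b a< b<) , λ _ _ ())
          (λ {σ} (_ , same , full) → assigned {σ} same full) copy)
        where
        assigned : ∀ {σ : Tables⁺ v} → (∀ t′ a b → t′ ≢ t → a < N → b < N → σ (suc t′) a b ≡ τ t′ a b) → Rows N (σ (suc t)) →
                 (σ ∘ suc) ≋ run {l = 0} (t ≔ φ) τ
        assigned same full t′ a b a< b< with t′ Fin.≟ t
        ... | yes refl = full a b a< b<
        ... | no t′≢t  = same t′ a b t′≢t a< b<

    -- The counters of the enclosing loops are pointers from `l` up to `L`. The pointers below `l`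
    -- are left to inner loops and those from `L` on to variables, and all of these start at 0.
    program : ∀ {l} (P : Program Q NT l) {π} → Free v π → (∀ j → toℕ j < l → π j ≡ 0) → l ≤ L → L + variablesᴾ P ≤ suc D → ∀ τ →
      Hoare v π (λ σ _ → (σ ∘ suc) ≋ τ) (compileᴾ P) (eval (timeᴾ P) (length v)) (λ σ _ → (σ ∘ suc) ≋ run P τ)
    program (t ≔ φ) free zeros l≤L ≤D τ = Assignment.assignment free t φ ≤D τ
    program (P ⨾ P′) free zeros l≤L ≤D τ = Hoare-∙ v
      (program P free zeros l≤L (≤-trans (+-monoʳ-≤ L (m≤m⊔n _ _)) ≤D) τ)
      (program P′ free zeros l≤L (≤-trans (+-monoʳ-≤ L (m≤n⊔m (variablesᴾ P) _)) ≤D) (run P τ))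
    program (loop {l} P) {π} free zeros l<L ≤D τ =
      Hoare-for v (timeᴾ P) (λ i σ _ → (σ ∘ suc) ≋ iterate (run P) τ i)
        (zeros (clamp l) (subst (_< suc l) (sym (toℕ-clamp l≤D)) ≤-refl))
        λ i i<N → Hoare-map v id (λ {σ} → subst ((σ ∘ suc) ≋_) (sym (iterate-suc (run P) τ i)))
          (program P (λ k L≤k → trans (↦-other π i λ e → <⇒≱ l<L
            (≤-trans L≤k (≤-reflexive (trans (cong toℕ e) (toℕ-clamp l≤D))))) (free k L≤k))
                     (λ k k<l → trans (↦-other π i λ e → <⇒≢ k<l (trans (cong toℕ e) (toℕ-clamp l≤D))) (zeros k (m<n⇒m<1+n k<l)))
                     (<⇒≤ l<L) ≤D (iterate (run P) τ i))
      where
      l≤D : l ≤ D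
      l≤D = s≤s⁻¹ (≤-trans (≤-trans l<L (m≤m+n L _)) ≤D)

-- Annotating the input by a finite automaton

nth-++ : ∀ {A : Set} (d : A) xs y ys z j → nth d (xs ++ z ∷ ys) j ≡ upd (nth d (xs ++ y ∷ ys)) (length xs) z j
nth-++ d []       y ys z zero    = refl
nth-++ d []       y ys z (suc j) = refl
nth-++ d (x ∷ xs) y ys z zero    = refl
nth-++ d (x ∷ xs) y ys z (suc j) with j ≟ length xs | suc j ≟ suc (length xs) | nth-++ d xs y ys z j
... | yes _ | yes _   | e = e
... | no _  | no _    | e = e
... | yes p | no ¬p   | _ = contradiction (cong suc p) ¬p
... | no ¬p | yes p   | _ = contradiction (suc-injective p) ¬p

nth-default : ∀ {A : Set} (d : A) xs j → nth d (xs ++ d ∷ []) j ≡ nth d xs j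
nth-default d []       zero    = refl
nth-default d []       (suc j) = refl
nth-default d (x ∷ xs) zero    = refl
nth-default d (x ∷ xs) (suc j) = nth-default d xs j

∅ : ∀ {NT} → Fin NT → Table
∅ _ _ _ = false

module Preprocessing {Σ Q : Set} (finite-Σ : Finite Σ) (finite-Q : Finite Q) (δ : Q → Σ → Q) (q₀ : Q) (D NT : ℕ) where

  open Machine finite-Σ finite-Q (suc D) (suc NT)
  open Primitives finite-Σ finite-Q (suc D) (suc NT)
  open Compile finite-Σ finite-Q D NT

  transduce : Γ → Γ → Γ
  transduce (ltr q) (inp s) = ltr (δ q s)
  transduce g       _       = g

  -- The truth value tape is borrowed to hold the last annotated letter, from which the next one is
  -- computed; it starts with `q₀`.
  begin : Code
  begin = act λ where
    hs U       → mark , right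
    hs F       → ltr q₀ , stay
    hs (ptr x) → hs at ptr x , right
    hs i       → hs at i , stay

  advance : Code
  advance = act λ where
    hs U       → transduce (hs at F) (hs at U) , right
    hs F       → transduce (hs at F) (hs at U) , stay
    hs (ptr x) → transduce (hs at F) (hs at U) , right
    hs i       → hs at i , stay

  return : Id → Move
  return U       = left
  return (ptr _) = left
  return _       = stay

  prepare : Code
  prepare = begin ∙ while (notBlank U) advance ∙ while (notMark U) (move return)

  prepareᵖ : Polynomial
  prepareᵖ = con 1 :+ (con 1 :+ var :* con 2 :+ (con 1 :+ Nᵖ :* con 2))

  letters : List Q → List Γ
  letters = map (λ q → ltr q)

  -- After the symbols annotated by u, in state q, with the symbols w to come.
  halfway : List Q → Q → List Σ → Store
  halfway u q w = store
    (λ { U → suc (length u) ; (ptr _) → suc (length u) ; _ → 0 })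
    λ where
      U       → nth blank (mark ∷ letters u ++ map inp w)
      F       → nth blank (ltr q ∷ [])
      (ptr x) → nth blank (mark ∷ letters u)
      _       → nth blank (mark ∷ [])

  Runs-begin : ∀ w → Runs begin (starting w) 1 (halfway [] q₀ w)
  Runs-begin w = Runs-act record
    { moves  = λ { U → right ; S → stay ; F → stay ; (tab _) → stay ; (ptr _) → right }
    ; writes = λ where
        U zero          → refl
        U (suc j)       → refl
        F zero          → refl
        F (suc zero)    → refl
        F (suc (suc j)) → refl
        S j             → sym (upd-id (cell (starting w) S) (sym (heads-at (starting w) S)) j)
        (tab t) j       → sym (upd-id (cell (starting w) (tab t)) (sym (heads-at (starting w) (tab t))) j)
        (ptr x) j       → sym (upd-id (cell (starting w) (ptr x)) (sym (heads-at (starting w) (ptr x))) j) }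

  head-U : ∀ u q w → heads (halfway u q w) at U ≡ nth blank (map inp w) 0
  head-U u q w = trans (heads-at (halfway u q w) U) (at-end u)
    where
    at-end : ∀ u → nth blank (letters u ++ map inp w) (length u) ≡ nth blank (map inp w) 0
    at-end []      = refl
    at-end (q ∷ u) = at-end u

  Runs-advance : ∀ u q s w → Runs advance (halfway u q (s ∷ w)) 1 (halfway (u ∷ʳ δ q s) (δ q s) w)
  Runs-advance u q s w = Runs-≈ʳ (Runs-act {s′ = target} record
    { moves  = λ { U → right ; S → stay ; F → stay ; (tab _) → stay ; (ptr _) → right }
    ; writes = λ where
        U j → trans (nth-++ blank (mark ∷ letters u) (inp s) (map inp w) (ltr q′) j)
                (cong₂ (λ p g → upd (nth blank (mark ∷ letters u ++ inp s ∷ map inp w)) p g j)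
                  (cong suc (Listₚ.length-map _ u)) (sym new))
        S j → sym (upd-id (cell h S) (sym (heads-at h S)) j)
        F j → trans (at-F j) (cong (λ g → upd (nth blank (ltr q ∷ [])) 0 g j) (sym new))
        (tab t) j → sym (upd-id (cell h (tab t)) (sym (heads-at h (tab t))) j)
        (ptr x) j → trans (nth-++ blank (mark ∷ letters u) blank [] (ltr q′) j)
                (trans (upd-cong {f = nth blank (mark ∷ letters u ++ blank ∷ [])}
                  (nth-default blank (mark ∷ letters u)) (cong suc (Listₚ.length-map _ u)) j)
                       (cong (λ g → upd (nth blank (mark ∷ letters u)) (suc (length u)) g j) (sym new))) })
    (record { pos≈  = λ { U → longer ; S → refl ; F → refl ; (tab _) → refl ; (ptr _) → longer }
            ; cell≈ = λ { U j → cong (λ xs → nth blank (mark ∷ xs) j) regroup ; S _ → refl ; F _ → refl ; (tab _) _ → refl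
                        ; (ptr _) j → cong (λ xs → nth blank (mark ∷ xs) j) (sym (Listₚ.map-++ (λ q → ltr q) u (q′ ∷ []))) } })
    where
    h = halfway u q (s ∷ w)
    q′ = δ q s
    target : Store
    target = store (λ { U → suc (suc (length u)) ; (ptr _) → suc (suc (length u)) ; _ → 0 }) λ where
      U       → nth blank (mark ∷ letters u ++ ltr q′ ∷ map inp w)
      F       → nth blank (ltr q′ ∷ [])
      (ptr x) → nth blank (mark ∷ letters u ++ ltr q′ ∷ [])
      _       → nth blank (mark ∷ [])
    new : transduce (heads h at F) (heads h at U) ≡ ltr q′
    new = cong₂ transduce (heads-at h F) (head-U u q (s ∷ w))
    at-F : ∀ j → nth blank (ltr q′ ∷ []) j ≡ upd (nth blank (ltr q ∷ [])) 0 (ltr q′) j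
    at-F zero          = refl
    at-F (suc zero)    = refl
    at-F (suc (suc j)) = refl
    longer : suc (suc (length u)) ≡ suc (length (u ∷ʳ q′))
    longer = cong suc (sym (trans (Listₚ.length-++ u) (+-comm (length u) 1)))
    regroup : letters u ++ ltr q′ ∷ map inp w ≡ letters (u ∷ʳ q′) ++ map inp w
    regroup = sym (trans (cong (_++ map inp w) (Listₚ.map-++ (λ q → ltr q) u (q′ ∷ [])))
                         (Listₚ.++-assoc (letters u) (ltr q′ ∷ []) (map inp w)))

  Runs-annotate : ∀ u q w → ∃ λ q′ →
    Runs (while (notBlank U) advance) (halfway u q w) (1 + length w * 2) (halfway (u ++ annotate δ q w) q′ [])
  Runs-annotate u q [] = q , subst (λ u′ → Runs (while (notBlank U) advance) (halfway u q []) 1 (halfway u′ q []))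
    (sym (Listₚ.++-identityʳ u))
    (Runs-done (cong (not ∘ isBlank) (head-U u q [])))
  Runs-annotate u q (s ∷ w) with Runs-annotate (u ∷ʳ δ q s) (δ q s) w
  ... | q′ , r = q′ , Runs-loop (cong (not ∘ isBlank) (head-U u q (s ∷ w))) (Runs-advance u q s w)
    (subst (λ u′ → Runs (while (notBlank U) advance) (halfway (u ∷ʳ δ q s) (δ q s) w) (1 + length w * 2)
      (halfway u′ q′ [])) (Listₚ.++-assoc u (δ q s ∷ []) (annotate δ (δ q s) w)) r)

  prepared : ∀ w → ∃ λ s → Runs prepare (starting w) (eval prepareᵖ (length w)) s ×
             Good (annotate δ q₀ w) (λ _ → 0) ∅ false s
  prepared w with Runs-annotate [] q₀ w
  ... | q , r = store (λ _ → 0) (cell h) , Runs-∙ (Runs-begin w)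
    (Runs-∙ r (Runs-≤ (≤-reflexive (cong (λ k → 1 + suc k * 2) (annotate-length δ q₀ w)))
          (Runs-≈ʳ (Runs-drain {U} {return} {pos h} {cell h} marked-U refl λ
            { U _ → ≤-refl ; S () ; F () ; (tab _) () ; (ptr _) _ → ≤-refl })
                   (same-cells λ { U → n∸n≡0 (length v) ; S → refl ; F → refl ; (tab _) → refl ; (ptr _) → n∸n≡0
                     (length v) })))) ,
    record
      { position = λ { U → refl ; S → refl ; F → refl ; (tab _) → refl ; (ptr _) → refl }
      ; wordU    = word-U
      ; wordP    = λ x → word-nth
      ; markS    = λ { zero → refl ; (suc j) → refl }
      ; markT    = λ { t zero → refl ; t (suc j) → refl }
      -- The letter left behind on the truth value tape is not `one`, so it counts as false.
      ; truth    = refl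
      ; table    = λ t x y _ _ → blank-table (y + (x * suc (length v) + 1)) (≤-trans (m≤n+m 1 (x * suc (length v))) (m≤n+m _ y)) }
    where
    v = annotate δ q₀ w
    h = halfway v q []
    word-nth : ∀ j → nth blank (mark ∷ letters v) j ≡ word v j
    word-nth zero    = refl
    word-nth (suc j) = refl
    word-U : ∀ j → cell h U j ≡ word v j
    word-U j = trans (cong (λ xs → nth blank (mark ∷ xs) j) (Listₚ.++-identityʳ (letters v))) (word-nth j)
    marked-U : Marked (cell h U)
    marked-U j = trans (cong isMark (word-U j)) (word-marked v j)
    blank-table : ∀ k → 1 ≤ k → isOne (nth blank (mark ∷ []) k) ≡ false
    blank-table (suc k) _ = refl

-- The interface between machines and everything that follows. Program and sentence are fixed while
-- the word varies, so the nesting of loops and quantifiers is bounded and the running time is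
-- polynomial.
definable∈P : ∀ {ℓ} {Σ Q : Set} {NT l} → Finite Σ → Finite Q → (δ : Q → Σ → Q) (q₀ : Q)
  (P : Program Q NT l) (χ : Formula Q NT 0) {L : Pred (List Σ) ℓ} →
  (∀ w → Semantics.⟦_⟧ᶠ (annotate δ q₀ w) χ (Semantics.run (annotate δ q₀ w) P ∅) [] ⇔ L w) → InPTime L
definable∈P {Σ = Σ} {Q} {NT} {l} finite-Σ finite-Q δ q₀ P χ {L} correct = code∈P program′ (prepareᵖ :+ (timeᴾ P :+ time χ)) λ w →
  let (_ , r , g) = prepared w in decided w r g
  where
  -- Room for `l` loop counters and for the variables of the program and of the sentence, which can
  -- share pointers.
  D = l + (variablesᴾ P ⊔ variables χ)
  open Machine finite-Σ finite-Q (suc D) (suc NT)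
  open Compile finite-Σ finite-Q D NT
  open Compilation finite-Σ finite-Q D NT l
  open Programs finite-Σ finite-Q D NT l
  open Preprocessing finite-Σ finite-Q δ q₀ D NT
  program′ : Code
  program′ = prepare ∙ (compileᴾ P ∙ compile χ)
  decided : ∀ w {s} → Runs prepare (starting w) (eval prepareᵖ (length w)) s → Good (annotate δ q₀ w) (λ _ → 0) ∅ false s →
    ∃ λ s′ → Runs program′ (starting w) (eval (prepareᵖ :+ (timeᴾ P :+ time χ)) (length w)) s′ × Reflects (L w)
      (isOne (cell s′ F (pos s′ F)))
  decided w {s} r g = finish (execute (Hoare-∙ v
      (program v P {λ _ → 0} (λ _ _ → refl) (λ _ _ → refl) ≤-refl (m≤n⇒m≤1+n (+-monoʳ-≤ l (m≤m⊔n _ _))) ∅)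
      (hoare {J′ = λ _ b → Reflects (⟦ χ ⟧ᶠ (run P ∅) []) b} λ {σ} e g′ → Result-map v
        (λ { (_ , h) → reflects-map (⟦⟧-cong χ [] e) (⟦⟧-cong χ [] (≋-sym e)) h })
        (execute (compile-decides v χ {λ _ → 0} {σ} {[]} (λ _ _ → refl)
          (m≤n⇒m≤1+n (+-monoʳ-≤ l (m≤n⊔m (variablesᴾ P) _))) []) refl g′)))
      (λ _ _ _ _ _ → refl) g)
    where
    v = annotate δ q₀ w
    open Semantics {Q} {NT} v
    finish : Result v (λ _ → 0) (λ _ b → Reflects (⟦ χ ⟧ᶠ (run P ∅) []) b) (compileᴾ P ∙ compile χ) s
      (eval (timeᴾ P) (length v) + eval (time χ) (length v)) →
      ∃ λ s′ → Runs program′ (starting w) (eval (prepareᵖ :+ (timeᴾ P :+ time χ)) (length w)) s′ × Reflects (L w)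
        (isOne (cell s′ F (pos s′ F)))
    finish (result {final = s′} r′ g′ h) = s′ ,
      subst (λ n → Runs program′ (starting w) (eval prepareᵖ (length w) + (eval (timeᴾ P) n + eval (time χ) n)) s′)
        (annotate-length δ q₀ w) (Runs-∙ r r′) ,
      subst (Reflects (L w)) (sym (trans (cong (isOne ∘ cell s′ F) (Good.position g′ F)) (Good.truth g′)))
        (reflects-map (Equivalence.to (correct w)) (Equivalence.from (correct w)) h)

-- Raw examples and powerset interpretations

Name : Set
Name = List Bool

_≟ⁿ_ : DecidableEquality Name
_≟ⁿ_ = Listₚ.≡-dec Boolₚ._≟_

Raw : Set
Raw = ABox × AQ

assertions : Raw → List Assertion
assertions = toList ∘ proj₁

⟦⟧⊆Δ : ∀ I C {d} → ⟦ I ⟧ C d → Interpretation.Δ I d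
⟦⟧⊆Δ I ⊤ᶜ                 h           = h
⟦⟧⊆Δ I (atom A)           h           = Interpretation.concept⊆ I A h
⟦⟧⊆Δ I (C ⊓ D)            (h , _)     = ⟦⟧⊆Δ I C h
⟦⟧⊆Δ I (∃ᶜ (name r) C)    (e , h , _) = proj₁ (Interpretation.role⊆ I r h)
⟦⟧⊆Δ I (∃ᶜ (inverse r) C) (e , h , _) = proj₂ (Interpretation.role⊆ I r h)

data Witness : Set where
  successors : Role → Concept → N-I ⊎ Witness → Witness

-- An interpretation whose elements are subsets of the disjoint union of the 𝓘 j, such that a set
-- belongs to a concept iff all its members do. Only the sets X x and the sets of R-successors in C
-- of these are needed; the codes make them range over a small type.
module Powerset (L : DL) {Ix : Set} (𝓘 : Ix → Interpretation) (X : N-I → ∀ i → Pred (Interpretation.Element (𝓘 i)) 0ℓ) where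

  open Interpretation

  ⟪_⟫ : N-I ⊎ Witness → ∀ i → Pred (Element (𝓘 i)) 0ℓ
  ⟪ inj₁ x ⟫                       = X x
  ⟪ inj₂ (successors R C d) ⟫ i y = ⟦ 𝓘 i ⟧ C y × ∃ λ x → ⟪ d ⟫ i x × ⟦ 𝓘 i ⟧ᴿ R x y

  -- All members of the empty set satisfy every concept, even `⊥ᶜ`; hence sets must be nonempty when
  -- `⊥` is available. Without `⊥` the empty set is a harmless element.
  Proper : N-I ⊎ Witness → Set
  Proper d = (∀ {i x} → ⟪ d ⟫ i x → Δ (𝓘 i) x) × (T (admits-⊥ L) → ∃₂ λ i x → ⟪ d ⟫ i x)

  Forward Backward : N-R → N-I ⊎ Witness → N-I ⊎ Witness → Set
  Forward  r d d′ = ∀ {i x} → ⟪ d ⟫ i x → ∃ λ y → ⟪ d′ ⟫ i y × roleᴵ (𝓘 i) r x y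
  Backward r d d′ = ∀ {i y} → ⟪ d′ ⟫ i y → ∃ λ x → ⟪ d ⟫ i x × roleᴵ (𝓘 i) r x y

  powerset : Satisfiable Proper → Interpretation
  powerset inhabited = record
    { Other    = Witness
    ; Δ        = Proper
    ; nonempty = inhabited
    ; conceptᴵ = λ A d → Proper d × (∀ {i x} → ⟪ d ⟫ i x → conceptᴵ (𝓘 i) A x)
    ; roleᴵ    = λ r d d′ → (Proper d × Proper d′) × Forward r d d′ × (T (admits-inverse L) → Backward r d d′)
    ; concept⊆ = λ _ → proj₁
    ; role⊆    = λ _ → proj₁
    }

  module _ (inhabited : Satisfiable Proper) where

    𝒫 = powerset inhabited

    members : ∀ C {d} → IsConcept L C → ⟦ 𝒫 ⟧ C d → ∀ {i x} → ⟪ d ⟫ i x → ⟦ 𝓘 i ⟧ C x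
    members ⊤ᶜ       _         h       x∈ = proj₁ h x∈
    members (atom A) _         (_ , h) x∈ = h x∈
    members (C ⊓ D)  (p , q)   (h , k) x∈ = members C p h x∈ , members D q k x∈
    members (∃ᶜ (name r) C)    (_ , p)   (d′ , (_ , forward , _) , h) x∈ with forward x∈
    ... | y , y∈ , rxy = y , rxy , members C p h y∈
    members (∃ᶜ (inverse r) C) (inv , p) (d′ , (_ , _ , backward) , h) x∈ with backward inv x∈
    ... | y , y∈ , ryx = y , ryx , members C p h y∈

    member : ∀ C {d} → IsConcept L C → Proper d → (∀ {i x} → ⟪ d ⟫ i x → ⟦ 𝓘 i ⟧ C x) → ⟦ 𝒫 ⟧ C d
    member ⊤ᶜ       _       proper all = proper
    member ⊥ᶜ       ⊥∈L     (_ , nonvoid) all with nonvoid ⊥∈L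
    ... | i , x , x∈ = all x∈
    member (atom A) _       proper all = proper , all
    member (C ⊓ D)  (p , q) proper all = member C p proper (proj₁ ∘ all) , member D q proper (proj₂ ∘ all)
    member (∃ᶜ R C) {d} (r , p) proper all = d′ , related R r
      (λ x∈ → let (y , Rxy , y∈) = all x∈ in y , (y∈ , _ , x∈ , Rxy) , Rxy) (λ { (_ , x , x∈ , Rxy) → x , x∈ , Rxy })
                    , member C p proper′ proj₁
      where
      -- The set of all `R`-successors in `C` of members of `d`. One of the two conditions on roles
      -- then holds by construction, the other is the hypothesis on the members.
      d′ = inj₂ (successors R C d)
      proper′ : Proper d′
      proper′ = (λ (h , _) → ⟦⟧⊆Δ (𝓘 _) C h) , λ ⊥∈L → let (i , x , x∈) = proj₂ proper ⊥∈L ; (y , Rxy , y∈) = all x∈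
                                                             in i , y , y∈ , x , x∈ , Rxy
      related : ∀ R′ → IsRole L R′ → (∀ {i x} → ⟪ d ⟫ i x → ∃ λ y → ⟪ d′ ⟫ i y × ⟦ 𝓘 i ⟧ᴿ R′ x y) →
                (∀ {i y} → ⟪ d′ ⟫ i y → ∃ λ x → ⟪ d ⟫ i x × ⟦ 𝓘 i ⟧ᴿ R′ x y) → ⟦ 𝒫 ⟧ᴿ R′ d d′
      related (name r)    _   f g = (proper , proper′) , f , λ _ → g
      related (inverse r) inv f g = (proper′ , proper) , g , λ _ → f

    -- Both sides of an inclusion are tested member by member, and each member lives in a model of
    -- the ontology.
    powerset-model : ∀ {𝒪} → IsOntology L 𝒪 → (∀ i → ModelOfOntology (𝓘 i) 𝒪) → ModelOfOntology 𝒫 𝒪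
    powerset-model {[]}          []              sat = []
    powerset-model {(C ⊑ D) ∷ 𝒪} ((p , q) ∷ is) sat =
      (λ {d} h → member D q (⟦⟧⊆Δ 𝒫 C h) λ {i} x∈ → All.head (sat i) (members C p h x∈)) ∷
      powerset-model is (All.tail ∘ sat)

-- Simulations, derived facts and the criterion for fitting

data At {A : Set} : List A → ℕ → A → Set where
  here  : ∀ {x xs} → At (x ∷ xs) 0 x
  there : ∀ {x y xs k} → At xs k y → At (x ∷ xs) (suc k) y

At⇒∈ : ∀ {A : Set} {xs : List A} {k x} → At xs k x → x ∈ xs
At⇒∈ here      = here refl
At⇒∈ (there p) = there (At⇒∈ p)

∈⇒At : ∀ {A : Set} {xs : List A} {x} → x ∈ xs → ∃ λ k → At xs k x
∈⇒At (here refl) = 0 , here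
∈⇒At (there p)   = let (k , q) = ∈⇒At p in suc k , there q

At-unique : ∀ {A : Set} {xs : List A} {k x y} → At xs k x → At xs k y → x ≡ y
At-unique here      here      = refl
At-unique (there p) (there q) = At-unique p q

Entailedᴿ : Ontology → Raw → Set₁
Entailedᴿ 𝒪 (𝒜 , q) = 𝒜 ∪ 𝒪 ⊨ q

data _∈ₐ_ (x : N-I) : Assertion → Set where
  conc   : ∀ {A} → x ∈ₐ concept A x
  first  : ∀ {r b} → x ∈ₐ role r x b
  second : ∀ {r a} → x ∈ₐ role r a x

∈-individuals : ∀ {x α} → x ∈ individuals α → x ∈ₐ α
∈-individuals {α = concept A a} (here refl)         = conc
∈-individuals {α = role r a b}  (here refl)         = first
∈-individuals {α = role r a b}  (there (here refl)) = second

individuals-∈ : ∀ {x α} → x ∈ₐ α → x ∈ individuals α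
individuals-∈ conc   = here refl
individuals-∈ first  = here refl
individuals-∈ second = there (here refl)

-- true stands for the positive and false for the negative examples; the negative ones are numbered after the positive ones.
module Fitting (L : DL) (P N : List Raw) where

  Ex : Bool → ℕ → Raw → Set
  Ex true  k e = At P k e
  Ex false k e = ∃ λ j → k ≡ length P + j × At N j e

  Has : Bool → ℕ → Assertion → Set
  Has sg k α = ∃ λ e → Ex sg k e × α ∈ assertions e

  Query : Bool → ℕ → N-C → N-I → Set
  Query sg k Q a = ∃ λ 𝒜 → Ex sg k (𝒜 , aq Q a)

  Ind : Bool → ℕ → N-I → Set
  Ind sg k x = ∃ λ α → Has sg k α × x ∈ₐ α

  Negative : N-I → Set
  Negative b = ∃ λ k → Ind false k b

  -- The pair (x , b) may stay in a simulation contained in S, where the labels of b are given by F.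
  Local : (N-C → N-I → Set) → (N-I → N-I → Set) → N-I → N-I → Set
  Local F S x b =
      (∀ {k A} → Has true k (concept A x) → F A b)
    × (∀ {k r y} → Has true k (role r x y) → ∃₂ λ k′ c → Has false k′ (role r b c) × S y c)
    × (T (admits-inverse L) → ∀ {k r y} → Has true k (role r y x) → ∃₂ λ k′ c → Has false k′ (role r c b) × S y c)

  -- Approximations from above of the greatest simulation. Each is contained in its predecessor by
  -- definition, so they decrease.
  Sim : (N-C → N-I → Set) → ℕ → N-I → N-I → Set
  Sim F zero    x b = ⊤
  Sim F (suc t) x b = Sim F t x b × Local F (Sim F t) x b

  Simulated : (N-I → N-I → Set) → N-I → Set
  Simulated S x = ∃ λ b → Negative b × S x b

  Fires : (N-I → N-I → Set) → N-C → N-I → Set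
  Fires S Q b = Negative b × ∃₂ λ k a → Query true k Q a × S a b ×
    (T (admits-⊥ L) → ∀ {x} → Ind true k x → Simulated S x)

  -- `m` is the number of refinements granted to the simulation in each round; a value at which
  -- refinement is stationary is supplied later.
  Facts : ℕ → ℕ → N-C → N-I → Set
  Facts m zero    A b = ∃ λ k → Has false k (concept A b)
  Facts m (suc t) A b = Facts m t A b ⊎ Fires (Sim (Facts m t) m) A b

  Rejects : (N-C → N-I → Set) → Set
  Rejects F = ∃ λ k → ∃₂ λ Q a → Query false k Q a × F Q a

  QueryInd Disjoint-Inds : Set
  QueryInd      = ∀ {sg k Q a} → Query sg k Q a → Ind sg k a
  Disjoint-Inds = ∀ {sg sg′ k k′ x} → Ind sg k x → Ind sg′ k′ x → k ≡ k′

  Ex-unique : ∀ {sg k e e′} → Ex sg k e → Ex sg k e′ → e ≡ e′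
  Ex-unique {true}  p q = At-unique p q
  Ex-unique {false} (j , refl , p) (j′ , e , q) with +-cancelˡ-≡ (length P) j j′ e
  ... | refl = At-unique p q

  ∈ind⇒Ind : ∀ {sg k e x} → Ex sg k e → x ∈ ind (proj₁ e) → Ind sg k x
  ∈ind⇒Ind ex x∈ with find (∈-concatMap⁻ individuals x∈)
  ... | α , α∈ , x∈α = α , (_ , ex , α∈) , ∈-individuals x∈α

  Ind⇒∈ind : ∀ {sg k e x} → Ex sg k e → Ind sg k x → x ∈ ind (proj₁ e)
  Ind⇒∈ind {sg} ex (α , (e′ , ex′ , α∈) , x∈α) with Ex-unique {sg} ex ex′
  ... | refl = ∈-concatMap⁺ individuals (lose α∈ (individuals-∈ x∈α))

  module Named (I : Interpretation) {sg k e} (ex : Ex sg k e) (model : ModelOfABox I (proj₁ e)) where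
    open Interpretation I

    holds : ∀ {α} → α ∈ assertions e → SatisfiesAssertion I α
    holds = All.lookup model

    ind∈Δ : ∀ {x} → Ind sg k x → Δ (inj₁ x)
    ind∈Δ (α , (e′ , ex′ , α∈) , x∈α) with Ex-unique {sg} ex ex′
    ind∈Δ (concept A x , (e , ex′ , α∈) , conc)   | refl = concept⊆ A (holds α∈)
    ind∈Δ (role r x b  , (e , ex′ , α∈) , first)  | refl = proj₁ (role⊆ r (holds α∈))
    ind∈Δ (role r a x  , (e , ex′ , α∈) , second) | refl = proj₂ (role⊆ r (holds α∈))

  module _ (query∈ind : QueryInd) (disjoint : Disjoint-Inds) where

    same-example : ∀ {sg k e α β x} → Ex sg k e → β ∈ assertions e → x ∈ₐ β → ∀ {k′} → Has sg k′ α → x ∈ₐ α → α ∈ assertions e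
    same-example {sg} ex β∈ x∈β (e′ , ex′ , α∈) x∈α with disjoint {sg} {sg} (_ , (_ , ex , β∈) , x∈β) (_ , (_ , ex′ , α∈) , x∈α)
    ... | refl with Ex-unique {sg} ex ex′
    ...   | refl = α∈

    module Sufficient (m t : ℕ)
      (closed : ∀ {Q b} → Fires (Sim (Facts m t) m) Q b → Facts m t Q b)
      (Simulated? : ∀ {k x} → Ind true k x → Dec (Simulated (Sim (Facts m t) m) x)) where

      F : N-C → N-I → Set
      F = Facts m t

      S : N-I → N-I → Set
      S = Sim F m

      -- The union of the negative examples, extended by the derived facts.
      𝒞 : ∃ Negative → Interpretation
      𝒞 (b₀ , neg) = record
        { Other    = ⊥
        ; Δ        = λ { (inj₁ b) → Negative b ; (inj₂ ()) }
        ; nonempty = inj₁ b₀ , neg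
        ; conceptᴵ = λ { A (inj₁ b) → Negative b × F A b ; A (inj₂ ()) }
        ; roleᴵ    = λ { r (inj₁ b) (inj₁ c) → ∃ λ k → Has false k (role r b c) ; r (inj₂ ()) _ ; r (inj₁ _) (inj₂ ()) }
        ; concept⊆ = λ { A {inj₁ b} (neg , _) → neg ; A {inj₂ ()} _ }
        ; role⊆    = λ { r {inj₁ b} {inj₁ c} (k , h) → (k , _ , h , first) , (k , _ , h , second)
                       ; r {inj₂ ()} _ ; r {inj₁ _} {inj₂ ()} _ } }

      conj : List Concept → Concept
      conj []       = ⊤ᶜ
      conj (C ∷ Cs) = C ⊓ conj Cs

      when : ∀ {P : Set} → Dec P → Concept → Concept
      when (yes _) C = C
      when (no _)  C = ⊤ᶜ

      -- The recursion mirrors that of `Sim`: depth `t` expresses `t` rounds of the simulation test.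
      -- All assertions of the positive examples are gone through, those not about `x` contributing
      -- only `⊤ᶜ`.
      unravel : ℕ → N-I → Concept
      part    : ℕ → N-I → Assertion → Concept

      unravel zero    x = ⊤ᶜ
      unravel (suc t) x = unravel t x ⊓ conj (map (part t x) (concatMap assertions P))

      part t x (concept A a) = when (a ≟ⁿ x) (atom A)
      part t x (role r a b)  = when (a ≟ⁿ x) (∃ᶜ (name r) (unravel t b))
                             ⊓ when (b ≟ⁿ x ×-dec T? (admits-inverse L)) (∃ᶜ (inverse r) (unravel t a))

      IsConcept-conj : ∀ {Cs} → All (IsConcept L) Cs → IsConcept L (conj Cs)
      IsConcept-conj []       = tt
      IsConcept-conj (p ∷ ps) = p , IsConcept-conj ps

      IsConcept-when : ∀ {P : Set} {C} (d : Dec P) → (P → IsConcept L C) → IsConcept L (when d C)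
      IsConcept-when (yes p) f = f p
      IsConcept-when (no _)  f = tt

      IsConcept-unravel : ∀ t x → IsConcept L (unravel t x)
      IsConcept-part    : ∀ t x α → IsConcept L (part t x α)

      IsConcept-unravel zero    x = tt
      IsConcept-unravel (suc t) x = IsConcept-unravel t x ,
        IsConcept-conj (Allₚ.map⁺ (All.universal (IsConcept-part t x) (concatMap assertions P)))

      IsConcept-part t x (concept A a) = IsConcept-when (a ≟ⁿ x) (λ _ → tt)
      IsConcept-part t x (role r a b)  = IsConcept-when (a ≟ⁿ x) (λ _ → tt , IsConcept-unravel t b) ,
        IsConcept-when (b ≟ⁿ x ×-dec T? (admits-inverse L)) (λ (_ , inv) → inv , IsConcept-unravel t a)

      Has⇒∈ : ∀ {k α} → Has true k α → α ∈ concatMap assertions P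
      Has⇒∈ (e , at , α∈) = ∈-concatMap⁺ assertions (lose (At⇒∈ at) α∈)

      ∈⇒Has : ∀ {α} → α ∈ concatMap assertions P → ∃ λ k → Has true k α
      ∈⇒Has α∈ with find (∈-concatMap⁻ assertions α∈)
      ... | e , e∈ , α∈e = let (k , at) = ∈⇒At e∈ in k , e , at , α∈e

      module _ (I : Interpretation) where
        conj-elim : ∀ {Cs C d} → ⟦ I ⟧ (conj Cs) d → C ∈ Cs → ⟦ I ⟧ C d
        conj-elim (h , _)  (here refl) = h
        conj-elim (_ , hs) (there C∈)  = conj-elim hs C∈

        conj-intro : ∀ {d} Cs → Interpretation.Δ I d → (∀ {C} → C ∈ Cs → ⟦ I ⟧ C d) → ⟦ I ⟧ (conj Cs) d
        conj-intro []       Δd f = Δd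
        conj-intro (C ∷ Cs) Δd f = f (here refl) , conj-intro Cs Δd (f ∘ there)

        when-elim : ∀ {P : Set} {C d} (p? : Dec P) → ⟦ I ⟧ (when p? C) d → P → ⟦ I ⟧ C d
        when-elim (yes _) h p = h
        when-elim (no ¬p) h p = contradiction p ¬p

        when-intro : ∀ {P : Set} {C d} (p? : Dec P) → Interpretation.Δ I d → (P → ⟦ I ⟧ C d) → ⟦ I ⟧ (when p? C) d
        when-intro (yes p) Δd f = f p
        when-intro (no _)  Δd f = Δd

      unravel⇒Sim : ∀ neg t {x b} → ⟦ 𝒞 neg ⟧ (unravel t x) (inj₁ b) → Sim F t x b
      unravel⇒Sim neg zero    h = tt
      unravel⇒Sim neg (suc t) {x} {b} (h , hs) = unravel⇒Sim neg t h ,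
        (λ {k} {A} has → proj₂ (when-elim I (x ≟ⁿ x) (conj-elim I hs (∈-map⁺ (part t x) (Has⇒∈ has))) refl)) ,
        (λ {k} {r} {y} has → forward (when-elim I (x ≟ⁿ x) (proj₁ (conj-elim I hs (∈-map⁺ (part t x) (Has⇒∈ has)))) refl)) ,
        (λ inv {k} {r} {y} has → backward (when-elim I (x ≟ⁿ x ×-dec T? (admits-inverse L))
          (proj₂ (conj-elim I hs (∈-map⁺ (part t x) (Has⇒∈ has)))) (refl , inv)))
        where
        I = 𝒞 neg
        forward : ∀ {r y} → ⟦ I ⟧ (∃ᶜ (name r) (unravel t y)) (inj₁ b) → ∃₂ λ k′ c → Has false k′ (role r b c) × Sim F t y c
        forward (inj₁ c , (k , has) , h) = k , c , has , unravel⇒Sim neg t h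
        backward : ∀ {r y} → ⟦ I ⟧ (∃ᶜ (inverse r) (unravel t y)) (inj₁ b) → ∃₂ λ k′ c → Has false k′ (role r c b) × Sim F t y c
        backward (inj₁ c , (k , has) , h) = k , c , has , unravel⇒Sim neg t h

      module _ (I : Interpretation) {k e} (ex : Ex true k e) (model : ModelOfABox I (proj₁ e)) where
        open Interpretation I
        open Named I {true} ex model

        local : ∀ {x α} → Ind true k x → α ∈ concatMap assertions P → x ∈ₐ α → α ∈ assertions e
        local (β , (e′ , ex′ , β∈) , x∈β) α∈ x∈α with Ex-unique {true} ex ex′
        ... | refl = same-example {true} ex β∈ x∈β (proj₂ (∈⇒Has α∈)) x∈α

        in-unravelling : ∀ t {x} → Ind true k x → ⟦ I ⟧ (unravel t x) (inj₁ x)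
        in-part : ∀ t {x} → Ind true k x → ∀ α → α ∈ concatMap assertions P → ⟦ I ⟧ (part t x α) (inj₁ x)

        in-unravelling zero    i = ind∈Δ i
        in-unravelling (suc t) {x} i = in-unravelling t i ,
          conj-intro I (map (part t x) (concatMap assertions P)) (ind∈Δ i) λ C∈ → each (∈-map⁻ (part t x) C∈)
          where
          each : ∀ {C} → (∃ λ α → α ∈ concatMap assertions P × C ≡ part t x α) → ⟦ I ⟧ C (inj₁ x)
          each (α , α∈ , refl) = in-part t i α α∈

        in-part t {x} i (concept A a) α∈ = when-intro I (a ≟ⁿ x) (ind∈Δ i) λ { refl → holds (local i α∈ conc) }
        in-part t {x} i (role r a b)  α∈ =
          when-intro I (a ≟ⁿ x) (ind∈Δ i) (λ { refl → let α∈e = local i α∈ first in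
            inj₁ b , holds α∈e , in-unravelling t (_ , (e , ex , α∈e) , second) }) ,
          when-intro I (b ≟ⁿ x ×-dec T? (admits-inverse L)) (ind∈Δ i) (λ { (refl , _) → let α∈e = local i α∈ second in
            inj₁ a , holds α∈e , in-unravelling t (_ , (e , ex , α∈e) , first) })

      Good-for : Raw → Set₁
      Good-for e = ∃ λ 𝒪 → IsOntology L 𝒪 × (∀ neg → ModelOfOntology (𝒞 neg) 𝒪) × Entailedᴿ 𝒪 e

      all-or-any : ∀ {A : Set} {R : Pred A 0ℓ} {xs} → All (Dec ∘ R) xs → All R xs ⊎ (∃ λ x → x ∈ xs × ¬ R x)
      all-or-any []            = inj₁ []
      all-or-any (no ¬r ∷ rs)  = inj₂ (_ , here refl , ¬r)
      all-or-any (yes r ∷ rs) with all-or-any rs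
      ... | inj₁ all            = inj₁ (r ∷ all)
      ... | inj₂ (x , x∈ , ¬r)  = inj₂ (x , there x∈ , ¬r)

      -- If the side condition for `⊥` is met, the inclusion into `Q` holds in the countermodel
      -- because the facts are closed. Otherwise `⊥` is available and some individual is simulated
      -- nowhere: its unravelling is empty in the countermodel and may be declared empty, which
      -- makes the positive example inconsistent with the ontology.
      separable : ∀ {k e} → Ex true k e → Good-for e
      separable {k} {𝒜 , aq Q a} ex = decide (T? (admits-⊥ L))
        where
        query : Query true k Q a
        query = 𝒜 , ex
        derives : (T (admits-⊥ L) → ∀ {x} → Ind true k x → Simulated S x) → Good-for (𝒜 , aq Q a)
        derives simulated = (unravel m a ⊑ atom Q) ∷ [] ,
          ((IsConcept-unravel m a , tt) ∷ []) ,
          (λ neg → (λ { {inj₁ b} h → in-Δ neg h , closed (in-Δ neg h , k , a , query , unravel⇒Sim neg m h ,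
            simulated) ; {inj₂ ()} _ }) ∷ []) ,
          (λ I model → λ { (sat ∷ []) → sat (in-unravelling I ex model m (query∈ind {true} query)) })
          where
          in-Δ : ∀ neg {b} → ⟦ 𝒞 neg ⟧ (unravel m a) (inj₁ b) → Negative b
          in-Δ neg = go m
            where
            go : ∀ t {b} → ⟦ 𝒞 neg ⟧ (unravel t a) (inj₁ b) → Negative b
            go zero    h       = h
            go (suc t) (h , _) = go t h
        decide : Dec (T (admits-⊥ L)) → Good-for (𝒜 , aq Q a)
        decide (no ¬⊥) = derives λ ⊥∈L → contradiction ⊥∈L ¬⊥
        decide (yes ⊥∈L) with all-or-any (All.tabulate {xs = ind 𝒜} λ x∈ → Simulated? (∈ind⇒Ind {true} ex x∈))
        ... | inj₁ all = derives λ _ i → All.lookup all (Ind⇒∈ind {true} ex i)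
        ... | inj₂ (x , x∈ , ¬simulated) = (unravel m x ⊑ ⊥ᶜ) ∷ [] ,
          ((IsConcept-unravel m x , ⊥∈L) ∷ []) ,
          (λ neg → (λ { {inj₁ b} h → contradiction (b , in-Δ neg h , unravel⇒Sim neg m h) ¬simulated ; {inj₂ ()} _ }) ∷ []) ,
          (λ I model → λ { (sat ∷ []) → ⊥-elim (sat (in-unravelling I ex model m (∈ind⇒Ind {true} ex x∈))) })
          where
          in-Δ : ∀ neg {b} → ⟦ 𝒞 neg ⟧ (unravel m x) (inj₁ b) → Negative b
          in-Δ neg = go m
            where
            go : ∀ t {b} → ⟦ 𝒞 neg ⟧ (unravel t x) (inj₁ b) → Negative b
            go zero    h       = h
            go (suc t) (h , _) = go t h

      -- Entailment is monotone in the ontology and the countermodel is the same for all examples,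
      -- so the ontologies can be united.
      combine : ∀ {es} → All Good-for es → ∃ λ 𝒪 → IsOntology L 𝒪 × (∀ neg → ModelOfOntology (𝒞 neg) 𝒪) × All (Entailedᴿ 𝒪) es
      combine [] = [] , [] , (λ _ → []) , []
      combine ((𝒪₁ , is₁ , sat₁ , ent₁) ∷ gs) with combine gs
      ... | 𝒪₂ , is₂ , sat₂ , ent₂ = 𝒪₁ ++ 𝒪₂ , Allₚ.++⁺ is₁ is₂ , (λ neg → Allₚ.++⁺ (sat₁ neg) (sat₂ neg)) ,
        (λ I model sat → ent₁ I model (Allₚ.++⁻ˡ 𝒪₁ sat)) ∷ All.map (λ ent I model sat → ent I model (Allₚ.++⁻ʳ 𝒪₁ sat)) ent₂

      facts-base : ∀ t′ {A b k} → Has false k (concept A b) → Facts m t′ A b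
      facts-base zero     has = _ , has
      facts-base (suc t′) has = inj₁ (facts-base t′ has)

      sufficient : ¬ Rejects F → ∃ λ 𝒪 → IsOntology L 𝒪 × All (Entailedᴿ 𝒪) P × All (¬_ ∘ Entailedᴿ 𝒪) N
      sufficient accepts with combine (All.tabulate λ e∈ → separable (proj₂ (∈⇒At e∈)))
      ... | 𝒪 , is , sat , ent = 𝒪 , is , ent , All.tabulate λ {e} e∈ entails →
        let (j , at) = ∈⇒At e∈
            query    = proj₁ e , j , refl , at
            -- The individual of the refuted query makes the domain of the countermodel nonempty.
            neg      = _ , _ , query∈ind {false} query
        in accepts (_ , _ , _ , query , proj₂ (entails (𝒞 neg)
             (All.tabulate λ {α} α∈ → model neg α {e} (_ , j , refl , at) α∈) (sat neg)))
        where
        model : ∀ neg α {e} → (∃ λ k → Ex false k e) → α ∈ assertions e → SatisfiesAssertion (𝒞 neg) α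
        model neg (concept A a) {e} (k , ex) α∈ = (k , _ , (e , ex , α∈) , conc) , facts-base t (e , ex , α∈)
        model neg (role r a b)  {e} (k , ex) α∈ = k , e , ex , α∈

    module Necessary (m : ℕ)
      (closed : ∀ {t k x b} → Ind true k x → Negative b → Sim (Facts m t) m x b → Local (Facts m t) (Sim (Facts m t) m) x b)
      {𝒪 : Ontology} (is : IsOntology L 𝒪) (entails : All (Entailedᴿ 𝒪) P) where

      module Models {Ix : Set} (𝓘 : Ix → Interpretation) (example : Ix → ∃₂ (Ex false))
        (ABox-model : ∀ i → ModelOfABox (𝓘 i) (proj₁ (proj₁ (proj₂ (example i)))))
        (ontology-model : ∀ i → ModelOfOntology (𝓘 i) 𝒪)
        (covers : ∀ {k e} → Ex false k e → ∃ λ i → proj₁ (example i) ≡ k) where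

        number : Ix → ℕ
        number i = proj₁ (example i)

        -- Induction over the stages: the labels that a simulation relies on are facts of an earlier
        -- stage, already true in the models, and this makes the powerset model satisfy the concept
        -- assertions of the positive example.
        facts-hold : ∀ t {A b} i → Facts m t A b → Ind false (number i) b → Interpretation.conceptᴵ (𝓘 i) A (inj₁ b)
        facts-hold zero i (k , has) (β , (e , ex , β∈) , b∈β) with Ex-unique {false} (proj₂ (proj₂ (example i))) ex
        ... | refl = All.lookup (ABox-model i) (same-example {false} ex β∈ b∈β has conc)
        facts-hold (suc t) i (inj₁ f) ind = facts-hold t i f ind
        facts-hold (suc t) {Q} {b} i (inj₂ (_ , k , a , (𝒜 , ex) , a∼b , simulated)) ind =
          proj₂ (All.lookup entails (At⇒∈ ex) (powerset inhabited) (All.tabulate λ {α} → satisfied α)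
                  (powerset-model inhabited is ontology-model)) (b , refl , ind , a∼b)
          where
          F = Facts m t
          S = Sim F m
          X : N-I → ∀ i → Pred (Interpretation.Element (𝓘 i)) 0ℓ
          X x i y = ∃ λ b → y ≡ inj₁ b × Ind false (number i) b × S x b
          open Powerset L 𝓘 X
          proper : ∀ {x} → Ind true k x → Proper (inj₁ x)
          proper x∈ = (λ { {i} (b , refl , ind , _) → Named.ind∈Δ (𝓘 i) {false} (proj₂ (proj₂ (example i)))
            (ABox-model i) ind }) ,
            λ ⊥∈L → witness (simulated ⊥∈L x∈)
            where
            -- The simulating individual may lie in any negative example; therefore the family of
            -- models has to cover all of them.
            witness : ∀ {x} → Simulated S x → ∃₂ λ i y → X x i y
            witness (b , (k , β , (e , ex , β∈) , b∈β) , s) with covers ex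
            ... | i , refl = i , inj₁ b , b , refl , (β , (e , ex , β∈) , b∈β) , s
          inhabited : Satisfiable Proper
          inhabited = inj₁ a , proper (query∈ind {true} (𝒜 , ex))
          -- By disjointness, an assertion about an individual belongs to the individual's own
          -- example, so the successors provided by a simulation stay in the same model.
          inside : ∀ {i b α} → Ind false (number i) b → (∃ λ k → Has false k α) → b ∈ₐ α →
                   SatisfiesAssertion (𝓘 i) α × Has false (number i) α
          inside {i} (β , (e , ex , β∈) , b∈β) (k , has) b∈α with Ex-unique {false} (proj₂ (proj₂ (example i))) ex
          ... | refl = let α∈ = same-example {false} ex β∈ b∈β has b∈α in All.lookup (ABox-model i) α∈ , (e , ex , α∈)
          satisfied : ∀ α → α ∈ toList 𝒜 → SatisfiesAssertion (powerset inhabited) α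
          satisfied (concept A x) α∈ = proper (_ , has , conc) ,
            λ { {i} (b , refl , ind , s) → facts-hold t i (proj₁ (closed {t} (_ , has , conc) (_ , ind) s) has) ind }
            where
            has : Has true k (concept A x)
            has = _ , ex , α∈
          satisfied (role r x y) α∈ = (proper (_ , has , first) , proper (_ , has , second)) ,
            (λ { {i} (b , refl , ind , s) → forward ind (proj₁ (proj₂ (closed {t} (_ , has , first) (_ , ind) s)) has) }) ,
            (λ inv → λ { {i} (b , refl , ind , s) → backward ind
              (proj₂ (proj₂ (closed {t} (_ , has , second) (_ , ind) s)) inv has) })
            where
            has : Has true k (role r x y)
            has = _ , ex , α∈
            forward : ∀ {i b} → Ind false (number i) b → (∃₂ λ k′ c → Has false k′ (role r b c) × S y c) →
                      ∃ λ e → X y i e × Interpretation.roleᴵ (𝓘 i) r (inj₁ b) e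
            forward ind (k′ , c , has′ , s) = let (sat , h) = inside ind (k′ , has′) first in
              inj₁ c , (c , refl , (_ , h , second) , s) , sat
            backward : ∀ {i b} → Ind false (number i) b → (∃₂ λ k′ c → Has false k′ (role r c b) × S x c) →
                       ∃ λ e → X x i e × Interpretation.roleᴵ (𝓘 i) r e (inj₁ b)
            backward ind (k′ , c , has′ , s) = let (sat , h) = inside ind (k′ , has′) second in
              inj₁ c , (c , refl , (_ , h , first) , s) , sat

      Model : Raw → Set₁
      Model e = ∃ λ I → ModelOfABox I (proj₁ e) × ModelOfOntology I 𝒪

      -- A failed entailment gives a model up to double negation, and double negation commutes with
      -- finite conjunctions.
      ¬¬-models : ∀ {es} → All (¬_ ∘ Entailedᴿ 𝒪) es → ¬ ¬ All Model es
      ¬¬-models []       k = k []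
      ¬¬-models (n ∷ ns) k = n λ I model sat → ⊥-elim (¬¬-models ns λ ms → k ((I , model , sat) ∷ ms))

      -- Refuting "the negative example is not entailed" by establishing the entailment lets us use models of all
      -- negative examples, although these exist only up to double negation.
      necessary : ∀ t → All (¬_ ∘ Entailedᴿ 𝒪) N → ¬ Rejects (Facts m t)
      necessary t notEntailed (k , Q , a , (𝒜 , ex@(j , _ , at)) , f) = ¬¬-models notEntailed λ models →
        All.lookup notEntailed (At⇒∈ at) λ I model sat → entailed models I model sat
        where
        entailed : All Model N → ∀ I → ModelOfABox I 𝒜 → ModelOfOntology I 𝒪 → Interpretation.conceptᴵ I Q (inj₁ a)
        entailed models I model sat = Models.facts-hold 𝓘 example (proj₁ ∘ models-of) (proj₂ ∘ models-of) covers t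
          nothing f (query∈ind {false} (𝒜 , ex))
          where
          -- `nothing` stands for the arbitrary model in which the query is to be established, the
          -- other indices for the models at hand of all negative examples.
          Ix : Set
          Ix = Maybe (∃₂ (At N))
          given : ∀ {j e} → At N j e → Model e
          given at = All.lookup models (At⇒∈ at)
          𝓘 : Ix → Interpretation
          𝓘 nothing             = I
          𝓘 (just (_ , _ , at)) = proj₁ (given at)
          example : Ix → ∃₂ (Ex false)
          example nothing             = k , _ , ex
          example (just (j , e , at)) = length P + j , e , j , refl , at
          models-of : ∀ i → ModelOfABox (𝓘 i) (proj₁ (proj₁ (proj₂ (example i)))) × ModelOfOntology (𝓘 i) 𝒪
          models-of nothing             = model , sat
          models-of (just (_ , _ , at)) = proj₂ (given at)
          covers : ∀ {k e} → Ex false k e → ∃ λ i → proj₁ (example i) ≡ k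
          covers (j , refl , at) = just (j , _ , at) , refl

-- The automaton reading encoded collections

Finite-× : ∀ {A B} → Finite A → Finite B → Finite (A × B)
Finite-× (m , f) (n , g) = m * n , ↔-trans (f ×-↔ g) (↔-sym *↔×)

Finite-Symbol : Finite Symbol
Finite-Symbol = 7 , mk↔ₛ′
  (λ { (bit false) → 0F ; (bit true) → 1F ; lparen → 2F ; comma → 3F ; rparen → 4F ; turnstile → 5F ; vbar → 6F })
  (λ { 0F → bit false ; 1F → bit true ; 2F → lparen ; 3F → comma ; 4F → rparen ; 5F → turnstile ; 6F → vbar })
  (λ { 0F → refl ; 1F → refl ; 2F → refl ; 3F → refl ; 4F → refl ; 5F → refl ; 6F → refl })
  (λ { (bit false) → refl ; (bit true) → refl ; lparen → refl ; comma → refl ; rparen → refl ; turnstile → refl ; vbar → refl })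

-- Where in an encoded collection the automaton reading it is; a query is the atom after a turnstile.
Context : Set
Context = Fin 9

pattern between  = 0F
pattern afterC   = 1F
pattern afterR   = 2F
pattern inName   = 3F
pattern inFirst  = 4F
pattern inSecond = 5F
pattern inQuery  = 6F
pattern inQInd   = 7F
pattern invalid  = 8F

-- A letter records the symbol read and the context and sign of the examples after it.
Letter : Set
Letter = Context × Bool × Symbol

Finite-Letter : Finite Letter
Finite-Letter = Finite-× (9 , ↔-refl) (Finite-× Finite-Bool Finite-Symbol)

-- A turnstile is refused in the context `between`, which enforces nonempty ABoxes. Names may be
-- empty, so a parenthesis may open at once.
proceed : Context → Symbol → Context
proceed between  (bit _)   = inName
proceed between  lparen    = inFirst
proceed afterC   (bit _)   = inName
proceed afterC   lparen    = inFirst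
proceed afterC   turnstile = inQuery
proceed afterR   (bit _)   = inName
proceed afterR   lparen    = inFirst
proceed afterR   turnstile = inQuery
proceed inName   (bit _)   = inName
proceed inName   lparen    = inFirst
proceed inFirst  (bit _)   = inFirst
proceed inFirst  comma     = inSecond
proceed inFirst  rparen    = afterC
proceed inSecond (bit _)   = inSecond
proceed inSecond rparen    = afterR
proceed inQuery  (bit _)   = inQuery
proceed inQuery  lparen    = inQInd
proceed inQInd   (bit _)   = inQInd
proceed inQInd   rparen    = between
proceed _        _         = invalid

read : Context → Symbol → Bool → Context × Bool
read between vbar true = between , false
read c       x    sg   = proceed c x , sg

State : Set
State = Context × Bool

letterOf : State → Symbol → Letter
letterOf (c , sg) x = let (c′ , sg′) = read c x sg in c′ , sg′ , x

δ : Letter → Symbol → Letter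
δ (c , sg , _) = letterOf (c , sg)

q₀ : Letter
q₀ = between , true , vbar

data Kind : Set where
  bitᵏ                     : Bool → Kind
  conceptᵏ roleᵏ queryᵏ    : Bool → Kind
  other                    : Kind

-- Items are recognised by their closing parentheses.
kind : Letter → Kind
kind (_       , _  , bit b)  = bitᵏ b
kind (afterC  , sg , rparen) = conceptᵏ sg
kind (afterR  , sg , rparen) = roleᵏ sg
kind (between , sg , rparen) = queryᵏ sg
kind _                       = other

-- The reversed current name, the two reversed names before it, and the number of completed examples.
record Summary : Set where
  constructor summary
  field
    current before before² : Name
    completed              : ℕ
open Summary public

absorb : Kind → Summary → Summary
absorb (bitᵏ b)   (summary c d e k) = summary (b ∷ c) d e k
absorb (queryᵏ _) (summary c d e k) = summary [] c d (suc k)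
absorb _          (summary c d e k) = summary [] c d k

data Item : Set where
  conceptᴵ : Bool → ℕ → N-C → N-I → Item
  roleᴵ    : Bool → ℕ → N-R → N-I → N-I → Item
  queryᴵ   : Bool → ℕ → N-C → N-I → Item

emit : Kind → Summary → List Item
emit (conceptᵏ sg) (summary c d e k) = conceptᴵ sg k (reverse d) (reverse c) ∷ []
emit (roleᵏ sg)    (summary c d e k) = roleᴵ sg k (reverse e) (reverse d) (reverse c) ∷ []
emit (queryᵏ sg)   (summary c d e k) = queryᴵ sg k (reverse d) (reverse c) ∷ []
emit _             _                 = []

move′ : State → Symbol → State
move′ (c , sg) x = read c x sg

scan : State → Summary → List Symbol → List Item
scan q s []      = []
scan q s (x ∷ w) = emit (kind (letterOf q x)) s ++ scan (move′ q x) (absorb (kind (letterOf q x)) s) w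

end : State → List Symbol → State
end q []      = q
end q (x ∷ w) = end (move′ q x) w

-- The quantification over the rest of the word is what lets the readings of consecutive pieces be
-- composed.
record Reads (q : State) (s : Summary) (u : List Symbol) (is : List Item) (q′ : State) (s′ : Summary) : Set where
  constructor reads
  field
    scanned : ∀ w → scan q s (u ++ w) ≡ is ++ scan q′ s′ w
    ended   : ∀ w → end q (u ++ w) ≡ end q′ w
open Reads

Reads-++ : ∀ {q s u is q′ s′ u′ is′ q″ s″} → Reads q s u is q′ s′ → Reads q′ s′ u′ is′ q″ s″ →
           Reads q s (u ++ u′) (is ++ is′) q″ s″
Reads-++ {q} {s} {u} {is} {q′} {s′} {u′} {is′} {q″} {s″} r r′ = reads
  (λ w → trans (cong (scan q s) (Listₚ.++-assoc u u′ w)) (trans (scanned r (u′ ++ w))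
           (trans (cong (is ++_) (scanned r′ w)) (sym (Listₚ.++-assoc is is′ (scan q″ s″ w))))))
  (λ w → trans (cong (end q) (Listₚ.++-assoc u u′ w)) (trans (ended r (u′ ++ w)) (ended r′ w)))

Reads-∷ : ∀ {q s x u is q″ s″} → Reads (move′ q x) (absorb (kind (letterOf q x)) s) u is q″ s″ →
          Reads q s (x ∷ u) (emit (kind (letterOf q x)) s ++ is) q″ s″
Reads-∷ {q} {s} {x} {u} {is} r = reads
  (λ w → trans (cong (emit (kind (letterOf q x)) s ++_) (scanned r w)) (sym (Listₚ.++-assoc (emit (kind (letterOf q x)) s) is _)))
  (ended r)

Reads-[] : ∀ {q s} → Reads q s [] [] q s
Reads-[] = reads (λ _ → refl) (λ _ → refl)

Reads-bits : ∀ {c sg} → (∀ b → read c (bit b) sg ≡ (c , sg)) → ∀ A {cur d e k} →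
  Reads (c , sg) (summary cur d e k) (map bit A) [] (c , sg) (summary (A ʳ++ cur) d e k)
Reads-bits stable []      = Reads-[]
Reads-bits {c} {sg} stable (b ∷ A) {cur} {d} {e} {k} = Reads-∷
  (subst (λ q → Reads q (summary (b ∷ cur) d e k) (map bit A) [] (c , sg) (summary ((b ∷ A) ʳ++ cur) d e k)) (sym (stable b))
    (Reads-bits stable A))

Reads-cast : ∀ {q s u is q′ s′ u′ is′ s″} → u ≡ u′ → is ≡ is′ → s′ ≡ s″ → Reads q s u is q′ s′ → Reads q s u′ is′ q′ s″
Reads-cast refl refl refl r = r

data Starting : Context → Set where
  start    : Starting between
  conceptˢ : Starting afterC
  roleˢ    : Starting afterR

-- The first bit changes the context and later bits keep it, while an empty name leads straight to
-- the parenthesis; hence the split into cases.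
Reads-name : ∀ {c sg} → Starting c → ∀ A {d e k} →
  Reads (c , sg) (summary [] d e k) (map bit A ++ lparen ∷ []) [] (inFirst , sg) (summary [] (reverse A) d k)
Reads-name start    []      = Reads-∷ Reads-[]
Reads-name conceptˢ []      = Reads-∷ Reads-[]
Reads-name roleˢ    []      = Reads-∷ Reads-[]
Reads-name start (b ∷ A) = Reads-∷ (Reads-++ (Reads-bits (λ _ → refl) A) (Reads-∷ Reads-[]))
Reads-name conceptˢ (b ∷ A) = Reads-∷ (Reads-++ (Reads-bits (λ _ → refl) A) (Reads-∷ Reads-[]))
Reads-name roleˢ    (b ∷ A) = Reads-∷ (Reads-++ (Reads-bits (λ _ → refl) A) (Reads-∷ Reads-[]))

assertionItem : Bool → ℕ → Assertion → Item
assertionItem sg k (concept A a) = conceptᴵ sg k A a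
assertionItem sg k (role r a b)  = roleᴵ sg k r a b

encodeRaw : Raw → List Symbol
encodeRaw e@(_ , aq Q a) = concatMap encodeAssertion (assertions e) ++ turnstile ∷ encodeAtom Q a

afterAssertion : Assertion → Context
afterAssertion (concept _ _) = afterC
afterAssertion (role _ _ _)  = afterR

Reads-assertion : ∀ {c sg} → Starting c → ∀ α {d e k} → ∃₂ λ d′ e′ →
  Reads (c , sg) (summary [] d e k) (encodeAssertion α) (assertionItem sg k α ∷ []) (afterAssertion α , sg) (summary [] d′ e′ k)
Reads-assertion st (concept A a) {d} {e} {k} = _ , _ ,
  Reads-cast (Listₚ.++-assoc (map bit A) _ _)
    (cong₂ (λ A a → conceptᴵ _ k A a ∷ []) (Listₚ.reverse-involutive A) (Listₚ.reverse-involutive a)) refl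
    (Reads-++ (Reads-name st A) (Reads-++ (Reads-bits (λ _ → refl) a) (Reads-∷ Reads-[])))
Reads-assertion {sg = sg} st (role r a b) {d} {e} {k} = _ , _ ,
  Reads-cast (Listₚ.++-assoc (map bit r) _ _)
    (cong (_∷ []) (trans (cong₂ (λ r a → roleᴵ sg k r a (reverse (reverse b))) (Listₚ.reverse-involutive r)
      (Listₚ.reverse-involutive a))
                         (cong (roleᴵ sg k r a) (Listₚ.reverse-involutive b)))) refl
    (Reads-++ (Reads-name st r) (Reads-++ (Reads-bits (λ _ → refl) a)
      (Reads-∷ (Reads-++ (Reads-bits (λ _ → refl) b) (Reads-∷ Reads-[])))))

Starting-afterAssertion : ∀ α → Starting (afterAssertion α)
Starting-afterAssertion (concept _ _) = conceptˢ
Starting-afterAssertion (role _ _ _)  = roleˢ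

Reads-query : ∀ {sg} α Q a {d e k} → ∃₂ λ d′ e′ →
  Reads (afterAssertion α , sg) (summary [] d e k) (turnstile ∷ encodeAtom Q a) (queryᴵ sg k Q a ∷ []) (between , sg)
    (summary [] d′ e′ (suc k))
Reads-query {sg} α Q a {d} {e} {k} = _ , _ ,
  Reads-cast (cong (turnstile ∷_) (Listₚ.++-assoc (map bit Q) _ _))
    (cong₂ (λ Q a → queryᴵ sg k Q a ∷ []) (Listₚ.reverse-involutive Q) (Listₚ.reverse-involutive a)) refl (after α)
  where
  after : ∀ α → Reads (afterAssertion α , sg) (summary [] d e k)
    (turnstile ∷ ((map bit Q ++ lparen ∷ []) ++ map bit a ++ rparen ∷ []))
            (queryᴵ sg k (reverse (reverse Q)) (reverse (reverse a)) ∷ []) (between , sg)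
              (summary [] (reverse a) (reverse Q) (suc k))
  body : ∀ {d e} → Reads (inQuery , sg) (summary [] d e k) ((map bit Q ++ lparen ∷ []) ++ map bit a ++ rparen ∷ [])
            (queryᴵ sg k (reverse (reverse Q)) (reverse (reverse a)) ∷ []) (between , sg)
              (summary [] (reverse a) (reverse Q) (suc k))
  body = Reads-++ (Reads-++ (Reads-bits (λ _ → refl) Q) (Reads-∷ Reads-[]))
    (Reads-++ (Reads-bits (λ _ → refl) a) (Reads-∷ Reads-[]))
  after (concept _ _) = Reads-∷ body
  after (role _ _ _)  = Reads-∷ body

exampleItems : Bool → ℕ → Raw → List Item
exampleItems sg k e@(_ , aq Q a) = map (assertionItem sg k) (assertions e) ++ queryᴵ sg k Q a ∷ []

Reads-example : ∀ {sg} e {d e′ k} → ∃₂ λ d′ e″ →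
  Reads (between , sg) (summary [] d e′ k) (encodeRaw e) (exampleItems sg k e) (between , sg) (summary [] d′ e″ (suc k))
Reads-example {sg} (α ∷ αs , aq Q a) {d} {e} {k} = go start α αs
  where
  go : ∀ {c} → Starting c → ∀ α αs {d e} → ∃₂ λ d′ e′ →
    Reads (c , sg) (summary [] d e k) (encodeRaw (α ∷ αs , aq Q a)) (exampleItems sg k (α ∷ αs , aq Q a))
      (between , sg) (summary [] d′ e′ (suc k))
  go st α [] with Reads-assertion st α
  ... | d₁ , e₁ , r₁ with Reads-query α Q a {d₁} {e₁}
  ...   | d₂ , e₂ , r₂ = d₂ , e₂ , Reads-cast (cong (_++ turnstile ∷ encodeAtom Q a)
    (sym (Listₚ.++-identityʳ (encodeAssertion α)))) refl refl (Reads-++ r₁ r₂)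
  go st α (β ∷ αs) with Reads-assertion st α
  ... | d₁ , e₁ , r₁ with go (Starting-afterAssertion α) β αs {d₁} {e₁}
  ...   | d₂ , e₂ , r₂ = d₂ , e₂ , Reads-cast (sym (Listₚ.++-assoc (encodeAssertion α) _ _)) refl refl (Reads-++ r₁ r₂)

examplesItems : Bool → ℕ → List Raw → List Item
examplesItems sg k []       = []
examplesItems sg k (e ∷ es) = exampleItems sg k e ++ examplesItems sg (suc k) es

Reads-examples : ∀ {sg} es {d e k} → ∃₂ λ d′ e′ →
  Reads (between , sg) (summary [] d e k) (concatMap encodeRaw es) (examplesItems sg k es) (between , sg)
    (summary [] d′ e′ (length es + k))
Reads-examples [] = _ , _ , Reads-[]
Reads-examples {sg} (e ∷ es) {k = k} with Reads-example {sg} e {k = k}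
... | d₁ , e₁ , r₁ with Reads-examples {sg} es {d₁} {e₁} {suc k}
...   | d₂ , e₂ , r₂ = d₂ , e₂ , Reads-++ r₁ (Reads-cast refl refl (cong (summary [] d₂ e₂) (+-suc (length es) k)) r₂)

encodeRaws : List Raw → List Raw → List Symbol
encodeRaws P N = concatMap encodeRaw P ++ vbar ∷ concatMap encodeRaw N

items : List Raw → List Raw → List Item
items P N = examplesItems true 0 P ++ examplesItems false (length P) N

scan-encoding : ∀ P N → scan (between , true) (summary [] [] [] 0) (encodeRaws P N) ≡ items P N
scan-encoding P N with Reads-examples {true} P {[]} {[]} {0}
... | d₁ , e₁ , r₁ with Reads-examples {false} N {[]} {d₁} {length P + 0}
...   | d₂ , e₂ , r₂ = begin
  scan q s (encodeRaws P N)                                       ≡⟨ scanned r₁ _ ⟩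
  examplesItems true 0 P ++ scan q s₁ (vbar ∷ concatMap encodeRaw N)  ≡⟨ cong
    (λ w → examplesItems true 0 P ++ scan q s₁ (vbar ∷ w)) (sym (Listₚ.++-identityʳ (concatMap encodeRaw N))) ⟩
  examplesItems true 0 P ++ scan _ (summary [] [] d₁ (length P + 0)) (concatMap encodeRaw N ++ [])
    ≡⟨ cong (examplesItems true 0 P ++_) (trans (scanned r₂ []) (Listₚ.++-identityʳ _)) ⟩
  examplesItems true 0 P ++ examplesItems false (length P + 0) N  ≡⟨ cong
    (λ k → examplesItems true 0 P ++ examplesItems false k N) (+-identityʳ (length P)) ⟩
  items P N ∎
  where
  open ≡-Reasoning
  q = between , true
  s = summary [] [] [] 0
  s₁ = summary [] d₁ e₁ (length P + 0)

end-encoding : ∀ P N → end (between , true) (encodeRaws P N) ≡ (between , false)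
end-encoding P N with Reads-examples {true} P {[]} {[]} {0}
... | _ , _ , r₁ with Reads-examples {false} N {[]} {[]} {0}
...   | _ , _ , r₂ = trans (ended r₁ (vbar ∷ concatMap encodeRaw N))
  (trans (cong (end (between , false)) (sym (Listₚ.++-identityʳ (concatMap encodeRaw N)))) (ended r₂ []))

∈-exampleItems⁻ : ∀ {sg k e i} → i ∈ exampleItems sg k e →
  (∃ λ α → α ∈ assertions e × i ≡ assertionItem sg k α) ⊎ i ≡ queryᴵ sg k (AQ.queryName (proj₂ e)) (AQ.individual (proj₂ e))
∈-exampleItems⁻ {sg} {k} {e} i∈ with ∈-++⁻ (map (assertionItem sg k) (assertions e)) i∈
... | inj₁ i∈′         = inj₁ (∈-map⁻ (assertionItem sg k) i∈′)
... | inj₂ (here refl) = inj₂ refl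

∈-examplesItems⁺ : ∀ {sg k₀ es j e i} → At es j e → i ∈ exampleItems sg (k₀ + j) e → i ∈ examplesItems sg k₀ es
∈-examplesItems⁺ {sg} {k₀} {_} {_} {e} {i} here i∈ = ∈-++⁺ˡ (subst (λ k → i ∈ exampleItems sg k e) (+-identityʳ k₀) i∈)
∈-examplesItems⁺ {sg} {k₀} {e₀ ∷ es} {suc j} {e} {i} (there at) i∈ = ∈-++⁺ʳ (exampleItems sg k₀ e₀)
  (∈-examplesItems⁺ at (subst (λ k → i ∈ exampleItems sg k e) (+-suc k₀ j) i∈))

∈-examplesItems⁻ : ∀ {sg k₀ es i} → i ∈ examplesItems sg k₀ es → ∃₂ λ j e → At es j e × i ∈ exampleItems sg (k₀ + j) e
∈-examplesItems⁻ {sg} {k₀} {e₀ ∷ es} {i} i∈ with ∈-++⁻ (exampleItems sg k₀ e₀) i∈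
... | inj₁ i∈′ = 0 , e₀ , here , subst (λ k → i ∈ exampleItems sg k e₀) (sym (+-identityʳ k₀)) i∈′
... | inj₂ i∈′ with ∈-examplesItems⁻ {sg} {suc k₀} {es} i∈′
...   | j , e , at , i∈″ = suc j , e , there at , subst (λ k → i ∈ exampleItems sg k e) (sym (+-suc k₀ j)) i∈″

module _ (L : DL) (P N : List Raw) where
  open Fitting L P N

  items⁺ : ∀ {sg k e i} → Ex sg k e → i ∈ exampleItems sg k e → i ∈ items P N
  items⁺ {true}  at              i∈ = ∈-++⁺ˡ (∈-examplesItems⁺ at i∈)
  items⁺ {false} (j , refl , at) i∈ = ∈-++⁺ʳ (examplesItems true 0 P) (∈-examplesItems⁺ at i∈)

  items⁻ : ∀ {i} → i ∈ items P N → ∃₂ λ sg k → ∃ λ e → Ex sg k e × i ∈ exampleItems sg k e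
  items⁻ i∈ with ∈-++⁻ (examplesItems true 0 P) i∈
  ... | inj₁ i∈′ = let (j , e , at , i∈″) = ∈-examplesItems⁻ i∈′ in true , j , e , at , i∈″
  ... | inj₂ i∈′ = let (j , e , at , i∈″) = ∈-examplesItems⁻ i∈′ in false , length P + j , e , (j , refl , at) , i∈″

  has⁺ : ∀ {sg k α} → Has sg k α → assertionItem sg k α ∈ items P N
  has⁺ {sg} {k} (e , ex , α∈) = items⁺ ex (∈-++⁺ˡ (∈-map⁺ (assertionItem sg k) α∈))

  has⁻ : ∀ {sg k α} → assertionItem sg k α ∈ items P N → Has sg k α
  has⁻ {sg} {k} {α} i∈ with items⁻ i∈
  ... | sg′ , k′ , e , ex , i∈′ with ∈-exampleItems⁻ {sg′} {k′} {e} i∈′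
  ...   | inj₁ (β , β∈ , eq) = go α β β∈ eq
    where
    go : ∀ α β → β ∈ assertions e → assertionItem sg k α ≡ assertionItem sg′ k′ β → Has sg k α
    go (concept _ _) (concept _ _) β∈ refl = e , ex , β∈
    go (role _ _ _)  (role _ _ _)  β∈ refl = e , ex , β∈
  ...   | inj₂ eq with α | eq
  ...     | concept _ _ | ()
  ...     | role _ _ _  | ()

  query⁺ : ∀ {sg k Q a} → Query sg k Q a → queryᴵ sg k Q a ∈ items P N
  query⁺ {sg} {k} (𝒜 , ex) = items⁺ ex (∈-++⁺ʳ (map (assertionItem sg k) (toList 𝒜)) (here refl))

  query⁻ : ∀ {sg k Q a} → queryᴵ sg k Q a ∈ items P N → Query sg k Q a
  query⁻ i∈ with items⁻ i∈
  ... | sg , k , e , ex , i∈′ with ∈-exampleItems⁻ {sg} {k} {e} i∈′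
  ...   | inj₁ (concept _ _ , _ , ())
  ...   | inj₁ (role _ _ _ , _ , ())
  ...   | inj₂ refl = _ , ex

-- Locating the items of a collection at positions

module Positions (w : List Symbol) where

  v : List Letter
  v = annotate δ q₀ w

  open Semantics {Letter} {3} v public

  K : ℕ → Kind
  K i = maybe kind other (letterAt i)

  sm : ℕ → Summary
  sm zero    = summary [] [] [] 0
  sm (suc i) = absorb (K (suc i)) (sm i)

  -- The reversed name that ends just before a position, and the number of examples completed before it.
  nm : ℕ → Name
  nm zero    = []
  nm (suc i) = current (sm i)

  exNo : ℕ → ℕ
  exNo zero    = 0
  exNo (suc i) = completed (sm i)

  last : ℕ → ℕ
  last zero    = 0
  last (suc i) with K (suc i)
  ... | bitᵏ _ = last i
  ... | _      = suc i

  prev : ℕ → ℕ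
  prev zero    = 0
  prev (suc i) = last i

  -- This eliminates the unbounded summaries: earlier names are those ending at earlier delimiters,
  -- and passing from a delimiter to the previous one is expressible by a formula.
  before-last : ∀ i → before (sm i) ≡ nm (last i) × before² (sm i) ≡ nm (prev (last i))
  before-last zero    = refl , refl
  before-last (suc i) with K (suc i) | before-last i
  ... | bitᵏ _     | p     = p
  ... | conceptᵏ _ | e , _ = refl , e
  ... | roleᵏ _    | e , _ = refl , e
  ... | queryᵏ _   | e , _ = refl , e
  ... | other      | e , _ = refl , e

  stateOf : Letter → State
  stateOf (c , sg , _) = c , sg

  -- Generalised for the induction to a suffix `w′` of the word whose annotated letters follow
  -- position `i`.
  scan-positions : ∀ {item} w′ q i → (∀ j → letterAt (suc (i + j)) ≡ nth nothing (map just (annotate δ q w′)) j) →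
    item ∈ scan (stateOf q) (sm i) w′ ⇔ ∃ λ j → j < length w′ × item ∈ emit (K (suc (i + j))) (sm (i + j))
  scan-positions []       q i at = mk⇔ (λ ()) (λ { (_ , () , _) })
  scan-positions {item} (x ∷ w′) q i at = mk⇔ to from
    where
    K≡ : K (suc i) ≡ kind (δ q x)
    K≡ = cong (maybe kind other) (trans (cong (letterAt ∘ suc) (sym (+-identityʳ i))) (at 0))
    ih : item ∈ scan (stateOf (δ q x)) (sm (suc i)) w′ ⇔ ∃ λ j → j < length w′ × item ∈ emit (K (suc (suc i + j)))
      (sm (suc i + j))
    ih = scan-positions w′ (δ q x) (suc i) λ j → trans (cong (letterAt ∘ suc) (sym (+-suc i j))) (at (suc j))
    to : _ → _
    to i∈ with ∈-++⁻ (emit (kind (δ q x)) (sm i)) i∈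
    ... | inj₁ i∈′ = 0 , z<s , subst₂ (λ K j → item ∈ emit K (sm j))
      (trans (sym K≡) (cong (K ∘ suc) (sym (+-identityʳ i)))) (sym (+-identityʳ i)) i∈′
    ... | inj₂ i∈′ with Equivalence.to ih (subst (λ K → item ∈ scan (stateOf (δ q x)) (absorb K (sm i)) w′) (sym K≡) i∈′)
    ...   | j , j< , i∈″ = suc j , s<s j< , subst (λ j → item ∈ emit (K (suc j)) (sm j)) (sym (+-suc i j)) i∈″
    from : _ → _
    from (zero , _ , i∈′) = ∈-++⁺ˡ (subst₂ (λ K j → item ∈ emit K (sm j)) (trans (cong (K ∘ suc) (+-identityʳ i)) K≡)
      (+-identityʳ i) i∈′)
    from (suc j , s<s j< , i∈′) = ∈-++⁺ʳ (emit (kind (δ q x)) (sm i))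
      (subst (λ K → item ∈ scan (stateOf (δ q x)) (absorb K (sm i)) w′) K≡
      (Equivalence.from ih (j , j< , subst (λ j → item ∈ emit (K (suc j)) (sm j)) (+-suc i j) i∈′)))

  ⟨_⟩ : ℕ → Name
  ⟨ p ⟩ = reverse (nm p)

  data ItemAt (q : ℕ) : Item → Set where
    conceptᵃ : ∀ {sg} → K q ≡ conceptᵏ sg → ItemAt q (conceptᴵ sg (exNo q) ⟨ prev q ⟩ ⟨ q ⟩)
    roleᵃ    : ∀ {sg} → K q ≡ roleᵏ sg → ItemAt q (roleᴵ sg (exNo q) ⟨ prev (prev q) ⟩ ⟨ prev q ⟩ ⟨ q ⟩)
    queryᵃ   : ∀ {sg} → K q ≡ queryᵏ sg → ItemAt q (queryᴵ sg (exNo q) ⟨ prev q ⟩ ⟨ q ⟩)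

  emit⇔ItemAt : ∀ {i item} → item ∈ emit (K (suc i)) (sm i) ⇔ ItemAt (suc i) item
  emit⇔ItemAt {i} {item} = mk⇔ (to (K (suc i)) refl) from
    where
    d = proj₁ (before-last i)
    e = proj₂ (before-last i)
    to : ∀ κ → K (suc i) ≡ κ → item ∈ emit κ (sm i) → ItemAt (suc i) item
    to (conceptᵏ sg) eq (here refl) = subst (λ A → ItemAt (suc i) (conceptᴵ sg (exNo (suc i)) (reverse A) ⟨ suc i ⟩))
      (sym d) (conceptᵃ eq)
    to (roleᵏ sg)    eq (here refl) = subst₂ (λ r a → ItemAt (suc i)
      (roleᴵ sg (exNo (suc i)) (reverse r) (reverse a) ⟨ suc i ⟩)) (sym e) (sym d) (roleᵃ eq)
    to (queryᵏ sg)   eq (here refl) = subst (λ A → ItemAt (suc i) (queryᴵ sg (exNo (suc i)) (reverse A) ⟨ suc i ⟩))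
      (sym d) (queryᵃ eq)
    from : ItemAt (suc i) item → item ∈ emit (K (suc i)) (sm i)
    from (conceptᵃ {sg} eq) rewrite eq = here (cong (λ A → conceptᴵ sg (exNo (suc i)) (reverse A) ⟨ suc i ⟩) (sym d))
    from (roleᵃ {sg} eq)    rewrite eq = here (cong₂ (λ r a → roleᴵ sg (exNo (suc i)) (reverse r) (reverse a) ⟨ suc i
      ⟩) (sym e) (sym d))
    from (queryᵃ {sg} eq)   rewrite eq = here (cong (λ A → queryᴵ sg (exNo (suc i)) (reverse A) ⟨ suc i ⟩) (sym d))

  scanned-items : ∀ {item} → item ∈ scan (between , true) (summary [] [] [] 0) w ⇔ ∃ λ q → q < N × ItemAt q item
  scanned-items {item} = mk⇔ to from
    where
    positions = scan-positions {item} w q₀ 0 (λ _ → refl)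
    to : _ → _
    to i∈ with Equivalence.to positions i∈
    ... | j , j< , i∈′ = suc j , s<s (subst (j <_) (sym (annotate-length δ q₀ w)) j<) , Equivalence.to emit⇔ItemAt i∈′
    from : _ → _
    from (zero , _ , conceptᵃ ())
    from (zero , _ , roleᵃ ())
    from (zero , _ , queryᵃ ())
    from (suc j , s<s j< , at) = Equivalence.from positions (j , subst (j <_) (annotate-length δ q₀ w) j< ,
      Equivalence.from emit⇔ItemAt at)

-- Parsing accepted words

Remaining : Bool → List Symbol → Set
Remaining true  w = ∃₂ λ P N → w ≡ encodeRaws P N
Remaining false w = ∃ λ N → w ≡ concatMap encodeRaw N

RestOfExample RestOfName RestOfFirst RestOfSecond RestOfQuery RestOfQInd : Bool → List Symbol → Set
RestOfQInd    sg w = ∃₂ λ a w′ → w ≡ map bit a ++ rparen ∷ w′ × Remaining sg w′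
RestOfQuery   sg w = ∃₂ λ Q w′ → w ≡ map bit Q ++ lparen ∷ w′ × RestOfQInd sg w′
RestOfExample sg w = ∃₂ λ αs w′ → w ≡ concatMap encodeAssertion αs ++ turnstile ∷ w′ × RestOfQuery sg w′
RestOfSecond  sg w = ∃₂ λ b w′ → w ≡ map bit b ++ rparen ∷ w′ × RestOfExample sg w′
RestOfFirst   sg w = ∃₂ λ a w′ → (w ≡ map bit a ++ rparen ∷ w′ × RestOfExample sg w′) ⊎
  (w ≡ map bit a ++ comma ∷ w′ × RestOfSecond sg w′)
RestOfName    sg w = ∃₂ λ A w′ → w ≡ map bit A ++ lparen ∷ w′ × RestOfFirst sg w′

Rest : Context → Bool → List Symbol → Set
Rest between  = Remaining
Rest afterC   = RestOfExample
Rest afterR   = RestOfExample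
Rest inName   = RestOfName
Rest inFirst  = RestOfFirst
Rest inSecond = RestOfSecond
Rest inQuery  = RestOfQuery
Rest inQInd   = RestOfQInd
Rest invalid  = λ _ _ → ⊥

assertion-rest : ∀ {sg w} → RestOfName sg w → ∃₂ λ α w′ → w ≡ encodeAssertion α ++ w′ × RestOfExample sg w′
assertion-rest (A , _ , refl , a , w′ , inj₁ (refl , rest)) = concept A a , w′ ,
  sym (trans (Listₚ.++-assoc (map bit A) _ w′) (cong (λ u → map bit A ++ lparen ∷ u) (Listₚ.++-assoc (map bit a) _ w′))) , rest
assertion-rest (r , _ , refl , a , _ , inj₂ (refl , b , w′ , refl , rest)) = role r a b , w′ ,
  sym (trans (Listₚ.++-assoc (map bit r) _ w′) (cong (λ u → map bit r ++ lparen ∷ u)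
    (trans (Listₚ.++-assoc (map bit a) _ w′) (cong (λ u → map bit a ++ comma ∷ u) (Listₚ.++-assoc (map bit b) _ w′))))) , rest

example-rest : ∀ {sg w} → RestOfExample sg w → ∃ λ αs → ∃₂ λ q w′ →
  w ≡ (concatMap encodeAssertion αs ++ turnstile ∷ encodeAtom (AQ.queryName q) (AQ.individual q)) ++ w′ × Remaining sg w′
example-rest (αs , _ , refl , Q , _ , refl , a , w′ , refl , rest) = αs , aq Q a , w′ ,
  sym (trans (Listₚ.++-assoc (concatMap encodeAssertion αs) _ w′) (cong (λ u → concatMap encodeAssertion αs ++ turnstile ∷ u)
    (trans (Listₚ.++-assoc (map bit Q) _ w′) (cong (λ u → map bit Q ++ lparen ∷ u) (Listₚ.++-assoc (map bit a) _ w′))))) , rest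

add-example : ∀ sg e {w} → Remaining sg w → Remaining sg (encodeRaw e ++ w)
add-example true  e (P , N , refl) = e ∷ P , N , sym (Listₚ.++-assoc (encodeRaw e) (concatMap encodeRaw P) _)
add-example false e (N , refl)     = e ∷ N , refl

add-assertion : ∀ {sg} α {w} → RestOfExample sg w → RestOfExample sg (encodeAssertion α ++ w)
add-assertion α (αs , w′ , refl , rest) = α ∷ αs , w′ , sym (Listₚ.++-assoc (encodeAssertion α)
  (concatMap encodeAssertion αs) _) , rest

start-example : ∀ {sg w} → RestOfName sg w → Remaining sg w
start-example {sg} r with assertion-rest r
... | α , _ , refl , rest with example-rest rest
...   | αs , q , w′ , refl , remaining = subst (Remaining sg)
  (trans (cong (_++ w′) (Listₚ.++-assoc (encodeAssertion α) _ _)) (Listₚ.++-assoc (encodeAssertion α) _ w′))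
  (add-example sg (α ∷ αs , q) remaining)

continue-example : ∀ {sg w} → RestOfName sg w → RestOfExample sg w
continue-example r with assertion-rest r
... | α , _ , refl , rest = add-assertion α rest

end-invalid : ∀ sg w → proj₁ (end (invalid , sg) w) ≡ invalid
end-invalid sg []      = refl
end-invalid sg (x ∷ w) = end-invalid sg w

-- Recursion on the word in parallel with the automaton. The context `invalid` is never left again,
-- so the clauses that enter it contradict acceptance.
parse : ∀ c sg w → end (c , sg) w ≡ (between , false) → Rest c sg w
parse invalid sg w eq with trans (sym (end-invalid sg w)) (cong proj₁ eq)
... | ()
parse between false [] eq = [] , refl
parse between sg (bit b ∷ w) eq = let (A , w′ , e , r) = parse inName sg w eq in start-example
                                        (b ∷ A , w′ , cong (bit b ∷_) e , r)
parse between sg (lparen ∷ w) eq = start-example ([] , w , refl , parse inFirst sg w eq)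
parse between true (vbar ∷ w) eq = let (N , e) = parse between false w eq in [] , N , cong (vbar ∷_) e
parse between false (vbar ∷ w) eq = ⊥-elim (parse invalid false w eq)
parse between sg (comma ∷ w) eq = ⊥-elim (parse invalid sg w eq)
parse between sg (rparen ∷ w) eq = ⊥-elim (parse invalid sg w eq)
parse between sg (turnstile ∷ w) eq = ⊥-elim (parse invalid sg w eq)
parse afterC sg (bit b ∷ w) eq = let (A , w′ , e , r) = parse inName sg w eq in continue-example
                                       (b ∷ A , w′ , cong (bit b ∷_) e , r)
parse afterC sg (lparen ∷ w) eq = continue-example ([] , w , refl , parse inFirst sg w eq)
parse afterC sg (turnstile ∷ w) eq = [] , w , refl , parse inQuery sg w eq
parse afterC sg (comma ∷ w) eq = ⊥-elim (parse invalid sg w eq)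
parse afterC sg (rparen ∷ w) eq = ⊥-elim (parse invalid sg w eq)
parse afterC sg (vbar ∷ w) eq = ⊥-elim (parse invalid sg w eq)
parse afterR sg (bit b ∷ w) eq = let (A , w′ , e , r) = parse inName sg w eq in continue-example
                                       (b ∷ A , w′ , cong (bit b ∷_) e , r)
parse afterR sg (lparen ∷ w) eq = continue-example ([] , w , refl , parse inFirst sg w eq)
parse afterR sg (turnstile ∷ w) eq = [] , w , refl , parse inQuery sg w eq
parse afterR sg (comma ∷ w) eq = ⊥-elim (parse invalid sg w eq)
parse afterR sg (rparen ∷ w) eq = ⊥-elim (parse invalid sg w eq)
parse afterR sg (vbar ∷ w) eq = ⊥-elim (parse invalid sg w eq)
parse inName sg (bit b ∷ w) eq = let (A , w′ , e , r) = parse inName sg w eq in b ∷ A , w′ , cong (bit b ∷_) e , r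
parse inName sg (lparen ∷ w) eq = [] , w , refl , parse inFirst sg w eq
parse inName sg (comma ∷ w) eq = ⊥-elim (parse invalid sg w eq)
parse inName sg (rparen ∷ w) eq = ⊥-elim (parse invalid sg w eq)
parse inName sg (turnstile ∷ w) eq = ⊥-elim (parse invalid sg w eq)
parse inName sg (vbar ∷ w) eq = ⊥-elim (parse invalid sg w eq)
parse inFirst sg (bit b ∷ w) eq with parse inFirst sg w eq
... | a , w′ , inj₁ (e , r) = b ∷ a , w′ , inj₁ (cong (bit b ∷_) e , r)
... | a , w′ , inj₂ (e , r) = b ∷ a , w′ , inj₂ (cong (bit b ∷_) e , r)
parse inFirst sg (rparen ∷ w) eq = [] , w , inj₁ (refl , parse afterC sg w eq)
parse inFirst sg (comma ∷ w) eq = [] , w , inj₂ (refl , parse inSecond sg w eq)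
parse inFirst sg (lparen ∷ w) eq = ⊥-elim (parse invalid sg w eq)
parse inFirst sg (turnstile ∷ w) eq = ⊥-elim (parse invalid sg w eq)
parse inFirst sg (vbar ∷ w) eq = ⊥-elim (parse invalid sg w eq)
parse inSecond sg (bit b ∷ w) eq = let (a , w′ , e , r) = parse inSecond sg w eq in b ∷ a , w′ , cong (bit b ∷_) e , r
parse inSecond sg (rparen ∷ w) eq = [] , w , refl , parse afterR sg w eq
parse inSecond sg (lparen ∷ w) eq = ⊥-elim (parse invalid sg w eq)
parse inSecond sg (comma ∷ w) eq = ⊥-elim (parse invalid sg w eq)
parse inSecond sg (turnstile ∷ w) eq = ⊥-elim (parse invalid sg w eq)
parse inSecond sg (vbar ∷ w) eq = ⊥-elim (parse invalid sg w eq)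
parse inQuery sg (bit b ∷ w) eq = let (a , w′ , e , r) = parse inQuery sg w eq in b ∷ a , w′ , cong (bit b ∷_) e , r
parse inQuery sg (lparen ∷ w) eq = [] , w , refl , parse inQInd sg w eq
parse inQuery sg (comma ∷ w) eq = ⊥-elim (parse invalid sg w eq)
parse inQuery sg (rparen ∷ w) eq = ⊥-elim (parse invalid sg w eq)
parse inQuery sg (turnstile ∷ w) eq = ⊥-elim (parse invalid sg w eq)
parse inQuery sg (vbar ∷ w) eq = ⊥-elim (parse invalid sg w eq)
parse inQInd sg (bit b ∷ w) eq = let (a , w′ , e , r) = parse inQInd sg w eq in b ∷ a , w′ , cong (bit b ∷_) e , r
parse inQInd sg (rparen ∷ w) eq = [] , w , refl , parse between sg w eq
parse inQInd sg (lparen ∷ w) eq = ⊥-elim (parse invalid sg w eq)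
parse inQInd sg (comma ∷ w) eq = ⊥-elim (parse invalid sg w eq)
parse inQInd sg (turnstile ∷ w) eq = ⊥-elim (parse invalid sg w eq)
parse inQInd sg (vbar ∷ w) eq = ⊥-elim (parse invalid sg w eq)

-- Growing tables become stationary

open Equivalence using (to; from)

infixr 0 _⨟_

_⨟_ : ∀ {a b c} {A : Set a} {B : Set b} {C : Set c} → A ⇔ B → B ⇔ C → A ⇔ C
f ⨟ g = mk⇔ (to g ∘ to f) (from f ∘ from g)

sumTo : (ℕ → ℕ) → ℕ → ℕ
sumTo f zero    = 0
sumTo f (suc k) = f k + sumTo f k

sumTo-mono : ∀ {f g} k → (∀ i → i < k → f i ≤ g i) → sumTo f k ≤ sumTo g k
sumTo-mono zero    le = z≤n
sumTo-mono (suc k) le = +-mono-≤ (le k ≤-refl) (sumTo-mono k λ i i<k → le i (m<n⇒m<1+n i<k))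

sumTo-grows : ∀ {f g} {E : ℕ → Set} k → (∀ i → i < k → E i ⊎ f i < g i) → (∀ i → i < k → f i ≤ g i) →
              (∀ i → i < k → E i) ⊎ sumTo f k < sumTo g k
sumTo-grows zero    step le = inj₁ λ _ ()
sumTo-grows {f} {g} {E} (suc k) step le with step k ≤-refl | sumTo-grows {E = E} k (λ i i<k → step i (m<n⇒m<1+n i<k))
  (λ i i<k → le i (m<n⇒m<1+n i<k))
... | inj₂ fk<gk | _          = inj₂ (+-mono-<-≤ fk<gk (sumTo-mono k λ i i<k → le i (m<n⇒m<1+n i<k)))
... | inj₁ _     | inj₂ f<g   = inj₂ (+-mono-≤-< (le k ≤-refl) f<g)
... | inj₁ ek    | inj₁ es    = inj₁ λ i i<k → split i (m≤n⇒m<n∨m≡n (s≤s⁻¹ i<k))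
  where
  split : ∀ i → i < k ⊎ i ≡ k → E i
  split i (inj₁ i<k)  = es i i<k
  split i (inj₂ refl) = ek

sumTo-bound : ∀ {f c} k → (∀ i → i < k → f i ≤ c) → sumTo f k ≤ k * c
sumTo-bound zero    le = z≤n
sumTo-bound (suc k) le = +-mono-≤ (le k ≤-refl) (sumTo-bound k λ i i<k → le i (m<n⇒m<1+n i<k))

-- A growing sequence of tables of size n is stationary after n * n steps if each table determines the next one.
module Stabilisation (n : ℕ) (A : ℕ → Table)
  (grows : ∀ k x y → x < n → y < n → T (A k x y) → T (A (suc k) x y)) where

  Equal : ℕ → Set
  Equal k = ∀ x → x < n → ∀ y → y < n → A k x y ≡ A (suc k) x y

  weight : Bool → ℕ
  weight b = if b then 1 else 0

  size : ℕ → ℕ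
  size k = sumTo (λ x → sumTo (λ y → weight (A k x y)) n) n

  weight-≤ : ∀ {a b} → (T a → T b) → weight a ≤ weight b
  weight-≤ {false} {b}    f = z≤n
  weight-≤ {true} {true}  f = ≤-refl
  weight-≤ {true} {false} f = ⊥-elim (f tt)

  weight-< : ∀ {a b} → (T a → T b) → a ≡ b ⊎ weight a < weight b
  weight-< {false} {false} f = inj₁ refl
  weight-< {false} {true}  f = inj₂ z<s
  weight-< {true}  {true}  f = inj₁ refl
  weight-< {true}  {false} f = ⊥-elim (f tt)

  equal-or-larger : ∀ k → Equal k ⊎ size k < size (suc k)
  equal-or-larger k = sumTo-grows n
    (λ x x< → sumTo-grows n (λ y y< → weight-< (grows k x y x< y<)) (λ y y< → weight-≤ (grows k x y x< y<)))
    (λ x x< → sumTo-mono n λ y y< → weight-≤ (grows k x y x< y<))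

  size≤ : ∀ k → size k ≤ n * n
  size≤ k = sumTo-bound n λ x x< → ≤-trans (sumTo-bound {c = 1} n λ y y< → weight≤1 (A k x y)) (≤-reflexive (*-identityʳ n))
    where
    weight≤1 : ∀ b → weight b ≤ 1
    weight≤1 true  = ≤-refl
    weight≤1 false = z≤n

  module _ (determined : ∀ k → Equal k → Equal (suc k)) where

    -- Every step that changes the table adds an entry, and a step without change is followed only
    -- by such steps.
    stationary-or-large : ∀ k → Equal k ⊎ k < size (suc k)
    stationary-or-large zero with equal-or-larger 0
    ... | inj₁ e = inj₁ e
    ... | inj₂ l = inj₂ (≤-<-trans z≤n l)
    stationary-or-large (suc k) with stationary-or-large k
    ... | inj₁ e = inj₁ (determined k e)
    ... | inj₂ l with equal-or-larger (suc k)
    ...   | inj₁ e  = inj₁ e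
    ...   | inj₂ l′ = inj₂ (≤-<-trans l l′)

    stationary : Equal (n * n)
    stationary with stationary-or-large (n * n)
    ... | inj₁ e = e
    ... | inj₂ l = contradiction l (≤⇒≯ (size≤ (suc (n * n))))

-- Formulas describing a collection

Fm : ℕ → Set
Fm = Formula Letter 3

pattern apart = 0F
pattern fact  = 1F
pattern bad   = 2F

isBit : Kind → Bool
isBit (bitᵏ _) = true
isBit _        = false

isBitOf isConcept isRole isQuery : Bool → Kind → Bool
isBitOf b (bitᵏ b′) = does (b Bool.≟ b′)
isBitOf b _         = false
isConcept sg (conceptᵏ sg′) = does (sg Bool.≟ sg′)
isConcept sg _              = false
isRole sg (roleᵏ sg′) = does (sg Bool.≟ sg′)
isRole sg _           = false
isQuery sg (queryᵏ sg′) = does (sg Bool.≟ sg′)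
isQuery sg _            = false

T-≟ : ∀ a b → T (does (a Bool.≟ b)) → b ≡ a
T-≟ true  true  _ = refl
T-≟ false false _ = refl

≟-T : ∀ a → T (does (a Bool.≟ a))
≟-T true  = tt
≟-T false = tt

isBitOf⇔ : ∀ {b} κ → T (isBitOf b κ) ⇔ κ ≡ bitᵏ b
isBitOf⇔ {b} (bitᵏ b′)    = mk⇔ (cong bitᵏ ∘ T-≟ b b′) λ { refl → ≟-T b }
isBitOf⇔ (conceptᵏ _) = mk⇔ (λ ()) λ ()
isBitOf⇔ (roleᵏ _)    = mk⇔ (λ ()) λ ()
isBitOf⇔ (queryᵏ _)   = mk⇔ (λ ()) λ ()
isBitOf⇔ other        = mk⇔ (λ ()) λ ()

isConcept⇔ : ∀ {sg} κ → T (isConcept sg κ) ⇔ κ ≡ conceptᵏ sg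
isConcept⇔ {sg} (conceptᵏ sg′) = mk⇔ (cong conceptᵏ ∘ T-≟ sg sg′) λ { refl → ≟-T sg }
isConcept⇔ (bitᵏ _)   = mk⇔ (λ ()) λ ()
isConcept⇔ (roleᵏ _)  = mk⇔ (λ ()) λ ()
isConcept⇔ (queryᵏ _) = mk⇔ (λ ()) λ ()
isConcept⇔ other      = mk⇔ (λ ()) λ ()

isRole⇔ : ∀ {sg} κ → T (isRole sg κ) ⇔ κ ≡ roleᵏ sg
isRole⇔ {sg} (roleᵏ sg′) = mk⇔ (cong roleᵏ ∘ T-≟ sg sg′) λ { refl → ≟-T sg }
isRole⇔ (bitᵏ _)     = mk⇔ (λ ()) λ ()
isRole⇔ (conceptᵏ _) = mk⇔ (λ ()) λ ()
isRole⇔ (queryᵏ _)   = mk⇔ (λ ()) λ ()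
isRole⇔ other        = mk⇔ (λ ()) λ ()

isQuery⇔ : ∀ {sg} κ → T (isQuery sg κ) ⇔ κ ≡ queryᵏ sg
isQuery⇔ {sg} (queryᵏ sg′) = mk⇔ (cong queryᵏ ∘ T-≟ sg sg′) λ { refl → ≟-T sg }
isQuery⇔ (bitᵏ _)     = mk⇔ (λ ()) λ ()
isQuery⇔ (conceptᵏ _) = mk⇔ (λ ()) λ ()
isQuery⇔ (roleᵏ _)    = mk⇔ (λ ()) λ ()
isQuery⇔ other        = mk⇔ (λ ()) λ ()

⊤′ : ∀ {m} → Fm m
⊤′ = ∀′ (zero ≼ zero)

infix 9 _≺_ _≐_

_≺_ _≐_ next same sameEx : ∀ {m} → Fin m → Fin m → Fm m
x ≺ y = ¬′ (y ≼ x)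
x ≐ y = x ≼ y ∧′ y ≼ x
-- The second alternative makes position 0 its own predecessor, in agreement with `prev`.
next p q = (p ≺ q ∧′ ¬′ letter (isBit ∘ kind) p ∧′ ∀′ (suc p ≺ zero ∧′ zero ≺ suc q ⇒′ letter (isBit ∘ kind) zero))
        ∨′ (∀′ (suc q ≼ zero) ∧′ p ≼ q)
same x y = ¬′ rel apart x y
-- An example ends where its query closes, so two positions share an example iff no such end
-- separates them.
sameEx x y = ∀′ (letter (isQuery true ∘ kind) zero ∨′ letter (isQuery false ∘ kind) zero ⇒′
  (suc x ≼ zero ⇒′ suc y ≼ zero) ∧′ (suc y ≼ zero ⇒′ suc x ≼ zero))

at-prev : ∀ {m} → Fin m → Fm (suc m) → Fm m
at-prev q φ = ∃′ (next zero (suc q) ∧′ φ)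

-- The variables bound are, from 0 on, the positions of the names and the individuals, ending with the closing parenthesis.
∃concept ∀concept ∃query ∀query ∃ind ∀ind : ∀ {m} → Bool → Fm (2 + m) → Fm m
∃role ∀role : ∀ {m} → Bool → Fm (3 + m) → Fm m
∃concept sg φ = ∃′ (letter (isConcept sg ∘ kind) zero ∧′ at-prev zero φ)
∀concept sg φ = ∀′ (letter (isConcept sg ∘ kind) zero ⇒′ at-prev zero φ)
∃query sg φ   = ∃′ (letter (isQuery sg ∘ kind) zero ∧′ at-prev zero φ)
∀query sg φ   = ∀′ (letter (isQuery sg ∘ kind) zero ⇒′ at-prev zero φ)
∃role sg φ    = ∃′ (letter (isRole sg ∘ kind) zero ∧′ at-prev zero (at-prev zero φ))
∀role sg φ    = ∀′ (letter (isRole sg ∘ kind) zero ⇒′ at-prev zero (at-prev zero φ))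

-- The name of an individual ends at the closing parenthesis or, for the first argument of a role,
-- at the delimiter before it.
occurs : ∀ {m} → Bool → Fin m → Fin m → Fm m
occurs sg z q = (letter (isConcept sg ∘ kind) q ∨′ letter (isRole sg ∘ kind) q) ∧′ z ≐ q
             ∨′ letter (isRole sg ∘ kind) q ∧′ next z q

-- Variable 0 is an occurrence of an individual in the assertion closed at variable 1.
∃ind sg φ = ∃′ (∃′ (occurs sg zero (suc zero) ∧′ φ))
∀ind sg φ = ∀′ (∀′ (occurs sg zero (suc zero) ⇒′ φ))

-- Correctness of the describing formulas

module Reading (w : List Symbol) where
  open Positions w

  letter⇔ : ∀ {g : Kind → Bool} i → g other ≡ false → T (maybe (g ∘ kind) false (letterAt i)) ⇔ T (g (K i))
  letter⇔ i g-other with letterAt i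
  ... | just _  = ⇔-id _
  ... | nothing = mk⇔ (λ ()) (subst T g-other)

  Bit : ℕ → Set
  Bit i = T (isBit (K i))

  last-spec : ∀ i → ¬ Bit (last i) × last i ≤ i × (∀ j → last i < j → j ≤ i → Bit j)
  last-spec zero = (λ ()) , z≤n , λ { (suc _) _ () }
  last-spec (suc i) with K (suc i) in eq | last-spec i
  ... | bitᵏ b | ¬b , ≤i , bits = ¬b , m≤n⇒m≤1+n ≤i , λ j l< j≤ → below j l< (m≤n⇒m<n∨m≡n j≤)
    where
    below : ∀ j → last i < j → j < suc i ⊎ j ≡ suc i → Bit j
    below j l< (inj₁ j<)   = bits j l< (s≤s⁻¹ j<)
    below j l< (inj₂ refl) = subst (T ∘ isBit) (sym eq) tt
  ... | conceptᵏ _ | _ = subst (T ∘ isBit) eq , ≤-refl , λ j l< j≤ → contradiction l< (≤⇒≯ j≤)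
  ... | roleᵏ _    | _ = subst (T ∘ isBit) eq , ≤-refl , λ j l< j≤ → contradiction l< (≤⇒≯ j≤)
  ... | queryᵏ _   | _ = subst (T ∘ isBit) eq , ≤-refl , λ j l< j≤ → contradiction l< (≤⇒≯ j≤)
  ... | other      | _ = subst (T ∘ isBit) eq , ≤-refl , λ j l< j≤ → contradiction l< (≤⇒≯ j≤)

  last-unique : ∀ {i p} → p ≤ i → ¬ Bit p → (∀ j → p < j → j ≤ i → Bit j) → p ≡ last i
  last-unique {i} {p} p≤i ¬b bits with last-spec i | <-cmp p (last i)
  ... | ¬b′ , ≤i , _    | tri< p<l _ _ = contradiction (bits (last i) p<l ≤i) ¬b′
  ... | _               | tri≈ _ p≡l _ = p≡l
  ... | _ , _ , bits′   | tri> _ _ l<p = contradiction (bits′ p l<p p≤i) ¬b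

  prev≤ : ∀ q → prev q ≤ q
  prev≤ zero    = z≤n
  prev≤ (suc i) = m≤n⇒m≤1+n (proj₁ (proj₂ (last-spec i)))

  prev<N : ∀ {q} → q < N → prev q < N
  prev<N {q} = ≤-<-trans (prev≤ q)

  BitAt : ℕ → Set
  BitAt i = T (maybe (isBit ∘ kind) false (letterAt i))

  prev⇔ : ∀ p q → q < N →
    ((¬ q ≤ p × ¬ BitAt p × (∀ j → j < N → (¬ j ≤ p) × (¬ q ≤ j) → BitAt j)) ⊎ (∀ j → j < N → q ≤ j) × p ≤ q) ⇔ p ≡ prev q
  prev⇔ p zero _ = mk⇔
    (λ { (inj₁ (p<0 , _)) → contradiction z≤n p<0 ; (inj₂ (_ , p≤0)) → n≤0⇒n≡0 p≤0 })
    (λ e → inj₂ ((λ _ _ → z≤n) , ≤-reflexive e))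
  prev⇔ p (suc i) i<N = mk⇔
    (λ { (inj₁ (p<q , ¬b , bits)) → last-unique (s≤s⁻¹ (≰⇒> p<q)) (¬b ∘ from (letter⇔ {isBit} p refl))
           λ j p<j j≤i → to (letter⇔ {isBit} j refl) (bits j (≤-<-trans j≤i (<⇒≤ i<N)) (<⇒≱ p<j , <⇒≱ (s≤s j≤i)))
       ; (inj₂ (least , _)) → contradiction (least 0 z<s) λ () })
    (λ e → let (¬b , l≤i , bits) = last-spec i in
      inj₁ (<⇒≱ (s≤s (subst (_≤ i) (sym e) l≤i)) , (λ b → ¬b (subst Bit e (to (letter⇔ {isBit} p refl) b))) ,
        λ j _ (¬j≤p , ¬si≤j) → from (letter⇔ {isBit} j refl) (bits j (subst (_< j) e (≰⇒> ¬j≤p)) (s≤s⁻¹ (≰⇒> ¬si≤j)))))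

  next⇔ : ∀ {m} σ (ρ : Vec ℕ m) {p q} → Vec.lookup ρ q < N → ⟦ next p q ⟧ᶠ σ ρ ⇔ Vec.lookup ρ p ≡ prev (Vec.lookup ρ q)
  next⇔ σ ρ {p} {q} = prev⇔ (Vec.lookup ρ p) (Vec.lookup ρ q)

  at-prev⇔ : ∀ {m} σ (ρ : Vec ℕ m) {q} φ → Vec.lookup ρ q < N → ⟦ at-prev q φ ⟧ᶠ σ ρ ⇔ ⟦ φ ⟧ᶠ σ (prev (Vec.lookup ρ q) ∷ ρ)
  at-prev⇔ σ ρ {q} φ q<N = mk⇔
    (λ { (p , p<N , n , h) → subst (λ p → ⟦ φ ⟧ᶠ σ (p ∷ ρ)) (to (next⇔ σ (p ∷ ρ) {zero} {suc q} q<N) n) h })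
    (λ h → _ , prev<N q<N , from (next⇔ σ (_ ∷ ρ) {zero} {suc q} q<N) refl , h)

  completed-mono : ∀ {i j} → i ≤ j → completed (sm i) ≤ completed (sm j)
  completed-mono {i} {j} i≤j with m≤n⇒m<n∨m≡n i≤j
  ... | inj₂ refl = ≤-refl
  completed-mono {i} {suc j} _ | inj₁ i<sj = ≤-trans (completed-mono (s≤s⁻¹ i<sj)) step
    where
    step : completed (sm j) ≤ completed (sm (suc j))
    step with K (suc j)
    ... | bitᵏ _     = ≤-refl
    ... | conceptᵏ _ = ≤-refl
    ... | roleᵏ _    = ≤-refl
    ... | queryᵏ _   = n≤1+n _
    ... | other      = ≤-refl

  Closing : ℕ → Set
  Closing e = ∃ λ sg → K e ≡ queryᵏ sg

  completed-closing : ∀ {e sg} → K (suc e) ≡ queryᵏ sg → completed (sm (suc e)) ≡ suc (completed (sm e))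
  completed-closing eq rewrite eq = refl

  closing-between : ∀ {i j} → i ≤ j → completed (sm i) < completed (sm j) → ∃ λ e → i < e × e ≤ j × Closing e
  closing-between {i} {j} i≤j lt with m≤n⇒m<n∨m≡n i≤j
  ... | inj₂ refl = contradiction lt (<-irrefl refl)
  closing-between {i} {suc j} _ lt | inj₁ i<sj with K (suc j) in eq
  ... | queryᵏ sg  = suc j , i<sj , ≤-refl , sg , eq
  ... | bitᵏ _     = let (e , l , u , c) = closing-between (s≤s⁻¹ i<sj) lt in e , l , m≤n⇒m≤1+n u , c
  ... | conceptᵏ _ = let (e , l , u , c) = closing-between (s≤s⁻¹ i<sj) lt in e , l , m≤n⇒m≤1+n u , c
  ... | roleᵏ _    = let (e , l , u , c) = closing-between (s≤s⁻¹ i<sj) lt in e , l , m≤n⇒m≤1+n u , c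
  ... | other      = let (e , l , u , c) = closing-between (s≤s⁻¹ i<sj) lt in e , l , m≤n⇒m≤1+n u , c

  exNo-< : ∀ {x y} → exNo x < exNo y → ∃ λ e → x ≤ e × e < y × Closing e
  exNo-< {zero} {suc j} lt = let (e , _ , e≤j , c) = closing-between {0} {j} z≤n lt in e , z≤n , s≤s e≤j , c
  exNo-< {suc i} {suc j} lt with ≤-total i j
  ... | inj₁ i≤j = let (e , i<e , e≤j , c) = closing-between i≤j lt in e , i<e , s≤s e≤j , c
  ... | inj₂ j≤i = contradiction lt (≤⇒≯ (completed-mono j≤i))

  exNo-separated : ∀ {x y e} → Closing e → x ≤ e → e < y → exNo x < exNo y
  exNo-separated {x} {suc j} {zero}  (_ , ()) _ _
  exNo-separated {zero} {suc j} {suc e} (_ , eq) x≤e (s≤s e≤j) =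
    ≤-trans (≤-<-trans z≤n (≤-reflexive (sym (completed-closing eq)))) (completed-mono e≤j)
  exNo-separated {suc i} {suc j} {suc e} (_ , eq) (s≤s i≤e) (s≤s e≤j) =
    ≤-trans (≤-trans (s≤s (completed-mono i≤e)) (≤-reflexive (sym (completed-closing eq)))) (completed-mono e≤j)

  -- Different numbers are witnessed by a query closing in between (`exNo-<`); conversely, a closing
  -- query raises the number (`exNo-separated`).
  sameEx⇔ : ∀ {m} σ (ρ : Vec ℕ m) {x y} → Vec.lookup ρ x < N → Vec.lookup ρ y < N →
    ⟦ sameEx x y ⟧ᶠ σ ρ ⇔ exNo (Vec.lookup ρ x) ≡ exNo (Vec.lookup ρ y)
  sameEx⇔ σ ρ {x} {y} x<N y<N = mk⇔ forth back
    where
    a = Vec.lookup ρ x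
    b = Vec.lookup ρ y
    query : ∀ e → Closing e → T (maybe (isQuery true ∘ kind) false (letterAt e)) ⊎ T
      (maybe (isQuery false ∘ kind) false (letterAt e))
    query e (true , eq)  = inj₁ (from (letter⇔ {isQuery true} e refl) (from (isQuery⇔ (K e)) eq))
    query e (false , eq) = inj₂ (from (letter⇔ {isQuery false} e refl) (from (isQuery⇔ (K e)) eq))
    closing : ∀ e → T (maybe (isQuery true ∘ kind) false (letterAt e)) ⊎ T
      (maybe (isQuery false ∘ kind) false (letterAt e)) → Closing e
    closing e (inj₁ t) = true , to (isQuery⇔ (K e)) (to (letter⇔ {isQuery true} e refl) t)
    closing e (inj₂ t) = false , to (isQuery⇔ (K e)) (to (letter⇔ {isQuery false} e refl) t)
    forth : ⟦ sameEx x y ⟧ᶠ σ ρ → exNo a ≡ exNo b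
    forth h with <-cmp (exNo a) (exNo b)
    ... | tri≈ _ e _ = e
    ... | tri< lt _ _ = let (e , a≤e , e<b , c) = exNo-< lt in contradiction
                              (proj₁ (h e (<-trans e<b y<N) (query e c)) a≤e) (<⇒≱ e<b)
    ... | tri> _ _ gt = let (e , b≤e , e<a , c) = exNo-< gt in contradiction
                              (proj₂ (h e (<-trans e<a x<N) (query e c)) b≤e) (<⇒≱ e<a)
    back : exNo a ≡ exNo b → ⟦ sameEx x y ⟧ᶠ σ ρ
    back e c c<N q = (λ a≤c → ≮⇒≥ λ c<b → <-irrefl e (exNo-separated (closing c q) a≤c c<b)) ,
                     (λ b≤c → ≮⇒≥ λ c<a → <-irrefl (sym e) (exNo-separated (closing c q) b≤c c<a))

  module Encoded (L : DL) (P N′ : List Raw) (encoded : w ≡ encodeRaws P N′) where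

    open Fitting L P N′

    positions : ∀ {item} → item ∈ items P N′ ⇔ ∃ λ q → q < N × ItemAt q item
    positions {item} = mk⇔
      (to scanned-items ∘ subst (item ∈_) (sym scanned-encoding))
      (subst (item ∈_) scanned-encoding ∘ from scanned-items)
      where
      scanned-encoding : scan (between , true) (summary [] [] [] 0) w ≡ items P N′
      scanned-encoding = trans (cong (scan (between , true) (summary [] [] [] 0)) encoded) (scan-encoding P N′)

    has-concept : ∀ {sg q} → q < N → K q ≡ conceptᵏ sg → Has sg (exNo q) (concept ⟨ prev q ⟩ ⟨ q ⟩)
    has-concept q<N eq = has⁻ L P N′ (from positions (_ , q<N , conceptᵃ eq))

    has-role : ∀ {sg q} → q < N → K q ≡ roleᵏ sg → Has sg (exNo q) (role ⟨ prev (prev q) ⟩ ⟨ prev q ⟩ ⟨ q ⟩)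
    has-role q<N eq = has⁻ L P N′ (from positions (_ , q<N , roleᵃ eq))

    has-query : ∀ {sg q} → q < N → K q ≡ queryᵏ sg → Query sg (exNo q) ⟨ prev q ⟩ ⟨ q ⟩
    has-query q<N eq = query⁻ L P N′ (from positions (_ , q<N , queryᵃ eq))

    -- The motive is explicit because the names at a position are computed, so users cannot match on
    -- an equation between them and given names.
    concept-at : ∀ {sg k A a} (C : ℕ → N-C → N-I → Set) → Has sg k (concept A a) →
      (∀ q → q < N → K q ≡ conceptᵏ sg → C (exNo q) ⟨ prev q ⟩ ⟨ q ⟩) → C k A a
    concept-at C has f with to positions (has⁺ L P N′ has)
    ... | q , q<N , conceptᵃ eq = f q q<N eq

    role-at : ∀ {sg k r a b} (C : ℕ → N-R → N-I → N-I → Set) → Has sg k (role r a b) →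
      (∀ q → q < N → K q ≡ roleᵏ sg → C (exNo q) ⟨ prev (prev q) ⟩ ⟨ prev q ⟩ ⟨ q ⟩) → C k r a b
    role-at C has f with to positions (has⁺ L P N′ has)
    ... | q , q<N , roleᵃ eq = f q q<N eq

    query-at : ∀ {sg k Q a} (C : ℕ → N-C → N-I → Set) → Query sg k Q a →
      (∀ q → q < N → K q ≡ queryᵏ sg → C (exNo q) ⟨ prev q ⟩ ⟨ q ⟩) → C k Q a
    query-at C has f with to positions (query⁺ L P N′ has)
    ... | q , q<N , queryᵃ eq = f q q<N eq

    module _ {m} (σ : Tables) (ρ : Vec ℕ m) where

      isConceptAt : ∀ {sg} q → T (maybe (isConcept sg ∘ kind) false (letterAt q)) ⇔ K q ≡ conceptᵏ sg
      isConceptAt {sg} q = letter⇔ {isConcept sg} q refl ⨟ isConcept⇔ (K q)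

      isRoleAt : ∀ {sg} q → T (maybe (isRole sg ∘ kind) false (letterAt q)) ⇔ K q ≡ roleᵏ sg
      isRoleAt {sg} q = letter⇔ {isRole sg} q refl ⨟ isRole⇔ (K q)

      isQueryAt : ∀ {sg} q → T (maybe (isQuery sg ∘ kind) false (letterAt q)) ⇔ K q ≡ queryᵏ sg
      isQueryAt {sg} q = letter⇔ {isQuery sg} q refl ⨟ isQuery⇔ (K q)

      at² : ∀ {q} φ → q < N → ⟦ at-prev zero (at-prev zero φ) ⟧ᶠ σ (q ∷ ρ) ⇔ ⟦ φ ⟧ᶠ σ (prev (prev q) ∷ prev q ∷ q ∷ ρ)
      at² {q} φ q<N = at-prev⇔ σ (q ∷ ρ) {zero} (at-prev zero φ) q<N ⨟ at-prev⇔ σ (prev q ∷ q ∷ ρ) {zero} φ (prev<N q<N)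

      -- Quantifying over closing parentheses amounts to quantifying over assertions as soon as the
      -- matrix depends on the names and the number of the example only. The equivalences below
      -- follow the same scheme.
      ∃concept⇔ : ∀ sg φ (Φ : ℕ → N-C → N-I → Set) →
        (∀ q → q < N → ⟦ φ ⟧ᶠ σ (prev q ∷ q ∷ ρ) ⇔ Φ (exNo q) ⟨ prev q ⟩ ⟨ q ⟩) →
        ⟦ ∃concept sg φ ⟧ᶠ σ ρ ⇔ (∃ λ k → ∃₂ λ A a → Has sg k (concept A a) × Φ k A a)
      ∃concept⇔ sg φ Φ φ⇔ = mk⇔
        (λ { (q , q<N , l , h) → _ , _ , _ , has-concept q<N (to (isConceptAt q) l) , to (φ⇔ q q<N)
          (to (at-prev⇔ σ (q ∷ ρ) {zero} φ q<N) h) })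
        (λ { (k , A , a , has , h) → concept-at (λ k A a → Φ k A a → ⟦ ∃concept sg φ ⟧ᶠ σ ρ) has
               (λ q q<N eq h → q , q<N , from (isConceptAt q) eq , from (at-prev⇔ σ (q ∷ ρ) {zero} φ q<N)
                 (from (φ⇔ q q<N) h)) h })

      ∀concept⇔ : ∀ sg φ (Φ : ℕ → N-C → N-I → Set) →
        (∀ q → q < N → ⟦ φ ⟧ᶠ σ (prev q ∷ q ∷ ρ) ⇔ Φ (exNo q) ⟨ prev q ⟩ ⟨ q ⟩) →
        ⟦ ∀concept sg φ ⟧ᶠ σ ρ ⇔ (∀ {k A a} → Has sg k (concept A a) → Φ k A a)
      ∀concept⇔ sg φ Φ φ⇔ = mk⇔
        (λ all {k} {A} {a} has → concept-at Φ has λ q q<N eq → to (φ⇔ q q<N)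
          (to (at-prev⇔ σ (q ∷ ρ) {zero} φ q<N) (all q q<N (from (isConceptAt q) eq))))
        (λ all q q<N l → from (at-prev⇔ σ (q ∷ ρ) {zero} φ q<N) (from (φ⇔ q q<N) (all (has-concept q<N (to (isConceptAt q) l)))))

      ∃role⇔ : ∀ sg φ (Φ : ℕ → N-R → N-I → N-I → Set) →
        (∀ q → q < N → ⟦ φ ⟧ᶠ σ (prev (prev q) ∷ prev q ∷ q ∷ ρ) ⇔ Φ (exNo q) ⟨ prev (prev q) ⟩ ⟨ prev q ⟩ ⟨ q ⟩) →
        ⟦ ∃role sg φ ⟧ᶠ σ ρ ⇔ (∃₂ λ k r → ∃₂ λ a b → Has sg k (role r a b) × Φ k r a b)
      ∃role⇔ sg φ Φ φ⇔ = mk⇔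
        (λ { (q , q<N , l , h) → _ , _ , _ , _ , has-role q<N (to (isRoleAt q) l) , to (φ⇔ q q<N) (to (at² φ q<N) h) })
        (λ { (k , r , a , b , has , h) → role-at (λ k r a b → Φ k r a b → ⟦ ∃role sg φ ⟧ᶠ σ ρ) has
               (λ q q<N eq h → q , q<N , from (isRoleAt q) eq , from (at² φ q<N) (from (φ⇔ q q<N) h)) h })

      ∀role⇔ : ∀ sg φ (Φ : ℕ → N-R → N-I → N-I → Set) →
        (∀ q → q < N → ⟦ φ ⟧ᶠ σ (prev (prev q) ∷ prev q ∷ q ∷ ρ) ⇔ Φ (exNo q) ⟨ prev (prev q) ⟩ ⟨ prev q ⟩ ⟨ q ⟩) →
        ⟦ ∀role sg φ ⟧ᶠ σ ρ ⇔ (∀ {k r a b} → Has sg k (role r a b) → Φ k r a b)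
      ∀role⇔ sg φ Φ φ⇔ = mk⇔
        (λ all {k} {r} {a} {b} has → role-at Φ has λ q q<N eq → to (φ⇔ q q<N) (to (at² φ q<N) (all q q<N (from (isRoleAt q) eq))))
        (λ all q q<N l → from (at² φ q<N) (from (φ⇔ q q<N) (all (has-role q<N (to (isRoleAt q) l)))))

      ∃query⇔ : ∀ sg φ (Φ : ℕ → N-C → N-I → Set) →
        (∀ q → q < N → ⟦ φ ⟧ᶠ σ (prev q ∷ q ∷ ρ) ⇔ Φ (exNo q) ⟨ prev q ⟩ ⟨ q ⟩) →
        ⟦ ∃query sg φ ⟧ᶠ σ ρ ⇔ (∃ λ k → ∃₂ λ Q a → Query sg k Q a × Φ k Q a)
      ∃query⇔ sg φ Φ φ⇔ = mk⇔
        (λ { (q , q<N , l , h) → _ , _ , _ , has-query q<N (to (isQueryAt q) l) , to (φ⇔ q q<N)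
          (to (at-prev⇔ σ (q ∷ ρ) {zero} φ q<N) h) })
        (λ { (k , Q , a , has , h) → query-at (λ k Q a → Φ k Q a → ⟦ ∃query sg φ ⟧ᶠ σ ρ) has
               (λ q q<N eq h → q , q<N , from (isQueryAt q) eq , from (at-prev⇔ σ (q ∷ ρ) {zero} φ q<N) (from (φ⇔ q q<N) h)) h })

      ∀query⇔ : ∀ sg φ (Φ : ℕ → N-C → N-I → Set) →
        (∀ q → q < N → ⟦ φ ⟧ᶠ σ (prev q ∷ q ∷ ρ) ⇔ Φ (exNo q) ⟨ prev q ⟩ ⟨ q ⟩) →
        ⟦ ∀query sg φ ⟧ᶠ σ ρ ⇔ (∀ {k Q a} → Query sg k Q a → Φ k Q a)
      ∀query⇔ sg φ Φ φ⇔ = mk⇔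
        (λ all {k} {Q} {a} has → query-at Φ has λ q q<N eq → to (φ⇔ q q<N)
          (to (at-prev⇔ σ (q ∷ ρ) {zero} φ q<N) (all q q<N (from (isQueryAt q) eq))))
        (λ all q q<N l → from (at-prev⇔ σ (q ∷ ρ) {zero} φ q<N) (from (φ⇔ q q<N) (all (has-query q<N (to (isQueryAt q) l)))))

      occurs⇒Ind : ∀ {sg z q} → q < N → ⟦ occurs sg zero (suc zero) ⟧ᶠ σ (z ∷ q ∷ ρ) → Ind sg (exNo q) ⟨ z ⟩
      occurs⇒Ind {sg} {z} {q} q<N (inj₁ (l , z≤q , q≤z)) with ≤-antisym z≤q q≤z
      ... | refl with l
      ...   | inj₁ c = _ , has-concept q<N (to (isConceptAt q) c) , conc
      ...   | inj₂ r = _ , has-role q<N (to (isRoleAt q) r) , second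
      occurs⇒Ind {sg} {z} {q} q<N (inj₂ (r , n)) with to (next⇔ σ (z ∷ q ∷ ρ) {zero} {suc zero} q<N) n
      ... | refl = _ , has-role q<N (to (isRoleAt q) r) , first

      Ind⇒occurs : ∀ {sg k x} (C : ℕ → N-I → Set) → Ind sg k x →
        (∀ q z → q < N → z < N → ⟦ occurs sg zero (suc zero) ⟧ᶠ σ (z ∷ q ∷ ρ) → C (exNo q) ⟨ z ⟩) → C k x
      Ind⇒occurs C (concept A a , has , conc) f = concept-at (λ k _ a → C k a) has λ q q<N eq →
        f q q q<N q<N (inj₁ (inj₁ (from (isConceptAt q) eq) , ≤-refl , ≤-refl))
      Ind⇒occurs C (role r a b , has , first) f = role-at (λ k _ a _ → C k a) has λ q q<N eq →
        f q (prev q) q<N (prev<N q<N) (inj₂ (from (isRoleAt q) eq , from (next⇔ σ (prev q ∷ q ∷ ρ) {zero} {suc zero} q<N) refl))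
      Ind⇒occurs C (role r a b , has , second) f = role-at (λ k _ _ b → C k b) has λ q q<N eq →
        f q q q<N q<N (inj₁ (inj₂ (from (isRoleAt q) eq) , ≤-refl , ≤-refl))

      ∃ind⇔ : ∀ sg φ (Φ : ℕ → N-I → Set) →
        (∀ q z → q < N → z < N → ⟦ φ ⟧ᶠ σ (z ∷ q ∷ ρ) ⇔ Φ (exNo q) ⟨ z ⟩) →
        ⟦ ∃ind sg φ ⟧ᶠ σ ρ ⇔ (∃₂ λ k x → Ind sg k x × Φ k x)
      ∃ind⇔ sg φ Φ φ⇔ = mk⇔
        (λ { (q , q<N , z , z<N , o , h) → _ , _ , occurs⇒Ind q<N o , to (φ⇔ q z q<N z<N) h })
        (λ { (k , x , i , h) → Ind⇒occurs (λ k x → Φ k x → ⟦ ∃ind sg φ ⟧ᶠ σ ρ) i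
               (λ q z q<N z<N o h → q , q<N , z , z<N , o , from (φ⇔ q z q<N z<N) h) h })

      ∀ind⇔ : ∀ sg φ (Φ : ℕ → N-I → Set) →
        (∀ q z → q < N → z < N → ⟦ φ ⟧ᶠ σ (z ∷ q ∷ ρ) ⇔ Φ (exNo q) ⟨ z ⟩) →
        ⟦ ∀ind sg φ ⟧ᶠ σ ρ ⇔ (∀ {k x} → Ind sg k x → Φ k x)
      ∀ind⇔ sg φ Φ φ⇔ = mk⇔
        (λ all {k} {x} i → Ind⇒occurs Φ i λ q z q<N z<N o → to (φ⇔ q z q<N z<N) (all q q<N z z<N o))
        (λ all q q<N z z<N o → from (φ⇔ q z q<N z<N) (all (occurs⇒Ind q<N o)))

-- The program for fitting and its acceptance condition

iterate-* : ∀ {A : Set} (f : A → A) x m n → iterate (λ x → iterate f x n) x m ≡ iterate f x (m * n)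
iterate-* f x zero    n = refl
iterate-* f x (suc m) n = trans (iterate-* f (iterate f x n) m n) (sym (iterate-+ f x n (m * n)))

T-does : ∀ {P : Set} (d : Dec P) → T (does d) ⇔ P
T-does (yes p) = mk⇔ (λ _ → p) _
T-does (no ¬p) = mk⇔ (λ ()) ¬p

successor bit₌ : ∀ {m} → Fin m → Fin m → Fm m
successor p q = p ≺ q ∧′ ∀′ (zero ≼ suc p ∨′ suc q ≼ zero)
bit₌ x y = letter (isBitOf true ∘ kind) x ∧′ letter (isBitOf true ∘ kind) y
        ∨′ letter (isBitOf false ∘ kind) x ∧′ letter (isBitOf false ∘ kind) y

after-bit : ∀ {m} → Fin m → Fm m
after-bit x = ∃′ (successor zero (suc x) ∧′ letter (isBit ∘ kind) zero)

-- Equality of the names ending before x and y, in terms of the positions before x and y.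
same-names : Fm 2
same-names = ¬′ after-bit 1F ∧′ ¬′ after-bit 0F
          ∨′ ∃′ (∃′ (successor 1F 3F ∧′ successor 0F 2F ∧′ bit₌ 1F 0F ∧′ ¬′ rel apart 1F 0F))

only-if : ∀ {m} → Bool → Fm m → Fm m
only-if true  φ = φ
only-if false φ = ⊤′

initially : Fm 2
initially = ∃concept false (same 0F 3F ∧′ same 1F 2F)

concept-step : Fm 4
concept-step = same 1F 3F ⇒′ rel fact 0F 2F

forward-match backward-match : Fm 8
forward-match  = same 0F 3F ∧′ same 1F 6F ∧′ ¬′ rel bad 5F 2F
backward-match = same 0F 3F ∧′ same 2F 6F ∧′ ¬′ rel bad 4F 1F

forward-step backward-step : Fm 5
forward-step  = same 1F 4F ⇒′ ∃role false forward-match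
backward-step = same 2F 4F ⇒′ ∃role false backward-match

local : DL → Fm 2
local L = ∀concept true concept-step ∧′ ∀role true forward-step ∧′ only-if (admits-inverse L) (∀role true backward-step)

simulated : ∀ {m} → Fin m → Fm m
simulated x = ∃ind false (¬′ rel bad (suc (suc x)) 0F)

consistent : Fm 4
consistent = ∀ind true (sameEx 1F 3F ⇒′ simulated 0F)

fires : DL → Fm 2
fires L = ∃ind false (same 0F 2F) ∧′ ∃query true (same 0F 3F ∧′ ¬′ rel bad 1F 2F ∧′ only-if (admits-⊥ L) consistent)

-- Each assignment keeps the old entries, so the tables grow and must become stationary.
refine derive : ∀ {l} → DL → Program Letter 3 l
refine L = bad ≔ rel bad 1F 0F ∨′ ¬′ local L
derive L = fact ≔ rel fact 1F 0F ∨′ fires L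

distinguish : ∀ {l} → Program Letter 3 l
distinguish = apart ≔ rel apart 1F 0F ∨′ ¬′ same-names

-- Facts derived in the last round may admit pairs excluded before, so the simulation is recomputed
-- from the full relation.
round : DL → Program Letter 3 2
round L = (bad ≔ ¬′ ⊤′) ⨾ loop (loop (refine L)) ⨾ derive L

-- The table apart collects the pairs of different names, bad the pairs in no simulation, and fact the derived facts.
fitting : DL → Program Letter 3 4
fitting L = loop (loop distinguish) ⨾ (fact ≔ initially) ⨾ loop (loop (round L))

isFinal : Letter → Bool
isFinal (between , false , _) = true
isFinal _                     = false

-- The state of the automaton after the whole word is read off at the greatest position. The empty
-- word is rejected, as position 0 carries no letter.
syntax-valid : Fm 0
syntax-valid = ∃′ (letter isFinal 0F ∧′ ∀′ (0F ≼ 1F))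

query-valid : Bool → Fm 0
query-valid sg = ∀query sg (∃ind sg (sameEx 1F 3F ∧′ same 0F 3F))

disjoint-valid : Bool → Bool → Fm 0
disjoint-valid sg sg′ = ∀ind sg (∀ind sg′ (same 2F 0F ⇒′ sameEx 3F 1F))

accepting : Fm 0
accepting = syntax-valid ∧′ (query-valid true ∧′ query-valid false)
         ∧′ ((disjoint-valid true true ∧′ disjoint-valid true false) ∧′ (disjoint-valid false true ∧′ disjoint-valid false false))
         ∧′ ¬′ ∃query false (rel fact 0F 1F)

-- Correctness of the program

module Running (w : List Symbol) where
  open Positions w
  open Reading w

  M : ℕ
  M = N * N

  only-if⇔ : ∀ {m} β (φ : Fm m) {σ ρ} {Φ : Set} → ⟦ φ ⟧ᶠ σ ρ ⇔ Φ → ⟦ only-if β φ ⟧ᶠ σ ρ ⇔ (T β → Φ)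
  only-if⇔ true  φ e = mk⇔ (λ h _ → to e h) (λ f → from e (f tt))
  only-if⇔ false φ e = mk⇔ (λ _ ()) (λ _ _ _ → ≤-refl)

  ≔-⇔ : ∀ {t σ} (φ : Fm 2) x y → T (run {l = 0} (t ≔ φ) σ t x y) ⇔ ⟦ φ ⟧ᶠ σ (y ∷ x ∷ [])
  ≔-⇔ {t} {σ} φ x y = mk⇔
    (to (T-does (decide φ σ (y ∷ x ∷ []))) ∘ subst T (cong (λ A → A x y) (↦-same σ t _)))
    (subst T (sym (cong (λ A → A x y) (↦-same σ t _))) ∘ from (T-does (decide φ σ (y ∷ x ∷ []))))

  loops : ∀ {l} (P : Program Letter 3 l) σ → run (loop (loop P)) σ ≡ iterate (run P) σ M
  loops P σ = iterate-* (run P) σ N N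

  iterate-invariant : (f : Tables → Tables) (I : ℕ → Tables → Set) {σ : Tables} → I 0 σ →
    (∀ k τ → I k τ → I (suc k) (f τ)) → ∀ k → I k (iterate f σ k)
  iterate-invariant f I {σ} base step zero    = base
  iterate-invariant f I {σ} base step (suc k) = subst (I (suc k)) (sym (iterate-suc f σ k))
    (step k _ (iterate-invariant f I base step k))

  SameTable : Table → Table → Set
  SameTable A B = ∀ x y → x < N → y < N → A x y ≡ B x y

  T-⇔-≡ : ∀ {a b} → T a ⇔ T b → a ≡ b
  T-⇔-≡ {true}  {true}  e = refl
  T-⇔-≡ {false} {false} e = refl
  T-⇔-≡ {true}  {false} e = ⊥-elim (to e tt)
  T-⇔-≡ {false} {true}  e = ⊥-elim (from e tt)

  -- The invariant `I` freezes those other tables on which the next value of `t` depends, so that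
  -- `t` determines its own successor.
  fixed-point : (f : Tables → Tables) (t : Fin 3) (I : Tables → Set) {σ : Tables} → I σ → (∀ τ → I τ → I (f τ)) →
    (∀ τ x y → T (τ t x y) → T (f τ t x y)) →
    (∀ τ τ′ → I τ → I τ′ → SameTable (τ t) (τ′ t) → SameTable (f τ t) (f τ′ t)) →
    SameTable (iterate f σ M t) (f (iterate f σ M) t)
  fixed-point f t I {σ} base step grows determined x y x<N y<N =
    trans (stationary next-equal x x<N y y<N) (cong (λ τ → τ t x y) (iterate-suc f σ M))
    where
    A : ℕ → Table
    A k = iterate f σ k t
    open Stabilisation N A (λ k x y _ _ h → subst (λ τ → T (τ t x y)) (sym (iterate-suc f σ k)) (grows (iterate f σ k) x y h))
    invariant : ∀ k → I (iterate f σ k)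
    invariant = iterate-invariant f (λ _ → I) base (λ _ → step)
    next-equal : ∀ k → Equal k → Equal (suc k)
    next-equal k e x x<N y y<N = trans (cong (λ τ → τ t x y) (iterate-suc f σ k))
      (trans (determined _ _ (invariant k) (invariant (suc k)) (λ x y x<N y<N → e x x<N y y<N) x y x<N y<N)
             (cong (λ τ → τ t x y) (sym (iterate-suc f σ (suc k)))))

  AfterBit : ℕ → Set
  AfterBit x = ∃ λ x′ → x ≡ suc x′ × Bit x′

  data NameView : ℕ → Set where
    empty  : ∀ {x} → ¬ AfterBit x → nm x ≡ [] → NameView x
    longer : ∀ {x b} → K x ≡ bitᵏ b → nm (suc x) ≡ b ∷ nm x → NameView (suc x)

  name-view : ∀ x → NameView x
  name-view zero = empty (λ ()) refl
  name-view (suc zero) = empty (λ { (_ , refl , ()) }) refl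
  name-view (suc (suc i)) with K (suc i) in eq
  ... | bitᵏ b     = longer eq (cong (λ κ → current (absorb κ (sm i))) eq)
  ... | conceptᵏ _ = empty (λ { (_ , refl , h) → subst (T ∘ isBit) eq h }) (cong (λ κ → current (absorb κ (sm i))) eq)
  ... | roleᵏ _    = empty (λ { (_ , refl , h) → subst (T ∘ isBit) eq h }) (cong (λ κ → current (absorb κ (sm i))) eq)
  ... | queryᵏ _   = empty (λ { (_ , refl , h) → subst (T ∘ isBit) eq h }) (cong (λ κ → current (absorb κ (sm i))) eq)
  ... | other      = empty (λ { (_ , refl , h) → subst (T ∘ isBit) eq h }) (cong (λ κ → current (absorb κ (sm i))) eq)

  successor⇔ : ∀ {m} σ (ρ : Vec ℕ m) {p q} → Vec.lookup ρ p < N → Vec.lookup ρ q < N →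
    ⟦ successor p q ⟧ᶠ σ ρ ⇔ Vec.lookup ρ q ≡ suc (Vec.lookup ρ p)
  successor⇔ σ ρ {p} {q} p<N q<N = mk⇔
    (λ { (p<q , gap) → ≤-antisym (≮⇒≥ λ sp<q → split (gap (suc (Vec.lookup ρ p)) (<-trans sp<q q<N)) sp<q) (≰⇒> p<q) })
    (λ e → <⇒≱ (≤-reflexive (sym e)) , λ j _ → Sum.map₂ (λ p<j → ≤-trans (≤-reflexive e) p<j) (≤-<-connex j (Vec.lookup ρ p)))
    where
    split : ∀ {p q} → suc p ≤ p ⊎ q ≤ suc p → suc p < q → ⊥
    split (inj₁ p<p) _    = <-irrefl refl p<p
    split (inj₂ q≤) sp<q = <⇒≱ sp<q q≤

  after-bit⇔ : ∀ {m} σ (ρ : Vec ℕ m) {x} → Vec.lookup ρ x < N → ⟦ after-bit x ⟧ᶠ σ ρ ⇔ AfterBit (Vec.lookup ρ x)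
  after-bit⇔ σ ρ {x} x<N = mk⇔
    (λ { (x′ , x′<N , s , b) → x′ , to (successor⇔ σ (x′ ∷ ρ) {zero} {suc x} x′<N x<N) s , to (letter⇔ {isBit} x′ refl) b })
    (λ { (x′ , e , b) → let x′<N = <-trans (≤-reflexive (sym e)) x<N in
           x′ , x′<N , from (successor⇔ σ (x′ ∷ ρ) {zero} {suc x} x′<N x<N) e , from (letter⇔ {isBit} x′ refl) b })

  Matches : Tables → ℕ → ℕ → Set
  Matches σ x y = (¬ AfterBit x × ¬ AfterBit y)
    ⊎ (∃₂ λ x′ y′ → x ≡ suc x′ × y ≡ suc y′ × (∃ λ b → K x′ ≡ bitᵏ b × K y′ ≡ bitᵏ b) × ¬ T (σ apart x′ y′))

  bit₌⇔ : ∀ x y → (T (maybe (isBitOf true ∘ kind) false (letterAt x)) × T (maybe (isBitOf true ∘ kind) false (letterAt y))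
                 ⊎ T (maybe (isBitOf false ∘ kind) false (letterAt x)) × T (maybe (isBitOf false ∘ kind) false (letterAt y)))
               ⇔ ∃ λ b → K x ≡ bitᵏ b × K y ≡ bitᵏ b
  bit₌⇔ x y = mk⇔
    (λ { (inj₁ (p , q)) → true , to (at-bit x) p , to (at-bit y) q ; (inj₂ (p , q)) → false , to (at-bit x) p , to (at-bit y) q })
    (λ { (true , p , q) → inj₁ (from (at-bit x) p , from (at-bit y) q) ; (false , p , q) → inj₂
      (from (at-bit x) p , from (at-bit y) q) })
    where
    at-bit : ∀ {b} i → T (maybe (isBitOf b ∘ kind) false (letterAt i)) ⇔ K i ≡ bitᵏ b
    at-bit {b} i = letter⇔ {isBitOf b} i refl ⨟ isBitOf⇔ (K i)

  same-names⇔ : ∀ {σ x y} → x < N → y < N → ⟦ same-names ⟧ᶠ σ (y ∷ x ∷ []) ⇔ Matches σ x y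
  same-names⇔ {σ} {x} {y} x<N y<N =
    (¬-cong-⇔ (after-bit⇔ σ (y ∷ x ∷ []) {1F} x<N) ×-⇔ ¬-cong-⇔ (after-bit⇔ σ (y ∷ x ∷ []) {0F} y<N)) ⊎-⇔ mk⇔
      (λ { (x′ , x′<N , y′ , y′<N , sx , sy , b , a) → x′ , y′ ,
             to (successor⇔ σ (y′ ∷ x′ ∷ y ∷ x ∷ []) {1F} {3F} x′<N x<N) sx , to
               (successor⇔ σ (y′ ∷ x′ ∷ y ∷ x ∷ []) {0F} {2F} y′<N y<N) sy , to (bit₌⇔ x′ y′) b , a })
      (λ { (x′ , y′ , ex , ey , b , a) → let x′<N = <-trans (≤-reflexive (sym ex)) x<N ; y′<N = <-trans
                                               (≤-reflexive (sym ey)) y<N in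
             x′ , x′<N , y′ , y′<N ,
             from (successor⇔ σ (y′ ∷ x′ ∷ y ∷ x ∷ []) {1F} {3F} x′<N x<N) ex , from
               (successor⇔ σ (y′ ∷ x′ ∷ y ∷ x ∷ []) {0F} {2F} y′<N y<N) ey , from (bit₌⇔ x′ y′) b , a })

  NamesCorrect : Tables → Set
  NamesCorrect σ = ∀ x y → x < N → y < N → (¬ T (σ apart x y)) ⇔ nm x ≡ nm y

  names : Tables
  names = iterate (run {l = 0} distinguish) ∅ M

  -- That only different names are told apart is an invariant of the iteration. The converse uses
  -- stationarity: names not told apart are both empty, or they end in the same bit and the shorter
  -- names are again not told apart; induction on positions concludes.
  names-correct : NamesCorrect names
  names-correct x y x<N y<N = mk⇔ (complete x y x<N y<N) λ e h → sound M x y x<N y<N h e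
    where
    f : Tables → Tables
    f = run {l = 0} distinguish
    f⇔ : ∀ τ x y → T (f τ apart x y) ⇔ (T (τ apart x y) ⊎ ¬ ⟦ same-names ⟧ᶠ τ (y ∷ x ∷ []))
    f⇔ τ x y = ≔-⇔ {apart} {τ} (rel apart 1F 0F ∨′ ¬′ same-names) x y
    sound : ∀ k x y → x < N → y < N → T (iterate f ∅ k apart x y) → nm x ≢ nm y
    sound = iterate-invariant f (λ _ τ → ∀ x y → x < N → y < N → T (τ apart x y) → nm x ≢ nm y) (λ _ _ _ _ ())
      λ k τ ih x y x<N y<N h e → step τ ih x y x<N y<N e (to (f⇔ τ x y) h)
      where
      step : ∀ τ → (∀ x y → x < N → y < N → T (τ apart x y) → nm x ≢ nm y) → ∀ x y → x < N → y < N → nm x ≡ nm y →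
             T (τ apart x y) ⊎ ¬ ⟦ same-names ⟧ᶠ τ (y ∷ x ∷ []) → ⊥
      step τ ih x y x<N y<N e (inj₁ h) = ih x y x<N y<N h e
      step τ ih x y x<N y<N e (inj₂ h) = h (from (same-names⇔ {τ} x<N y<N) (matches (name-view x) (name-view y)))
        where
        matches : NameView x → NameView y → Matches τ x y
        matches (empty ¬x _) (empty ¬y _) = inj₁ (¬x , ¬y)
        matches (empty _ ex) (longer _ ey) with trans (sym ex) (trans e ey)
        ... | ()
        matches (longer _ ex) (empty _ ey) with trans (sym ex) (trans e ey)
        ... | ()
        matches (longer {x′} {b} kx ex) (longer {y′} {b′} ky ey) with trans (sym ex) (trans e ey)
        ... | bs with Listₚ.∷-injective bs
        ...   | refl , e′ = inj₂ (x′ , y′ , refl , refl , (b , kx , ky) , λ h → ih x′ y′ (<⇒≤ x<N) (<⇒≤ y<N) h e′)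
    settled : SameTable (names apart) (f names apart)
    settled = fixed-point f apart (λ τ → τ fact ≡ ∅ {3} fact × τ bad ≡ ∅ {3} bad) (refl , refl) (λ _ i → i)
      (λ τ x y h → from (f⇔ τ x y) (inj₁ h))
      λ τ τ′ (e₁ , e₂) (e₁′ , e₂′) e → run-cong {l = 0} distinguish
        (λ { apart → e ; fact x y _ _ → cong (λ A → A x y) (trans e₁ (sym e₁′)) ; bad x y _ _ → cong (λ A → A x y)
          (trans e₂ (sym e₂′)) }) apart
    complete : ∀ x y → x < N → y < N → ¬ T (names apart x y) → nm x ≡ nm y
    complete x y x<N y<N ¬h = go x y x<N y<N (to (same-names⇔ {names} x<N y<N)
        (decidable-stable (decide same-names names (y ∷ x ∷ [])) λ ¬s → ¬h
          (subst T (sym (settled x y x<N y<N)) (from (f⇔ names x y) (inj₂ ¬s)))))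
      where
      go : ∀ x y → x < N → y < N → Matches names x y → nm x ≡ nm y
      go x y x<N y<N (inj₁ (¬x , ¬y)) with name-view x | name-view y
      ... | empty _ ex | empty _ ey = trans ex (sym ey)
      ... | longer kx _ | _ = contradiction (_ , refl , subst (T ∘ isBit) (sym kx) tt) ¬x
      ... | _ | longer ky _ = contradiction (_ , refl , subst (T ∘ isBit) (sym ky) tt) ¬y
      go (suc x) (suc y) x<N y<N (inj₂ (x , y , refl , refl , (b , kx , ky) , ¬a)) with name-view (suc x) | name-view (suc y)
      ... | longer kx′ ex | longer ky′ ey = trans ex (trans (cong₂ _∷_
        (bit-injective (trans (sym kx′) (trans kx (trans (sym ky) ky′)))) (complete x y (<⇒≤ x<N) (<⇒≤ y<N) ¬a)) (sym ey))
        where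
        bit-injective : ∀ {b b′} → bitᵏ b ≡ bitᵏ b′ → b ≡ b′
        bit-injective refl = refl
      ... | empty ¬x _ | _ = contradiction (x , refl , subst (T ∘ isBit) (sym kx) tt) ¬x
      ... | _ | empty ¬y _ = contradiction (y , refl , subst (T ∘ isBit) (sym ky) tt) ¬y

  ⟨⟩-injective : ∀ x y → nm x ≡ nm y ⇔ ⟨ x ⟩ ≡ ⟨ y ⟩
  ⟨⟩-injective x y = mk⇔ (cong reverse) Listₚ.reverse-injective

  same⇔ : ∀ σ {m} (ρ : Vec ℕ m) → NamesCorrect σ → ∀ x y → Vec.lookup ρ x < N → Vec.lookup ρ y < N →
    ⟦ same x y ⟧ᶠ σ ρ ⇔ ⟨ Vec.lookup ρ x ⟩ ≡ ⟨ Vec.lookup ρ y ⟩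
  same⇔ σ ρ correct x y x<N y<N = correct (Vec.lookup ρ x) (Vec.lookup ρ y) x<N y<N ⨟ ⟨⟩-injective (Vec.lookup ρ x)
    (Vec.lookup ρ y)

  module Deciding (L : DL) (P N′ : List Raw) (encoded : w ≡ encodeRaws P N′) where
    open Fitting L P N′
    open Encoded L P N′ encoded

    FactsCorrect : (N-C → N-I → Set) → Tables → Set
    FactsCorrect F σ = ∀ p b → p < N → b < N → T (σ fact p b) ⇔ F ⟨ p ⟩ ⟨ b ⟩

    SimCorrect : (N-I → N-I → Set) → Tables → Set
    SimCorrect S σ = ∀ x b → x < N → b < N → (¬ T (σ bad x b)) ⇔ S ⟨ x ⟩ ⟨ b ⟩

    module _ (σ : Tables) (nc : NamesCorrect σ) (S : N-I → N-I → Set) (sc : SimCorrect S σ) where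

      module Pair {x b} (x<N : x < N) (b<N : b < N) where

        ρ : Vec ℕ 2
        ρ = b ∷ x ∷ []

        Forward Backward : N-R → N-I → Set
        Forward r y  = ∃₂ λ k′ c → Has false k′ (role r ⟨ b ⟩ c) × S y c
        Backward r y = ∃₂ λ k′ c → Has false k′ (role r c ⟨ b ⟩) × S y c

        forward⇔ : ∀ q → q < N → ⟦ ∃role false forward-match ⟧ᶠ σ (prev (prev q) ∷ prev q ∷ q ∷ ρ) ⇔ Forward ⟨ prev
          (prev q) ⟩ ⟨ q ⟩
        forward⇔ q q<N = ∃role⇔ σ ρ′ false forward-match (λ k r a c → r ≡ ⟨ prev (prev q) ⟩ × a ≡ ⟨ b ⟩ × S ⟨ q ⟩ c) (λ q′ q′<N →
            let ρ″ = prev (prev q′) ∷ prev q′ ∷ q′ ∷ ρ′ in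
            same⇔ σ ρ″ nc 0F 3F (prev<N (prev<N q′<N)) (prev<N (prev<N q<N)) ×-⇔
              (same⇔ σ ρ″ nc 1F 6F (prev<N q′<N) b<N ×-⇔ sc q q′ q<N q′<N))
          ⨟ mk⇔ (λ { (k , _ , _ , c , has , refl , refl , s) → k , c , has , s })
                (λ { (k , c , has , s) → k , _ , _ , c , has , refl , refl , s })
          where
          ρ′ : Vec ℕ 5
          ρ′ = prev (prev q) ∷ prev q ∷ q ∷ ρ

        backward⇔ : ∀ q → q < N → ⟦ ∃role false backward-match ⟧ᶠ σ (prev (prev q) ∷ prev q ∷ q ∷ ρ) ⇔ Backward ⟨ prev
          (prev q) ⟩ ⟨ prev q ⟩
        backward⇔ q q<N = ∃role⇔ σ ρ′ false backward-match (λ k r c a → r ≡ ⟨ prev (prev q) ⟩ × a ≡ ⟨ b ⟩ × S ⟨ prev q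
          ⟩ c) (λ q′ q′<N →
            let ρ″ = prev (prev q′) ∷ prev q′ ∷ q′ ∷ ρ′ in
            same⇔ σ ρ″ nc 0F 3F (prev<N (prev<N q′<N)) (prev<N (prev<N q<N)) ×-⇔
              (same⇔ σ ρ″ nc 2F 6F q′<N b<N ×-⇔ sc (prev q) (prev q′) (prev<N q<N) (prev<N q′<N)))
          ⨟ mk⇔ (λ { (k , _ , c , _ , has , refl , refl , s) → k , c , has , s })
                (λ { (k , c , has , s) → k , _ , c , _ , has , refl , refl , s })
          where
          ρ′ : Vec ℕ 5
          ρ′ = prev (prev q) ∷ prev q ∷ q ∷ ρ

        local⇔ : ∀ F → FactsCorrect F σ → ⟦ local L ⟧ᶠ σ ρ ⇔ Local F S ⟨ x ⟩ ⟨ b ⟩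
        local⇔ F fc =
          (∀concept⇔ σ ρ true concept-step (λ k A a → a ≡ ⟨ x ⟩ → F A ⟨ b ⟩) (λ q q<N →
              →-cong-⇔ (same⇔ σ (prev q ∷ q ∷ ρ) nc 1F 3F q<N x<N) (fc _ _ (prev<N q<N) b<N))
            ⨟ mk⇔ (λ f {k} {A} has → f has refl) (λ { f {k} {A} {a} has refl → f has }))
          ×-⇔
          ((∀role⇔ σ ρ true forward-step (λ k r a y → a ≡ ⟨ x ⟩ → Forward r y) (λ q q<N →
              →-cong-⇔ (same⇔ σ (prev (prev q) ∷ prev q ∷ q ∷ ρ) nc 1F 4F (prev<N q<N) x<N) (forward⇔ q q<N))
            ⨟ mk⇔ (λ f {k} {r} {y} has → f has refl) (λ { f {k} {r} {a} {y} has refl → f has }))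
          ×-⇔
           only-if⇔ (admits-inverse L) (∀role true backward-step)
             (∀role⇔ σ ρ true backward-step (λ k r y a → a ≡ ⟨ x ⟩ → Backward r y) (λ q q<N →
              →-cong-⇔ (same⇔ σ (prev (prev q) ∷ prev q ∷ q ∷ ρ) nc 2F 4F q<N x<N) (backward⇔ q q<N))
            ⨟ mk⇔ (λ f {k} {r} {y} has → f has refl) (λ { f {k} {r} {y} {a} has refl → f has })))

      simulated⇔ : ∀ {m} (ρ : Vec ℕ m) x → Vec.lookup ρ x < N → ⟦ simulated x ⟧ᶠ σ ρ ⇔ Simulated S ⟨ Vec.lookup ρ x ⟩
      simulated⇔ ρ x x<N = ∃ind⇔ σ ρ false (¬′ rel bad (suc (suc x)) 0F) (λ k b → S ⟨ Vec.lookup ρ x ⟩ b)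
          (λ q z q<N z<N → sc (Vec.lookup ρ x) z x<N z<N)
        ⨟ mk⇔ (λ (k , b , i , s) → b , (k , i) , s) (λ (b , (k , i) , s) → k , b , i , s)

      consistent⇔ : ∀ {x b} q → q < N → ⟦ consistent ⟧ᶠ σ (prev q ∷ q ∷ b ∷ x ∷ []) ⇔
        (∀ {z} → Ind true (exNo q) z → Simulated S z)
      consistent⇔ {x} {b} q q<N = ∀ind⇔ σ ρ true (sameEx 1F 3F ⇒′ simulated 0F) (λ k z → k ≡ exNo q → Simulated S z)
        (λ q′ z q′<N z<N →
            →-cong-⇔ (sameEx⇔ σ (z ∷ q′ ∷ ρ) {1F} {3F} q′<N q<N) (simulated⇔ (z ∷ q′ ∷ ρ) 0F z<N))
          ⨟ mk⇔ (λ f {z} i → f i refl) (λ { f {k} {z} i refl → f i })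
        where
        ρ : Vec ℕ 4
        ρ = prev q ∷ q ∷ b ∷ x ∷ []

      fires⇔ : ∀ {x b} → x < N → b < N → ⟦ fires L ⟧ᶠ σ (b ∷ x ∷ []) ⇔ Fires S ⟨ x ⟩ ⟨ b ⟩
      fires⇔ {x} {b} x<N b<N =
        (∃ind⇔ σ ρ false (same 0F 2F) (λ k z → z ≡ ⟨ b ⟩) (λ q z q<N z<N → same⇔ σ (z ∷ q ∷ ρ) nc 0F 2F z<N b<N)
          ⨟ mk⇔ (λ { (k , _ , i , refl) → k , i }) (λ (k , i) → k , _ , i , refl))
        ×-⇔
        (∃query⇔ σ ρ true (same 0F 3F ∧′ ¬′ rel bad 1F 2F ∧′ only-if (admits-⊥ L) consistent)
            (λ k Q a → Q ≡ ⟨ x ⟩ × S a ⟨ b ⟩ × (T (admits-⊥ L) → ∀ {z} → Ind true k z → Simulated S z)) (λ q q<N →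
            same⇔ σ (prev q ∷ q ∷ ρ) nc 0F 3F (prev<N q<N) x<N ×-⇔ (sc q b q<N b<N ×-⇔
            only-if⇔ (admits-⊥ L) consistent (consistent⇔ {x} {b} q q<N)))
          ⨟ mk⇔ (λ { (k , _ , a , query , refl , s , f) → k , a , query , s , f })
                (λ { (k , a , query , s , f) → k , _ , a , query , refl , s , f }))
        where
        ρ : Vec ℕ 2
        ρ = b ∷ x ∷ []

    module Refining (F : N-C → N-I → Set) (σ₀ : Tables) (nc : NamesCorrect σ₀) (fc : FactsCorrect F σ₀)
                    (clear : ∀ x b → ¬ T (σ₀ bad x b)) where

      f : Tables → Tables
      f = run {l = 0} (refine L)

      refined : ℕ → Tables
      refined = iterate f σ₀

      kept : ∀ k → refined k apart ≡ σ₀ apart × refined k fact ≡ σ₀ fact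
      kept = iterate-invariant f (λ _ τ → τ apart ≡ σ₀ apart × τ fact ≡ σ₀ fact) (refl , refl) (λ _ _ e → e)

      refined-names : ∀ k → NamesCorrect (refined k)
      refined-names k x y x<N y<N = subst (λ A → (¬ T (A x y)) ⇔ nm x ≡ nm y) (sym (proj₁ (kept k))) (nc x y x<N y<N)

      refined-facts : ∀ k → FactsCorrect F (refined k)
      refined-facts k p b p<N b<N = subst (λ A → T (A p b) ⇔ F ⟨ p ⟩ ⟨ b ⟩) (sym (proj₂ (kept k))) (fc p b p<N b<N)

      refine⇔ : ∀ τ x b → T (f τ bad x b) ⇔ (T (τ bad x b) ⊎ ¬ ⟦ local L ⟧ᶠ τ (b ∷ x ∷ []))
      refine⇔ τ x b = ≔-⇔ {bad} {τ} (rel bad 1F 0F ∨′ ¬′ local L) x b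

      -- The table holds the complement of the simulation; the double negation caused by this is
      -- removed by deciding the formula.
      refine-step : ∀ k → SimCorrect (Sim F k) (refined k) → SimCorrect (Sim F (suc k)) (f (refined k))
      refine-step k sc x b x<N b<N =
        ¬-cong-⇔ (refine⇔ (refined k) x b)
        ⨟ mk⇔ (λ ¬h → (¬h ∘ inj₁) , decidable-stable (decide (local L) (refined k) (b ∷ x ∷ [])) (¬h ∘ inj₂))
              (λ { (¬t , _) (inj₁ t) → ¬t t ; (_ , l) (inj₂ ¬l) → ¬l l })
        ⨟ sc x b x<N b<N ×-⇔ Pair.local⇔ (refined k) (refined-names k) (Sim F k) sc x<N b<N F (refined-facts k)

      refined-sims : ∀ k → SimCorrect (Sim F k) (refined k)
      refined-sims zero    x b x<N b<N = mk⇔ _ λ _ → clear x b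
      refined-sims (suc k) = subst (SimCorrect (Sim F (suc k))) (sym (iterate-suc f σ₀ k)) (refine-step k (refined-sims k))

      settled : SameTable (refined M bad) (f (refined M) bad)
      settled = fixed-point f bad (λ τ → τ apart ≡ σ₀ apart × τ fact ≡ σ₀ fact) (refl , refl) (λ _ e → e)
        (λ τ x y h → from (refine⇔ τ x y) (inj₁ h))
        λ τ τ′ (e₁ , e₂) (e₁′ , e₂′) e → run-cong {l = 0} (refine L)
          (λ { apart x y _ _ → cong (λ A → A x y) (trans e₁ (sym e₁′)) ; fact x y _ _ → cong (λ A → A x y)
            (trans e₂ (sym e₂′)) ; bad → e }) bad

      -- Another refinement changes nothing, so a pair that survives `M` of them also survives the
      -- next, which is the local test against the pairs still present.
      settled-local : ∀ x b → x < N → b < N → Sim F M ⟨ x ⟩ ⟨ b ⟩ → Local F (Sim F M) ⟨ x ⟩ ⟨ b ⟩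
      settled-local x b x<N b<N s = proj₂ (to (refine-step M (refined-sims M) x b x<N b<N)
        (from (refined-sims M x b x<N b<N) s ∘ subst T (sym (settled x b x<N b<N))))

    reset : Tables → Tables
    reset = run {l = 0} (bad ≔ ¬′ ⊤′)

    reset-clear : ∀ σ x b → ¬ T (reset σ bad x b)
    reset-clear σ x b h = to (≔-⇔ {bad} {σ} (¬′ ⊤′) x b) h λ _ _ → ≤-refl

    next-round : Tables → Tables
    next-round σ = run {l = 0} (derive L) (iterate (run {l = 0} (refine L)) (reset σ) M)

    round≡ : ∀ σ → run (round L) σ ≡ next-round σ
    round≡ σ = cong (run {l = 0} (derive L)) (loops (refine {0} L) (reset σ))

    derive⇔ : ∀ τ p b → T (run {l = 0} (derive L) τ fact p b) ⇔ (T (τ fact p b) ⊎ ⟦ fires L ⟧ᶠ τ (b ∷ p ∷ []))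
    derive⇔ τ p b = ≔-⇔ {fact} {τ} (rel fact 1F 0F ∨′ fires L) p b

    base : Tables
    base = run {l = 0} (fact ≔ initially) names

    base-facts : FactsCorrect (Facts M 0) base
    base-facts p b p<N b<N = ≔-⇔ {fact} {names} initially p b
      ⨟ ∃concept⇔ names (b ∷ p ∷ []) false (same 0F 3F ∧′ same 1F 2F) (λ k A a → A ≡ ⟨ p ⟩ × a ≡ ⟨ b ⟩) (λ q q<N →
          same⇔ names (prev q ∷ q ∷ b ∷ p ∷ []) names-correct 0F 3F (prev<N q<N) p<N ×-⇔ same⇔ names
            (prev q ∷ q ∷ b ∷ p ∷ []) names-correct 1F 2F q<N b<N)
      ⨟ mk⇔ (λ { (k , _ , _ , has , refl , refl) → k , has }) (λ (k , has) → k , _ , _ , has , refl , refl)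

    stage : ℕ → Tables
    stage = iterate (run (round L)) base

    Invariant : ℕ → Tables → Set
    Invariant t σ = NamesCorrect σ × FactsCorrect (Facts M t) σ

    module Round {t σ} (inv : Invariant t σ) =
      Refining (Facts M t) (reset σ) (proj₁ inv) (proj₂ inv) (reset-clear σ)

    round-step : ∀ t σ → Invariant t σ → Invariant (suc t) (next-round σ)
    round-step t σ inv = R.refined-names M , λ p b p<N b<N → derive⇔ (R.refined M) p b
      ⨟ R.refined-facts M p b p<N b<N ⊎-⇔ fires⇔ (R.refined M) (R.refined-names M) (Sim (Facts M t) M) (R.refined-sims M) p<N b<N
      where
      module R = Round {t} {σ} inv

    invariant : ∀ t → Invariant t (stage t)
    invariant = iterate-invariant (run (round L)) Invariant (names-correct , base-facts)
      λ t σ inv → subst (Invariant (suc t)) (sym (round≡ σ)) (round-step t σ inv)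

    round-kept : ∀ σ → next-round σ apart ≡ σ apart
    round-kept σ = iterate-invariant (run {l = 0} (refine L)) (λ _ τ → τ apart ≡ σ apart) refl (λ _ _ e → e) M

    round-grows : ∀ σ p b → T (σ fact p b) → T (next-round σ fact p b)
    round-grows σ p b h = from (derive⇔ (iterate (run {l = 0} (refine L)) (reset σ) M) p b)
      (inj₁ (subst (λ A → T (A p b)) (sym (iterate-invariant (run {l = 0} (refine L)) (λ _ τ → τ fact ≡ σ fact) refl
        (λ _ _ e → e) M)) h))

    -- The reset empties `bad` in both cases, so the simulation of the previous round has no
    -- influence.
    round-determined : ∀ σ τ → σ apart ≡ τ apart → SameTable (σ fact) (τ fact) → run (round L) σ ≋ run (round L) τ
    round-determined σ τ e e′ = run-cong {l = 2} (loop (loop (refine L)) ⨾ derive L) λ where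
      apart x y _ _ → cong (λ A → A x y) e
      fact          → e′
      bad x y _ _   → T-⇔-≡ (mk⇔ (⊥-elim ∘ reset-clear σ x y) (⊥-elim ∘ reset-clear τ x y))

    settled : SameTable (stage M fact) (next-round (stage M) fact)
    settled x y x<N y<N = trans
      (fixed-point (run (round L)) fact (λ τ → τ apart ≡ names apart) refl
        (λ τ e → trans (cong (λ τ → τ apart) (round≡ τ)) (trans (round-kept τ) e))
        (λ τ p b h → subst (λ τ → T (τ fact p b)) (sym (round≡ τ)) (round-grows τ p b h))
        (λ τ τ′ e e′ same → round-determined τ τ′ (trans e (sym e′)) same fact) x y x<N y<N)
      (cong (λ τ → τ fact x y) (round≡ (stage M)))

    -- The names in question occur in the input, hence at positions, where the stationary table
    -- `fact` can be consulted.
    closed-facts : ∀ {Q b} → Fires (Sim (Facts M M) M) Q b → Facts M M Q b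
    closed-facts fires@((k , i) , k′ , a , query , _) =
      query-at (λ _ Q _ → Fires S Q _ → Facts M M Q _) query (λ q q<N _ fires →
        Ind⇒occurs (stage M) [] (λ _ b → Fires S ⟨ prev q ⟩ b → Facts M M ⟨ prev q ⟩ b) i
          (λ _ z _ z<N _ fires → to (proj₂ (invariant M) (prev q) z (prev<N q<N) z<N)
            (subst T (sym (settled (prev q) z (prev<N q<N) z<N))
              (from (proj₂ (round-step M (stage M) (invariant M)) (prev q) z (prev<N q<N) z<N) (inj₂ fires))))
          fires) fires
      where
      S = Sim (Facts M M) M

    closed-sims : ∀ {t k x b} → Ind true k x → Negative b → Sim (Facts M t) M x b → Local (Facts M t) (Sim (Facts M t) M) x b
    closed-sims {t} i (_ , i′) s =
      Ind⇒occurs (stage t) [] (λ _ x → Sim (Facts M t) M x _ → Local (Facts M t) (Sim (Facts M t) M) x _) i (λ _ x _ x<N _ s →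
        Ind⇒occurs (stage t) [] (λ _ b → Sim (Facts M t) M ⟨ x ⟩ b → Local (Facts M t) (Sim (Facts M t) M) ⟨ x ⟩ b) i′
          (λ _ b _ b<N _ s → Round.settled-local {t} {stage t} (invariant t) x b x<N b<N s) s) s

    -- Decidability is drawn from the computation: a formula is decided in the tables refined from
    -- the last stage.
    simulated? : ∀ {k x} → Ind true k x → Dec (Simulated (Sim (Facts M M) M) x)
    simulated? i = Ind⇒occurs (stage M) [] (λ _ x → Dec (Simulated (Sim (Facts M M) M) x)) i λ _ z _ z<N _ →
      map′ (to (sim⇔ z z<N)) (from (sim⇔ z z<N)) (decide (simulated 0F) (R.refined M) (z ∷ []))
      where
      module R = Round {M} {stage M} (invariant M)
      sim⇔ : ∀ z → z < N → ⟦ simulated 0F ⟧ᶠ (R.refined M) (z ∷ []) ⇔ Simulated (Sim (Facts M M) M) ⟨ z ⟩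
      sim⇔ z z<N = simulated⇔ (R.refined M) (R.refined-names M) (Sim (Facts M M) M) (R.refined-sims M) (z ∷ []) 0F z<N

    final≡ : run (fitting L) ∅ ≡ stage M
    final≡ = trans (loops (round L) _) (cong (λ τ → iterate (run (round L)) (run {l = 0} (fact ≔ initially) τ) M)
      (loops (distinguish {2}) ∅))

    query-valid⇔ : ∀ σ → NamesCorrect σ → ∀ sg → ⟦ query-valid sg ⟧ᶠ σ [] ⇔ (∀ {k Q a} → Query sg k Q a → Ind sg k a)
    query-valid⇔ σ nc sg = ∀query⇔ σ [] sg (∃ind sg (sameEx 1F 3F ∧′ same 0F 3F)) (λ k Q a → Ind sg k a) λ q q<N →
      ∃ind⇔ σ (prev q ∷ q ∷ []) sg (sameEx 1F 3F ∧′ same 0F 3F) (λ k z → k ≡ exNo q × z ≡ ⟨ q ⟩) (λ q′ z q′<N z<N →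
        sameEx⇔ σ (z ∷ q′ ∷ prev q ∷ q ∷ []) {1F} {3F} q′<N q<N ×-⇔ same⇔ σ (z ∷ q′ ∷ prev q ∷ q ∷ []) nc 0F 3F z<N q<N)
      ⨟ mk⇔ (λ { (_ , _ , i , refl , refl) → i }) (λ i → _ , _ , i , refl , refl)

    disjoint-valid⇔ : ∀ σ → NamesCorrect σ → ∀ sg sg′ → ⟦ disjoint-valid sg sg′ ⟧ᶠ σ [] ⇔
      (∀ {k x} → Ind sg k x → ∀ {k′} → Ind sg′ k′ x → k ≡ k′)
    disjoint-valid⇔ σ nc sg sg′ = ∀ind⇔ σ [] sg (∀ind sg′ (same 2F 0F ⇒′ sameEx 3F 1F))
      (λ k x → ∀ {k′} → Ind sg′ k′ x → k ≡ k′) λ q z q<N z<N →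
      ∀ind⇔ σ (z ∷ q ∷ []) sg′ (same 2F 0F ⇒′ sameEx 3F 1F) (λ k z′ → ⟨ z ⟩ ≡ z′ → exNo q ≡ k) (λ q′ z′ q′<N z′<N →
        →-cong-⇔ (same⇔ σ (z′ ∷ q′ ∷ z ∷ q ∷ []) nc 2F 0F z<N z′<N) (sameEx⇔ σ (z′ ∷ q′ ∷ z ∷ q ∷ []) {3F} {1F} q<N q′<N))
      ⨟ mk⇔ (λ f {k} i → f i refl) (λ { f {k} {x} i refl → f i })

    rejects⇔ : ∀ {F σ} → FactsCorrect F σ → ⟦ ∃query false (rel fact 0F 1F) ⟧ᶠ σ [] ⇔ Rejects F
    rejects⇔ {F} {σ} fc = ∃query⇔ σ [] false (rel fact 0F 1F) (λ k Q a → F Q a) λ q q<N → fc (prev q) q (prev<N q<N) q<N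

    accepting⇔ : ⟦ accepting ⟧ᶠ (stage M) [] ⇔ (⟦ syntax-valid ⟧ᶠ (stage M) [] × QueryInd × Disjoint-Inds × ¬ Rejects (Facts M M))
    accepting⇔ = ⇔-id _ ×-⇔
      ((query-valid⇔ (stage M) nc true ×-⇔ query-valid⇔ (stage M) nc false) ⨟ query-signs) ×-⇔
      (((disjoint-valid⇔ (stage M) nc true true ×-⇔ disjoint-valid⇔ (stage M) nc true false) ×-⇔
        (disjoint-valid⇔ (stage M) nc false true ×-⇔ disjoint-valid⇔ (stage M) nc false false))
        ⨟ disjoint-signs) ×-⇔
      ¬-cong-⇔ (rejects⇔ {Facts M M} {stage M} (proj₂ (invariant M)))
      where
      nc = proj₁ (invariant M)
      QueriesIn : Bool → Set
      QueriesIn sg = ∀ {k Q a} → Query sg k Q a → Ind sg k a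
      query-signs : (QueriesIn true × QueriesIn false) ⇔ QueryInd
      query-signs = mk⇔ (λ h {sg} {k} {Q} {a} q → both h sg {k} {Q} {a} q)
        (λ f → (λ {k} {Q} {a} q → f {true} {k} {Q} {a} q) , (λ {k} {Q} {a} q → f {false} {k} {Q} {a} q))
        where
        both : QueriesIn true × QueriesIn false → ∀ sg → QueriesIn sg
        both (h , _) true  = h
        both (_ , h) false = h
      Apart : Bool → Bool → Set
      Apart sg sg′ = ∀ {k x} → Ind sg k x → ∀ {k′} → Ind sg′ k′ x → k ≡ k′
      disjoint-signs : ((Apart true true × Apart true false) × (Apart false true × Apart false false)) ⇔ Disjoint-Inds
      disjoint-signs = mk⇔ (λ h {sg} {sg′} {k} {k′} {x} i j → all h sg sg′ {k} {x} i {k′} j)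
        (λ f → let one : ∀ sg sg′ → Apart sg sg′
                   one sg sg′ {k} {x} i {k′} j = f {sg} {sg′} {k} {k′} {x} i j
               in (one true true , one true false) , (one false true , one false false))
        where
        all : ((Apart true true × Apart true false) × (Apart false true × Apart false false)) → ∀ sg sg′ → Apart sg sg′
        all ((h , _) , _) true  true  = h
        all ((_ , h) , _) true  false = h
        all (_ , (h , _)) false true  = h
        all (_ , (_ , h)) false false = h

  letterAt-end : ∀ q u x → ∃ λ ℓ → nth nothing (map just (annotate δ q (x ∷ u))) (length u) ≡ just ℓ × stateOf ℓ ≡ end
    (stateOf q) (x ∷ u)
  letterAt-end q []      x = δ q x , refl , refl
  letterAt-end q (y ∷ u) x = letterAt-end (δ q x) u y

  isFinal⇔ : ∀ ℓ → T (isFinal ℓ) ⇔ stateOf ℓ ≡ (between , false)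
  isFinal⇔ (between  , false , _) = mk⇔ (λ _ → refl) _
  isFinal⇔ (between  , true  , _) = mk⇔ (λ ()) λ ()
  isFinal⇔ (Fin.suc c , _ , _)    = mk⇔ (λ ()) λ ()

  syntax-valid⇔ : ∀ σ → ⟦ syntax-valid ⟧ᶠ σ [] ⇔ end (between , true) w ≡ (between , false)
  syntax-valid⇔ σ = mk⇔
      (λ { (x , x<N , l , greatest) → to at-end (subst (λ i → T (maybe isFinal false (letterAt i)))
        (≤-antisym (s≤s⁻¹ x<N) (greatest (length v) ≤-refl)) l) })
      (λ e → length v , ≤-refl , from at-end e , λ y y<N → s≤s⁻¹ y<N)
    where
    ends : ∀ u → T (maybe isFinal false (Semantics.letterAt {NT = 3} (annotate δ q₀ u) (length (annotate δ q₀ u)))) ⇔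
      end (between , true) u ≡ (between , false)
    ends [] = mk⇔ (λ ()) λ ()
    ends (x ∷ u) rewrite annotate-length δ (δ q₀ x) u with letterAt-end q₀ u x
    ... | ℓ , e , e′ rewrite e = isFinal⇔ ℓ ⨟ mk⇔ (trans (sym e′)) (trans e′)
    at-end = ends w

-- From raw examples back to collections

module _ {A : Set} where

  At-++ˡ : ∀ {xs ys : List A} {k x} → At xs k x → At (xs ++ ys) k x
  At-++ˡ here      = here
  At-++ˡ (there p) = there (At-++ˡ p)

  At-++ʳ : ∀ xs {ys : List A} {k x} → At ys k x → At (xs ++ ys) (length xs + k) x
  At-++ʳ []       p = p
  At-++ʳ (_ ∷ xs) p = there (At-++ʳ xs p)

  At-++⁻ : ∀ xs {ys : List A} {k x} → At (xs ++ ys) k x → At xs k x ⊎ (∃ λ j → k ≡ length xs + j × At ys j x)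
  At-++⁻ []       p    = inj₂ (_ , refl , p)
  At-++⁻ (_ ∷ xs) here = inj₁ here
  At-++⁻ (_ ∷ xs) (there p) with At-++⁻ xs p
  ... | inj₁ q             = inj₁ (there q)
  ... | inj₂ (j , refl , q) = inj₂ (j , refl , q)

  At-map⁺ : ∀ {B : Set} (f : A → B) {xs k x} → At xs k x → At (map f xs) k (f x)
  At-map⁺ f here      = here
  At-map⁺ f (there p) = there (At-map⁺ f p)

  At-map⁻ : ∀ {B : Set} (f : A → B) {xs k y} → At (map f xs) k y → ∃ λ x → At xs k x × y ≡ f x
  At-map⁻ f {x ∷ xs} here = x , here , refl
  At-map⁻ f {x ∷ xs} (there p) with At-map⁻ f p
  ... | y , q , e = y , there q , e

  AllPairs⁺ : ∀ {R : A → A → Set} {xs} → (∀ {i j x y} → i < j → At xs i x → At xs j y → R x y) → AllPairs R xs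
  AllPairs⁺ {xs = []}     f = []
  AllPairs⁺ {xs = x ∷ xs} f = All.tabulate (λ y∈ → let (_ , at) = ∈⇒At y∈ in f z<s here (there at)) ∷
    AllPairs⁺ (λ i<j p q → f (s<s i<j) (there p) (there q))

  AllPairs⁻ : ∀ {R : A → A → Set} {xs} → AllPairs R xs → ∀ {i j x y} → i < j → At xs i x → At xs j y → R x y
  AllPairs⁻ (r ∷ rs) _         here      (there q) = All.lookup r (At⇒∈ q)
  AllPairs⁻ (r ∷ rs) (s<s i<j) (there p) (there q) = AllPairs⁻ rs i<j p q

-- Parsing produces ABoxes and queries without the proof that the queried individual occurs; the
-- sentence `query-valid` supplies it afterwards.
raw : Example → Raw
raw e = Example.abox e , Example.query e

encode≡ : ∀ E → encode E ≡ encodeRaws (map raw (Collection.positive E)) (map raw (Collection.negative E))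
encode≡ E = cong₂ (λ u u′ → u ++ vbar ∷ u′) (examples (Collection.positive E)) (examples (Collection.negative E))
  where
  examples : ∀ es → concatMap encodeExample es ≡ concatMap encodeRaw (map raw es)
  examples es = cong concat (Listₚ.map-∘ es)

module _ (L : DL) (pos neg : List Example) where
  open Fitting L (map raw pos) (map raw neg)

  Ex⇒At : ∀ {sg k e} → Ex sg k e → ∃ λ x → At (pos ++ neg) k x × e ≡ raw x
  Ex⇒At {true} at = let (x , at′ , e) = At-map⁻ raw at in x , At-++ˡ at′ , e
  Ex⇒At {false} (j , refl , at) = let (x , at′ , e) = At-map⁻ raw at in
    x , subst (λ n → At (pos ++ neg) (n + j) x) (sym (Listₚ.length-map raw pos)) (At-++ʳ pos at′) , e

  At⇒Ex : ∀ {k x} → At (pos ++ neg) k x → ∃ λ sg → Ex sg k (raw x)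
  At⇒Ex at with At-++⁻ pos at
  ... | inj₁ at′              = true , At-map⁺ raw at′
  ... | inj₂ (j , refl , at′) = false , j , cong (_+ j) (sym (Listₚ.length-map raw pos)) , At-map⁺ raw at′

  queries-in : QueryInd
  queries-in {sg} {k} {Q} {a} (𝒜 , ex) = let (x , _ , e) = Ex⇒At {sg} ex in
    ∈ind⇒Ind {sg} ex (subst (λ (𝒜 , q) → AQ.individual q ∈ ind 𝒜) (sym e) (Example.query∈ind x))

  Apart : Set
  Apart = AllPairs (λ e f → Disjoint (ind (Example.abox e)) (ind (Example.abox f))) (pos ++ neg)

  Ind⇒At : ∀ {sg k x} → Ind sg k x → ∃ λ e → At (pos ++ neg) k e × x ∈ ind (Example.abox e)
  Ind⇒At {sg} i@(_ , (_ , ex , _) , _) with Ex⇒At {sg} ex | Ind⇒∈ind {sg} ex i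
  ... | e , at , refl | x∈ = e , at , x∈

  apart⇒disjoint : Apart → Disjoint-Inds
  apart⇒disjoint apart′ {sg} {sg′} {k} {k′} i j with Ind⇒At {sg} i | Ind⇒At {sg′} j | <-cmp k k′
  ... | e , at , x∈ | e′ , at′ , x∈′ | tri< k<k′ _ _ = ⊥-elim (AllPairs⁻ apart′ k<k′ at at′ (x∈ , x∈′))
  ... | e , at , x∈ | e′ , at′ , x∈′ | tri≈ _ k≡k′ _ = k≡k′
  ... | e , at , x∈ | e′ , at′ , x∈′ | tri> _ _ k′<k = ⊥-elim (AllPairs⁻ apart′ k′<k at′ at (x∈′ , x∈))

  disjoint⇒apart : Disjoint-Inds → Apart
  disjoint⇒apart disjoint = AllPairs⁺ λ i<j p q (v∈ , v∈′) → let (sg , ex) = At⇒Ex p ; (sg′ , ex′) = At⇒Ex q in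
    <⇒≢ i<j (disjoint {sg} {sg′} (∈ind⇒Ind {sg} ex v∈) (∈ind⇒Ind {sg′} ex′ v∈′))

examples : ∀ es → (∀ {k e} → At es k e → AQ.individual (proj₂ e) ∈ ind (proj₁ e)) → ∃ λ xs → es ≡ map raw xs
examples []             f = [] , refl
examples ((𝒜 , q) ∷ es) f with examples es (f ∘ there)
... | xs , refl = record { abox = 𝒜 ; query = q ; query∈ind = f here } ∷ xs , refl

module _ (L : DL) (w : List Symbol) where
  open Positions w
  open Running w

  fits⇒accepted : OntologyFitting L w → ⟦ accepting ⟧ᶠ (run (fitting L) ∅) []
  fits⇒accepted (E , w≡ , 𝒪 , is , entailed , notEntailed) = subst (λ σ → ⟦ accepting ⟧ᶠ σ []) (sym final≡) (from accepting⇔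
    ( from (syntax-valid⇔ (stage M)) (trans (cong (end (between , true)) encoded) (end-encoding P N′))
    , (λ {sg} → queries {sg})
    , (λ {sg} {sg′} → disjoint {sg} {sg′})
    , Fitting.Necessary.necessary L P N′ queries disjoint M (λ {t} → closed-sims {t}) is (Allₚ.map⁺ entailed) M
      (Allₚ.map⁺ notEntailed)))
    where
    open Collection E
    P N′ : List Raw
    P  = map raw positive
    N′ = map raw negative
    encoded : w ≡ encodeRaws P N′
    encoded = trans w≡ (encode≡ E)
    open Deciding L P N′ encoded
    queries : Fitting.QueryInd L P N′
    queries {sg} = queries-in L positive negative {sg}
    disjoint : Fitting.Disjoint-Inds L P N′
    disjoint {sg} {sg′} = apart⇒disjoint L positive negative disjoint-inds {sg} {sg′}

  accepted⇒fits : ⟦ accepting ⟧ᶠ (run (fitting L) ∅) [] → OntologyFitting L w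
  accepted⇒fits h = let (P , N′ , encoded) = parse between true w (to (syntax-valid⇔ (run (fitting L) ∅)) (proj₁ h))
                          in parsed P N′ encoded
    where
    -- The lists are arguments, so that matching on the equations can replace them by the raw forms
    -- of proper examples in everything that depends on them.
    build : ∀ P N′ → w ≡ encodeRaws P N′ → Fitting.QueryInd L P N′ →
      (∃ λ pos → P ≡ map raw pos) → (∃ λ neg → N′ ≡ map raw neg) → Fitting.Disjoint-Inds L P N′ →
      (∃ λ 𝒪 → IsOntology L 𝒪 × All (Entailedᴿ 𝒪) P × All (¬_ ∘ Entailedᴿ 𝒪) N′) → OntologyFitting L w
    build _ _ encoded _ (pos , refl) (neg , refl) disjoint (𝒪 , is , entailed , notEntailed) =
      E , trans encoded (sym (encode≡ E)) , 𝒪 , is , Allₚ.map⁻ entailed , Allₚ.map⁻ notEntailed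
      where
      E : Collection
      E = record { positive = pos ; negative = neg ; disjoint-inds = disjoint⇒apart L pos neg disjoint }
    parsed : ∀ P N′ → w ≡ encodeRaws P N′ → OntologyFitting L w
    parsed P N′ encoded = build P N′ encoded queries
        (examples P λ at → Fitting.Ind⇒∈ind L P N′ {true} at (queries {true} (_ , at)))
        (examples N′ λ at → Fitting.Ind⇒∈ind L P N′ {false} (_ , refl , at) (queries {false} (_ , _ , refl , at)))
        disjoint
        (Fitting.Sufficient.sufficient L P N′ queries disjoint M M closed-facts simulated? (proj₂ (proj₂ (proj₂ valid))))
      where
      open Deciding L P N′ encoded
      valid = to accepting⇔ (subst (λ σ → ⟦ accepting ⟧ᶠ σ []) final≡ h)
      queries : Fitting.QueryInd L P N′
      queries {sg} = proj₁ (proj₂ valid) {sg}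
      disjoint : Fitting.Disjoint-Inds L P N′
      disjoint {sg} {sg′} = proj₁ (proj₂ (proj₂ valid)) {sg} {sg′}

theorem4 : ∀ (L : DL) → InPTime (OntologyFitting L)
theorem4 L = definable∈P Finite-Symbol Finite-Letter δ q₀ (fitting L) accepting λ w → mk⇔ (accepted⇒fits L w) (fits⇒accepted L w)
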